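{- Let $B:=(2,\{00,11\})$, that is, $B$ is the pattern consisting of two isolated loops. Then $\lambda_{5,4}=5/8$, the $(5,4)$-edge-inducibility problem is perfectly $B$-stable, and the unique maximizer of $\lambda_{5,4}(B(\mathbf{a}))$ over $\mathbf{a}\in\mathbb{S}_2$ is $\mathbf{a}=(1/2,1/2)$.
   Context: Graphs are finite and simple. $[m]:=\{0,\dots,m-1\}$, $ij$ abbreviates the unordered pair $\{i,j\}$ (with $ii$ denoting a loop at $i$), and $(m,E)$ denotes the graph/pattern with vertex set $[m]$ and edge set $E$. Edge-inducibility: for non-negative integers $\kappa,\ell$ and a graph $G$ with $n\ge\kappa$ vertices, $\lambda_{\kappa,\ell}(G)$ is the number of $\kappa$-subsets of $V(G)$ that span exactly $\ell$ edges of $G$, divided by $\binom{n}{\kappa}$. Further, $\lambda_{\kappa,\ell}(n):=\max\{\lambda_{\kappa,\ell}(G): G \text{ is an } n\text{ -vertex graph}\}$ and $\lambda_{\kappa,\ell}:=\lim_{n\to\infty}\lambda_{\kappa,\ell}(n)$ (the limit exists). A pattern $B$ is a graph in which loops on some vertices are additionally allowed (no multiple edges). A pattern automorphism is a bijection $f:V(B)\to V(B)$ such that for all $u,w\in V(B)$ (including $u=w$) $\{u,w\}\in E(B)$ iff $\{f(u),f(w)\}\in E(B)$. For a pattern $B$ with vertex set $[m]$ and pairwise disjoint finite sets $V_0,\dots,V_{m-1}$ (some possibly empty), the blowup $B(V_0,\dots,V_{m-1})$ is the (loopless) graph on $V_0\cup\dots\cup V_{m-1}$ in which distinct $x\in V_i$,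 $y\in V_j$ are adjacent iff $\{i,j\}\in E(B)$ (so $V_i$ is a clique if $i$ has a loop, and an independent set otherwise). $B()$ denotes the family of all blowups of $B$. $\mathbb{S}_m:=\{(x_0,\dots,x_{m-1})\in\mathbb{R}^m: x_0+\dots+x_{m-1}=1,\ x_i\ge 0 \text{ for all } i\}$. For $\mathbf{x}\in\mathbb{S}_m$, $\lambda_{\kappa,\ell}(B(\mathbf{x}))$ is the limit as $n\to\infty$ of $\lambda_{\kappa,\ell}(B(V_0,\dots,V_{m-1}))$ where $|V_i|=(x_i+o(1))n$ for each $i\in[m]$. A maximizer is an $\mathbf{x}\in\mathbb{S}_m$ at which this function attains its maximum over $\mathbb{S}_m$. The edit distance $\delta_{\mathrm{edit}}(G,H)$ between graphs of the same order is the minimum of $|E(G)\bigtriangleup f(E(H))|$ over bijections $f:V(H)\to V(G)$, and $\delta_{\mathrm{edit}}(G,B())$ is the minimum of $\delta_{\mathrm{edit}}(G,H)$ over $H\in B()$ with the same number of vertices as $G$. The $(\kappa,\ell)$-problem is perfectly $B$-stable if there is $C>0$ such that every graph $G$ of order $n\ge C$ satisfies $\delta_{\mathrm{edit}}(G,B())\le C\,(\lambda_{\kappa,\ell}(n)-\lambda_{\kappa,\ell}(G))\,n^2$. -}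

module Defs where

open import Data.Bool.Base using (Bool; true; false; _∧_; _∨_; _xor_; not)
open import Data.Bool.Properties using (∨-comm; ∨-identityʳ)
open import Data.Fin.Base using (Fin; zero; suc; punchIn)
import Data.Fin.Properties as Fin
open import Data.Fin.Permutation as Perm using (Permutation′; _⟨$⟩ʳ_; _⟨$⟩ˡ_)
open import Data.Fin.Subset using (Subset; ∣_∣)
import Data.Integer.Base as ℤ
open import Data.List.Base as List
  using (List; []; _∷_; length; filter; filterᵇ; allFin; cartesianProduct; cartesianProductWith)
open import Data.List.Membership.Propositional using (_∈_; lose)
open import Data.List.Membership.Propositional.Properties
  using (∈-allFin; ∈-map⁺; ∈-cartesianProductWith⁺)
import Data.List.Extrema as Extrema
open import Data.List.Relation.Unary.Any using (here; there)
open import Data.Nat.Base as ℕ using (ℕ; zero; suc)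
open import Data.Nat.Combinatorics using (_C_)
import Data.Nat.Properties as ℕ
open import Data.Product.Base using (Σ-syntax; _×_; _,_; proj₁; proj₂; uncurry)
open import Data.Rational.Base as ℚ using (ℚ; 0ℚ; 1ℚ; ½)
import Data.Rational.Properties as ℚ
import Data.Rational.Solver as ℚSolver
open import Data.Vec.Base as Vec using (Vec; []; _∷_; lookup; tabulate)
open import Data.Vec.Functional using (Vector; foldr)
import Data.Vec.Properties as Vec
open import Data.Sum.Base using (inj₂)
open import Relation.Binary.Bundles using (DecTotalOrder)
open import Relation.Binary.Definitions using (tri<; tri≈; tri>)
open import Relation.Binary.PropositionalEquality
  using (_≡_; _≗_; refl; sym; trans; cong; cong₂; subst)
open import Relation.Nullary.Decidable using (⌊_⌋; does; yes; no; _×-dec_; isYes≗does; dec-true; dec-false)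

private
  variable
    A : Set
    m n : ℕ

record ℝ : Set where
  field
    seq    : ℕ → ℚ
    cauchy : ∀ ε → 0ℚ ℚ.< ε →
             Σ[ N ∈ ℕ ] (∀ i j → N ℕ.≤ i → N ℕ.≤ j → ℚ.∣ seq i ℚ.- seq j ∣ ℚ.≤ ε)

open ℝ public

infix 4 _≤ᴿ_ _≃ᴿ_
infixl 6 _+ᴿ_

_≤ᴿ_ : ℝ → ℝ → Set
x ≤ᴿ y = ∀ ε → 0ℚ ℚ.< ε → Σ[ N ∈ ℕ ] (∀ i → N ℕ.≤ i → seq x i ℚ.≤ seq y i ℚ.+ ε)

_≃ᴿ_ : ℝ → ℝ → Set
x ≃ᴿ y = x ≤ᴿ y × y ≤ᴿ x

fromℚ : ℚ → ℝ
fromℚ q .seq _ = q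
fromℚ q .cauchy ε 0<ε = 0 , λ _ _ _ _ →
  ℚ.≤-trans (ℚ.≤-reflexive (cong ℚ.∣_∣ (ℚ.+-inverseʳ q))) (ℚ.<⇒≤ 0<ε)

_+ᴿ_ : ℝ → ℝ → ℝ
(x +ᴿ y) .seq i = seq x i ℚ.+ seq y i
(x +ᴿ y) .cauchy ε 0<ε = proj₁ cx ℕ.⊔ proj₁ cy , bound
  where
  open ℚ.≤-Reasoning

  0<ε/2 : 0ℚ ℚ.< ½ ℚ.* ε
  0<ε/2 = subst (ℚ._< ½ ℚ.* ε) (ℚ.*-zeroʳ ½) (ℚ.*-monoʳ-<-pos ½ 0<ε)

  cx = cauchy x (½ ℚ.* ε) 0<ε/2
  cy = cauchy y (½ ℚ.* ε) 0<ε/2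

  regroup : ∀ a b c d → (a ℚ.+ b) ℚ.- (c ℚ.+ d) ≡ (a ℚ.- c) ℚ.+ (b ℚ.- d)
  regroup = solve 4 (λ a b c d → (a :+ b) :- (c :+ d) := (a :- c) :+ (b :- d)) refl
    where open ℚSolver.+-*-Solver

  bound : ∀ i j → proj₁ cx ℕ.⊔ proj₁ cy ℕ.≤ i → proj₁ cx ℕ.⊔ proj₁ cy ℕ.≤ j →
          ℚ.∣ (seq x i ℚ.+ seq y i) ℚ.- (seq x j ℚ.+ seq y j) ∣ ℚ.≤ ε
  bound i j N≤i N≤j = begin
    ℚ.∣ (seq x i ℚ.+ seq y i) ℚ.- (seq x j ℚ.+ seq y j) ∣
      ≡⟨ cong ℚ.∣_∣ (regroup (seq x i) (seq y i) (seq x j) (seq y j)) ⟩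
    ℚ.∣ (seq x i ℚ.- seq x j) ℚ.+ (seq y i ℚ.- seq y j) ∣
      ≤⟨ ℚ.∣p+q∣≤∣p∣+∣q∣ (seq x i ℚ.- seq x j) (seq y i ℚ.- seq y j) ⟩
    ℚ.∣ seq x i ℚ.- seq x j ∣ ℚ.+ ℚ.∣ seq y i ℚ.- seq y j ∣
      ≤⟨ ℚ.+-mono-≤
           (proj₂ cx i j (ℕ.m⊔n≤o⇒m≤o _ _ N≤i) (ℕ.m⊔n≤o⇒m≤o _ _ N≤j))
           (proj₂ cy i j (ℕ.m⊔n≤o⇒n≤o (proj₁ cx) _ N≤i) (ℕ.m⊔n≤o⇒n≤o (proj₁ cx) _ N≤j)) ⟩
    ½ ℚ.* ε ℚ.+ ½ ℚ.* ε
      ≡⟨ ℚ.*-distribʳ-+ ε ½ ½ ⟨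
    1ℚ ℚ.* ε
      ≡⟨ ℚ.*-identityˡ ε ⟩
    ε ∎

infix 4 _⟶_

_⟶_ : (ℕ → ℚ) → ℝ → Set
s ⟶ x = ∀ ε → 0ℚ ℚ.< ε → Σ[ N ∈ ℕ ] (∀ n → N ℕ.≤ n →
  fromℚ (s n ℚ.- ε) ≤ᴿ x × x ≤ᴿ fromℚ (s n ℚ.+ ε))

record Graph (n : ℕ) : Set where
  field
    adj    : Fin n → Fin n → Bool
    symm   : ∀ i j → adj i j ≡ adj j i
    irrefl : ∀ i → adj i i ≡ false

record Pattern (m : ℕ) : Set where
  field
    adj  : Fin m → Fin m → Bool
    symm : ∀ i j → adj i j ≡ adj j i

-- A partition of the vertex set into V₀, …, Vₘ₋₁ (some possibly empty) is
-- given by the map c sending each vertex to the index of its part.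
blowup : Pattern m → (Fin n → Fin m) → Graph n
blowup B c = record
  { adj    = λ x y → not ⌊ x Fin.≟ y ⌋ ∧ Pattern.adj B (c x) (c y)
  ; symm   = λ x y → cong₂ (λ b b′ → not b ∧ b′) (≟-sym x y) (Pattern.symm B (c x) (c y))
  ; irrefl = λ x → cong (λ b → not b ∧ Pattern.adj B (c x) (c x))
                        (trans (isYes≗does (x Fin.≟ x)) (dec-true (x Fin.≟ x) refl))
  }
  where
  ≟-sym : ∀ {n} (x y : Fin n) → ⌊ x Fin.≟ y ⌋ ≡ ⌊ y Fin.≟ x ⌋
  ≟-sym x y with x Fin.≟ y | y Fin.≟ x
  ... | yes _   | yes _   = refl
  ... | no  _   | no  _   = refl
  ... | yes x≡y | no  y≢x with () ← y≢x (sym x≡y)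
  ... | no  x≢y | yes y≡x with () ← x≢y (sym y≡x)

partSize : (Fin n → Fin m) → Fin m → ℕ
partSize {n} c i = length (filter (λ x → c x Fin.≟ i) (allFin n))

vectors : List A → ∀ n → List (Vec A n)
vectors xs zero    = [] ∷ []
vectors xs (suc n) = cartesianProductWith _∷_ xs (vectors xs n)

bools : List Bool
bools = true ∷ false ∷ []

permutations : ∀ n → List (Permutation′ n)
permutations zero    = Perm.id ∷ []
permutations (suc n) = cartesianProductWith (Perm.insert zero) (allFin (suc n)) (permutations n)

-- Each n × n Boolean matrix is read above the diagonal only, so graphs repeat.
graphs : ∀ n → List (Graph n)
graphs n = List.map fromMatrix (vectors (vectors bools n) n)
  module Graphs where
  upper : Vec (Vec Bool n) n → Fin n → Fin n → Bool
  upper M i j = does (i Fin.<? j) ∧ lookup (lookup M i) j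

  fromMatrix : Vec (Vec Bool n) n → Graph n
  fromMatrix M = record
    { adj    = λ i j → upper M i j ∨ upper M j i
    ; symm   = λ i j → ∨-comm (upper M i j) (upper M j i)
    ; irrefl = λ i → cong (λ b → (b ∧ lookup (lookup M i) i) ∨ (b ∧ lookup (lookup M i) i))
                          (dec-false (i Fin.<? i) (ℕ.<-irrefl refl))
    }

emptyGraph : ∀ n → Graph n
emptyGraph n = record { adj = λ _ _ → false ; symm = λ _ _ → refl ; irrefl = λ _ → refl }

module Maxℚ = Extrema (DecTotalOrder.totalOrder ℚ.≤-decTotalOrder)
module Minℕ = Extrema ℕ.≤-totalOrder

pairs : ∀ n → List (Fin n × Fin n)
pairs n = filter (uncurry Fin._<?_) (cartesianProduct (allFin n) (allFin n))

-- Number of unordered pairs {i , j} with i ≢ j satisfying a symmetric P.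
countPairs : (Fin n → Fin n → Bool) → ℕ
countPairs {n} P = length (filterᵇ (uncurry P) (pairs n))

edgesWithin : Graph n → Subset n → ℕ
edgesWithin G S = countPairs λ i j → Graph.adj G i j ∧ lookup S i ∧ lookup S j

inducedCount : ℕ → ℕ → Graph n → ℕ
inducedCount {n} κ ℓ G =
  length (filter (λ S → (∣ S ∣ ℕ.≟ κ) ×-dec (edgesWithin G S ℕ.≟ ℓ)) (vectors bools n))

fromℕ : ℕ → ℚ
fromℕ a = ℤ.+ a ℚ./ 1

-- a / b, with the convention a / 0 = 0.
ratio : ℕ → ℕ → ℚ
ratio a zero    = 0ℚ
ratio a (suc b) = ℤ.+ a ℚ./ suc b

-- Only meaningful for n ≥ κ; by the convention above it is 0 when n < κ.
-- The convention is harmless below: only large n matter for limits, and the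
-- constant in PerfectlyStable may be enlarged.
density : ℕ → ℕ → Graph n → ℚ
density {n} κ ℓ G = ratio (inducedCount κ ℓ G) (n C κ)

maxDensity : ℕ → ℕ → ℕ → ℚ
maxDensity κ ℓ n = density κ ℓ (Maxℚ.argmax (density κ ℓ) (emptyGraph n) (graphs n))

HasInducibility : ℕ → ℕ → ℝ → Set
HasInducibility κ ℓ r = maxDensity κ ℓ ⟶ r

-- ∣ E(G) △ π(E(H)) ∣: {i , j} is in π(E(H)) iff {π⁻¹ i , π⁻¹ j} is in E(H).
symmDiff : Graph n → Graph n → Permutation′ n → ℕ
symmDiff G H π = countPairs λ i j → Graph.adj G i j xor Graph.adj H (π ⟨$⟩ˡ i) (π ⟨$⟩ˡ j)

editDistance : Graph n → Graph n → ℕ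
editDistance {n} G H = symmDiff G H (Minℕ.argmin (symmDiff G H) Perm.id (permutations n))

-- The pattern must have a vertex, for otherwise it has no blowup of order n ≥ 1.
distanceToBlowups : Pattern (suc m) → Graph n → ℕ
distanceToBlowups {m} {n} B G =
  dist (Minℕ.argmin dist (Vec.replicate n zero) (vectors (allFin (suc m)) n))
  module DistanceToBlowups where
  dist : Vec (Fin (suc m)) n → ℕ
  dist c = editDistance G (blowup B (lookup c))

-- Taking K rational loses nothing: maxDensity κ ℓ n - density κ ℓ G is
-- nonnegative, so any real K may be replaced by a larger rational.
PerfectlyStable : ℕ → ℕ → Pattern (suc m) → Set
PerfectlyStable κ ℓ B = Σ[ K ∈ ℚ ] 0ℚ ℚ.< K ×
  (∀ n (G : Graph n) → K ℚ.≤ fromℕ n →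
    fromℕ (distanceToBlowups B G)
      ℚ.≤ K ℚ.* (maxDensity κ ℓ n ℚ.- density κ ℓ G) ℚ.* fromℕ (n ℕ.^ 2))

InSimplex : Vector ℝ m → Set
InSimplex x = (foldr _+ᴿ_ (fromℚ 0ℚ) x ≃ᴿ fromℚ 1ℚ) × (∀ i → fromℚ 0ℚ ≤ᴿ x i)

-- L is the limit density of B(x). A sequence c as below exists for each x in
-- the simplex, so L is then unique up to _≃ᴿ_.
BlowupDensity : ℕ → ℕ → Pattern m → Vector ℝ m → ℝ → Set
BlowupDensity {m} κ ℓ B x L =
  (c : ∀ n → Fin n → Fin m) →
  (∀ i → (λ n → ratio (partSize (c n) i) n) ⟶ x i) →
  (λ n → density κ ℓ (blowup B (c n))) ⟶ L

IsMaximizer : ℕ → ℕ → Pattern m → Vector ℝ m → Set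
IsMaximizer κ ℓ B x = InSimplex x ×
  Σ[ L ∈ ℝ ] BlowupDensity κ ℓ B x L ×
    (∀ y → InSimplex y → Σ[ L′ ∈ ℝ ] BlowupDensity κ ℓ B y L′ × L′ ≤ᴿ L)

twoLoops : Pattern 2
twoLoops = record { adj = adj ; symm = symm }
  where
  adj : Fin 2 → Fin 2 → Bool
  adj zero       zero       = true
  adj (suc zero) (suc zero) = true
  adj _          _          = false

  symm : ∀ i j → adj i j ≡ adj j i
  symm zero       zero       = refl
  symm zero       (suc zero) = refl
  symm (suc zero) zero       = refl
  symm (suc zero) (suc zero) = refl

-- The enumerations are exhaustive, so the extrema above are as intended

filterᵇ-cong : {p q : A → Bool} → p ≗ q → ∀ xs → filterᵇ p xs ≡ filterᵇ q xs
filterᵇ-cong p≗q [] = refl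
filterᵇ-cong {q = q} p≗q (x ∷ xs) rewrite p≗q x with q x
... | true  = cong (x ∷_) (filterᵇ-cong p≗q xs)
... | false = filterᵇ-cong p≗q xs

countPairs-cong : {P Q : Fin n → Fin n → Bool} → (∀ i j → P i j ≡ Q i j) →
                  countPairs P ≡ countPairs Q
countPairs-cong {n} P≗Q = cong length (filterᵇ-cong (uncurry P≗Q) (pairs n))

edgesWithin-cong : (G H : Graph n) → (∀ i j → Graph.adj G i j ≡ Graph.adj H i j) →
                   edgesWithin G ≗ edgesWithin H
edgesWithin-cong G H G≗H S = countPairs-cong λ i j → cong (_∧ (lookup S i ∧ lookup S j)) (G≗H i j)

density-cong : ∀ κ ℓ (G H : Graph n) → (∀ i j → Graph.adj G i j ≡ Graph.adj H i j) →
               density κ ℓ G ≡ density κ ℓ H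
density-cong {n} κ ℓ G H G≗H = cong (λ a → ratio a (n C κ)) (lemma (vectors bools n))
  where
  lemma : ∀ Ss → length (filter (λ S → (∣ S ∣ ℕ.≟ κ) ×-dec (edgesWithin G S ℕ.≟ ℓ)) Ss)
               ≡ length (filter (λ S → (∣ S ∣ ℕ.≟ κ) ×-dec (edgesWithin H S ℕ.≟ ℓ)) Ss)
  lemma []       = refl
  lemma (S ∷ Ss) rewrite edgesWithin-cong G H G≗H S
    with does ((∣ S ∣ ℕ.≟ κ) ×-dec (edgesWithin H S ℕ.≟ ℓ))
  ... | true  = cong suc (lemma Ss)
  ... | false = lemma Ss

symmDiff-cong : (G H H′ : Graph n) (π ρ : Permutation′ n) →
                (∀ i j → Graph.adj H i j ≡ Graph.adj H′ i j) → π Perm.≈ ρ →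
                symmDiff G H π ≡ symmDiff G H′ ρ
symmDiff-cong G H H′ π ρ H≗H′ π≈ρ = countPairs-cong λ i j →
  cong (Graph.adj G i j xor_)
    (trans (H≗H′ (π ⟨$⟩ˡ i) (π ⟨$⟩ˡ j)) (cong₂ (Graph.adj H′) (inv i) (inv j)))
  where
  inv : ∀ i → π ⟨$⟩ˡ i ≡ ρ ⟨$⟩ˡ i
  inv i = trans (sym (Perm.inverseˡ ρ))
                (cong (ρ ⟨$⟩ˡ_) (trans (sym (π≈ρ (π ⟨$⟩ˡ i))) (Perm.inverseʳ π)))

∈-vectors : {xs : List A} → (∀ a → a ∈ xs) → (v : Vec A n) → v ∈ vectors xs n
∈-vectors full []      = here refl
∈-vectors full (a ∷ v) = ∈-cartesianProductWith⁺ _∷_ (full a) (∈-vectors full v)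

∈-bools : ∀ b → b ∈ bools
∈-bools true  = here refl
∈-bools false = there (here refl)

permutations-exhaustive : (π : Permutation′ n) → Σ[ ρ ∈ Permutation′ n ] ρ ∈ permutations n × ρ Perm.≈ π
permutations-exhaustive {zero}  π = Perm.id , here refl , λ ()
permutations-exhaustive {suc n} π with permutations-exhaustive (Perm.remove zero π)
... | ρ , ρ∈ , ρ≈ = Perm.insert zero (π ⟨$⟩ʳ zero) ρ
                  , ∈-cartesianProductWith⁺ (Perm.insert zero) (∈-allFin (π ⟨$⟩ʳ zero)) ρ∈
                  , agree
  where
  agree : Perm.insert zero (π ⟨$⟩ʳ zero) ρ Perm.≈ π
  agree zero    = refl
  agree (suc i) = trans (Perm.insert-punchIn zero (π ⟨$⟩ʳ zero) ρ i)
                 (trans (cong (punchIn (π ⟨$⟩ʳ zero)) (ρ≈ i))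
                        (sym (Perm.punchIn-permute π zero i)))

graphs-exhaustive : (G : Graph n) →
  Σ[ H ∈ Graph n ] H ∈ graphs n × (∀ i j → Graph.adj H i j ≡ Graph.adj G i j)
graphs-exhaustive {n} G =
  Graphs.fromMatrix n M , ∈-map⁺ (Graphs.fromMatrix n) (∈-vectors (∈-vectors ∈-bools) M) , agree
  where
  M : Vec (Vec Bool n) n
  M = tabulate λ i → tabulate (Graph.adj G i)

  M≗G : ∀ i j → lookup (lookup M i) j ≡ Graph.adj G i j
  M≗G i j = trans (cong (λ v → lookup v j) (Vec.lookup∘tabulate (λ i → tabulate (Graph.adj G i)) i))
                  (Vec.lookup∘tabulate (Graph.adj G i) j)

  agree : ∀ i j → Graphs.upper n M i j ∨ Graphs.upper n M j i ≡ Graph.adj G i j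
  agree i j rewrite M≗G i j | M≗G j i with Fin.<-cmp i j
  ... | tri< i<j _ j≮i
    rewrite dec-true (i Fin.<? j) i<j | dec-false (j Fin.<? i) j≮i = ∨-identityʳ (Graph.adj G i j)
  ... | tri≈ i≮j refl _
    rewrite dec-false (i Fin.<? i) i≮j = sym (Graph.irrefl G i)
  ... | tri> i≮j _ j<i
    rewrite dec-false (i Fin.<? j) i≮j | dec-true (j Fin.<? i) j<i = Graph.symm G j i

density≤maxDensity : ∀ κ ℓ (G : Graph n) → density κ ℓ G ℚ.≤ maxDensity κ ℓ n
density≤maxDensity {n} κ ℓ G = let (H , H∈ , H≗G) = graphs-exhaustive G in
  Maxℚ.v≤f[argmax]⁺ {f = density κ ℓ} {v = density κ ℓ G} (emptyGraph n) (graphs n)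
  (inj₂ (lose H∈ (ℚ.≤-reflexive (density-cong κ ℓ G H λ i j → sym (H≗G i j)))))

maxDensity-attained : ∀ κ ℓ n → Σ[ G ∈ Graph n ] density κ ℓ G ≡ maxDensity κ ℓ n
maxDensity-attained κ ℓ n = Maxℚ.argmax (density κ ℓ) (emptyGraph n) (graphs n) , refl

editDistance≤symmDiff : (G H : Graph n) (π : Permutation′ n) → editDistance G H ℕ.≤ symmDiff G H π
editDistance≤symmDiff {n} G H π = let (ρ , ρ∈ , ρ≈π) = permutations-exhaustive π in
  Minℕ.f[argmin]≤v⁺ {f = symmDiff G H} {v = symmDiff G H π} Perm.id (permutations n)
  (inj₂ (lose ρ∈ (ℕ.≤-reflexive (symmDiff-cong G H H ρ π (λ _ _ → refl) ρ≈π))))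

editDistance-attained : (G H : Graph n) → Σ[ π ∈ Permutation′ n ] symmDiff G H π ≡ editDistance G H
editDistance-attained {n} G H = Minℕ.argmin (symmDiff G H) Perm.id (permutations n) , refl

editDistance-cong : (G H H′ : Graph n) → (∀ i j → Graph.adj H i j ≡ Graph.adj H′ i j) →
                    editDistance G H ℕ.≤ editDistance G H′
editDistance-cong G H H′ H≗H′ = let (π , eq) = editDistance-attained G H′ in
  ℕ.≤-trans (editDistance≤symmDiff G H π)
  (ℕ.≤-reflexive (trans (symmDiff-cong G H H′ π π H≗H′ (λ _ → refl)) eq))

distanceToBlowups≤editDistance : (B : Pattern (suc m)) (G : Graph n) (c : Fin n → Fin (suc m)) →
                                 distanceToBlowups B G ℕ.≤ editDistance G (blowup B c)
distanceToBlowups≤editDistance {m} {n} B G c =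
  Minℕ.f[argmin]≤v⁺ {f = DistanceToBlowups.dist B G} {v = editDistance G (blowup B c)}
    (Vec.replicate n zero) (vectors (allFin (suc m)) n)
    (inj₂ (lose (∈-vectors ∈-allFin (tabulate c)) (editDistance-cong G (blowup B (lookup (tabulate c))) (blowup B c) agree)))
  where
  agree : ∀ x y → Graph.adj (blowup B (lookup (tabulate c))) x y ≡ Graph.adj (blowup B c) x y
  agree x y = cong₂ (λ i j → not ⌊ x Fin.≟ y ⌋ ∧ Pattern.adj B i j)
                    (Vec.lookup∘tabulate c x) (Vec.lookup∘tabulate c y)

distanceToBlowups-attained : (B : Pattern (suc m)) (G : Graph n) →
  Σ[ c ∈ (Fin n → Fin (suc m)) ] editDistance G (blowup B c) ≡ distanceToBlowups B G
distanceToBlowups-attained {m} {n} B G =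
  lookup (Minℕ.argmin (DistanceToBlowups.dist B G) (Vec.replicate n zero) (vectors (allFin (suc m)) n)) , refl

{-# OPTIONS --safe #-}

-- A graph is a union of two cliques exactly when each of its triples spans an
-- odd number of edges.  Counting ordered 5-tuples with repetition, equal
-- vertices being regarded as adjacent, a sum-of-squares (flag algebra)
-- certificate on five vertices yields
--
--     64 Φ + 2 S + n² U ≤ 40 n⁵,
--
-- with Φ the number of tuples spanning four edges, S a weighted sum of squares
-- and U the number of ordered even triples; unions of two cliques attain
-- equality.  Let v lie in at most the average number of even triples, let H be
-- the union of two cliques on the neighbours and the non-neighbours of v, and
-- let W be the number of pairs on which G and H differ, so that n W ≤ U.  On H
-- every square is a multiple of d², where d is the difference of the sizes of
-- the cliques, hence S(G) ≥ S(H) - O(∣ d ∣ n² W).  If ∣ d ∣ is a small multiple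
-- of n, the term n² U absorbs the error and Φ(H) - Φ(G) is at least a multiple
-- of n³ W; otherwise Φ(G) stays below (5/8 - η) n⁵ for some η > 0.  Tuples with
-- a repeated vertex change the first bound by O(n² W) only, so the edit distance
-- is controlled by the difference of the numbers of 5-sets, not just in the limit.

module Submission where

open import Defs
open import Data.Bool.Base using (Bool; true; false; T; _∧_; _∨_; _xor_; not)
open import Data.Bool.Properties using (∧-comm; ∨-zeroʳ; ∨-identityʳ; ∧-conicalˡ; ∧-conicalʳ)
open import Data.Fin.Base using (Fin; zero; suc; toℕ)
open import Data.Fin.Patterns using (0F; 1F; 2F; 3F; 4F)
import Data.Fin.Permutation as Perm
import Data.Fin.Properties as Fin
open import Data.Fin.Subset using (Subset) renaming (∣_∣ to size)
open import Data.Integer.Base hiding (suc; pred; sign; neg; _/_; _%_)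
open import Data.Integer.Properties
open import Data.Integer.Tactic.RingSolver using (solve-∀)
open import Data.List.Base as List using (List; []; _∷_; _++_; length; filter; allFin; cartesianProduct; cartesianProductWith)
open import Data.Nat.Base as ℕ using (ℕ; zero; suc)
open import Data.Nat.Combinatorics using (_C_; nCk+nC[k+1]≡[n+1]C[k+1]; k>n⇒nCk≡0)
import Data.Nat.Properties as ℕ
open import Data.Product.Base using (Σ-syntax; _×_; _,_; proj₁; proj₂; uncurry)
import Data.Rational.Base as ℚ
open import Data.Rational.Base using (ℚ; 0ℚ; 1ℚ; ½; _/_)
import Data.Rational.Properties as ℚ
import Data.Rational.Solver as ℚSolver
import Data.Rational.Unnormalised.Base as ℚᵘ
import Data.Rational.Unnormalised.Properties as ℚᵘ
open import Data.Sum.Base using (_⊎_; inj₁; inj₂)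
open import Data.Vec.Base as Vec using (Vec; []; _∷_; lookup; insertAt; map; take; _[_]≔_; replicate)
open import Data.Vec.Functional using (Vector)
import Data.Vec.Properties as Vec
open import Relation.Binary.Definitions using (tri<; tri≈; tri>)
open import Relation.Binary.PropositionalEquality
  using (_≡_; refl; sym; trans; cong; cong₂; subst; subst₂; module ≡-Reasoning)
open import Relation.Nullary.Decidable
  using (⌊_⌋; does; yes; no; Dec; T?; isYes≗does; dec-true; dec-false; _×-dec_)
open import Relation.Nullary.Negation using (contradiction)
open import Algebra.Properties.Semiring.Sum +-*-semiring
  using (sum; sum-syntax; sum-cong-≗; ∑-comm; ∑-distrib-+; *-distribˡ-sum)
open ℚSolver.+-*-Solver using (solve; _:=_; _:+_; _:*_; _:-_; :-_; con)

-- Repetition makes the counts exact: free entries contribute powers of n and the quadratic part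
-- becomes a genuine sum of squares. Equal vertices are made adjacent because a repeated vertex then
-- looks like two vertices of one clique, so that unions of two cliques attain equality tuple by
-- tuple. They do so for any two sizes, hence the certificate alone does not see the balance: a size
-- difference d is recorded as S(H), of order n³ d². This is why G is compared with an H of possibly
-- unequal sides, where the squares need not vanish. Their first-order change carries a factor d,
-- since the forms themselves are multiples of d on H; only therefore can n² U absorb it when d is
-- small. For large d a tangent line of slope 1/M is taken: it gives up most of S(H), but the error
-- shrinks by the same factor and a positive deficit survives. With M the ratio separating the
-- cases, η is 5/(32 M³), and the stability constant is 144 M³. In the second case the edit distance
-- is estimated trivially by n², and the deficit of order n⁵ pays for it.

𝟙 : Bool → ℤ
𝟙 true  = + 1
𝟙 false = + 0

-- Most inequalities below end here: the slack `c` is a sum of products of nonnegative gaps taken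
-- from the hypotheses, and what remains is a polynomial identity for the ring solver.
≤-by : ∀ {a b} c → + 0 ≤ c → b ≡ a + c → a ≤ b
≤-by {a} c 0≤c refl = subst (_≤ a + c) (+-identityʳ a) (+-monoʳ-≤ a 0≤c)

0≤-gap : ∀ {a b} → a ≤ b → + 0 ≤ b - a
0≤-gap = i≤j⇒0≤j-i

0≤+ : ∀ {a b} → + 0 ≤ a → + 0 ≤ b → + 0 ≤ a + b
0≤+ = +-mono-≤

0≤* : ∀ {a b} → + 0 ≤ a → + 0 ≤ b → + 0 ≤ a * b
0≤* {+ m} {+ n} _ _ = subst (+ 0 ≤_) (pos-* m n) (+≤+ ℕ.z≤n)

0≤sq : ∀ a → + 0 ≤ a * a
0≤sq (+ n)    = 0≤* (+≤+ (ℕ.z≤n {n})) (+≤+ ℕ.z≤n)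
0≤sq -[1+ n ] = +≤+ ℕ.z≤n

0≤𝟙 : ∀ b → + 0 ≤ 𝟙 b
0≤𝟙 true  = +≤+ ℕ.z≤n
0≤𝟙 false = +≤+ ℕ.z≤n

𝟙≤1 : ∀ b → 𝟙 b ≤ + 1
𝟙≤1 true  = ≤-refl
𝟙≤1 false = +≤+ ℕ.z≤n

-- Finite sums of integers

sum-mono : ∀ {n} {f g : Fin n → ℤ} → (∀ i → f i ≤ g i) → sum f ≤ sum g
sum-mono {zero}  f≤g = ≤-refl
sum-mono {suc n} f≤g = +-mono-≤ (f≤g zero) (sum-mono λ i → f≤g (suc i))

sum-const : ∀ n c → ∑[ i < n ] c ≡ + n * c
sum-const zero    c = sym (*-zeroˡ c)
sum-const (suc n) c = begin
  c + ∑[ i < n ] c   ≡⟨ cong (_+_ c) (sum-const n c) ⟩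
  c + + n * c        ≡⟨ regroup c (+ n) ⟩
  + suc n * c        ∎
  where
  open ≡-Reasoning
  regroup : ∀ c m → c + m * c ≡ (+ 1 + m) * c
  regroup = solve-∀

0≤sum : ∀ {n} {f : Fin n → ℤ} → (∀ i → + 0 ≤ f i) → + 0 ≤ sum f
0≤sum {zero}  0≤f = ≤-refl
0≤sum {suc n} 0≤f = 0≤+ (0≤f zero) (0≤sum λ i → 0≤f (suc i))

sum-*ʳ : ∀ {n} (f : Fin n → ℤ) c → ∑[ i < n ] (f i * c) ≡ sum f * c
sum-*ʳ f c = begin
  ∑[ i < _ ] (f i * c) ≡⟨ sum-cong-≗ (λ i → *-comm (f i) c) ⟩
  ∑[ i < _ ] (c * f i) ≡⟨ *-distribˡ-sum c f ⟨
  c * sum f            ≡⟨ *-comm c (sum f) ⟩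
  sum f * c            ∎
  where open ≡-Reasoning

below-average : ∀ {n} → + 1 ≤ + n → (f : Fin n → ℤ) → Σ[ v ∈ Fin n ] + n * f v ≤ sum f
below-average {zero}  (+≤+ ())
below-average {suc n} _ f = let v , min = minimum f in
  v , subst (_≤ sum f) (sum-const (suc n) (f v)) (sum-mono min)
  where
  minimum : ∀ {n} (f : Fin (suc n) → ℤ) → Σ[ v ∈ Fin (suc n) ] (∀ i → f v ≤ f i)
  minimum {zero}  f = zero , λ { zero → ≤-refl }
  minimum {suc n} f with minimum (λ i → f (suc i))
  ... | v , min with ≤-total (f zero) (f (suc v))
  ... | inj₁ f0≤fv = zero , λ { zero → ≤-refl ; (suc i) → ≤-trans f0≤fv (min i) }
  ... | inj₂ fv≤f0 = suc v , λ { zero → fv≤f0 ; (suc i) → min i }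

-- Sums over ordered tuples and symmetrisation

∑ᵛ : ∀ {n} k → (Vec (Fin n) k → ℤ) → ℤ
∑ᵛ zero    f = f []
∑ᵛ {n} (suc k) f = ∑[ x < n ] ∑ᵛ k (λ v → f (x ∷ v))

module _ {n : ℕ} where

  private N = + n

  ∑ᵛ-cong : ∀ k {f g : Vec (Fin n) k → ℤ} → (∀ v → f v ≡ g v) → ∑ᵛ k f ≡ ∑ᵛ k g
  ∑ᵛ-cong zero    f≗g = f≗g []
  ∑ᵛ-cong (suc k) f≗g = sum-cong-≗ λ x → ∑ᵛ-cong k λ v → f≗g (x ∷ v)

  ∑ᵛ-mono : ∀ k {f g : Vec (Fin n) k → ℤ} → (∀ v → f v ≤ g v) → ∑ᵛ k f ≤ ∑ᵛ k g
  ∑ᵛ-mono zero    f≤g = f≤g []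
  ∑ᵛ-mono (suc k) f≤g = sum-mono λ x → ∑ᵛ-mono k λ v → f≤g (x ∷ v)

  ∑ᵛ-const : ∀ k c → ∑ᵛ {n} k (λ _ → c) ≡ N ^ k * c
  ∑ᵛ-const zero    c = sym (*-identityˡ c)
  ∑ᵛ-const (suc k) c = begin
    ∑[ x < n ] ∑ᵛ {n} k (λ _ → c)  ≡⟨ sum-cong-≗ {n} (λ _ → ∑ᵛ-const k c) ⟩
    ∑[ x < n ] (N ^ k * c)         ≡⟨ sum-const n (N ^ k * c) ⟩
    N * (N ^ k * c)                ≡⟨ *-assoc N (N ^ k) c ⟨
    N ^ suc k * c                  ∎
    where open ≡-Reasoning

  ∑ᵛ-+ : ∀ k (f g : Vec (Fin n) k → ℤ) → ∑ᵛ k (λ v → f v + g v) ≡ ∑ᵛ k f + ∑ᵛ k g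
  ∑ᵛ-+ zero    f g = refl
  ∑ᵛ-+ (suc k) f g = trans
    (sum-cong-≗ λ x → ∑ᵛ-+ k (λ v → f (x ∷ v)) (λ v → g (x ∷ v)))
    (∑-distrib-+ (λ x → ∑ᵛ k (λ v → f (x ∷ v))) (λ x → ∑ᵛ k (λ v → g (x ∷ v))))

  ∑ᵛ-* : ∀ k c (f : Vec (Fin n) k → ℤ) → ∑ᵛ k (λ v → c * f v) ≡ c * ∑ᵛ k f
  ∑ᵛ-* zero    c f = refl
  ∑ᵛ-* (suc k) c f = trans
    (sum-cong-≗ λ x → ∑ᵛ-* k c (λ v → f (x ∷ v)))
    (sym (*-distribˡ-sum c (λ x → ∑ᵛ k (λ v → f (x ∷ v)))))

  ∑ᵛ-sum : ∀ k {m} (f : Fin m → Vec (Fin n) k → ℤ) →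
           ∑ᵛ k (λ v → ∑[ i < m ] f i v) ≡ ∑[ i < m ] ∑ᵛ k (f i)
  ∑ᵛ-sum zero    f = refl
  ∑ᵛ-sum (suc k) f = trans
    (sum-cong-≗ λ x → ∑ᵛ-sum k (λ i v → f i (x ∷ v)))
    (∑-comm (λ x i → ∑ᵛ k (λ v → f i (x ∷ v))))

  -- Exchanging sums moves the inserted entry past the first `i` ones: over all tuples the position
  -- of an entry is immaterial.
  ∑ᵛ-insertAt : ∀ k (i : Fin (suc k)) (f : Vec (Fin n) (suc k) → ℤ) →
                ∑[ x < n ] ∑ᵛ k (λ v → f (insertAt v i x)) ≡ ∑ᵛ (suc k) f
  ∑ᵛ-insertAt k       zero    f = refl
  ∑ᵛ-insertAt (suc k) (suc i) f = trans
    (∑-comm (λ x y → ∑ᵛ k (λ v → f (y ∷ insertAt v i x))))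
    (sum-cong-≗ λ y → ∑ᵛ-insertAt k i (λ v → f (y ∷ v)))

-- The sum over all k! rearrangements: each arises from one rearrangement of the tail and one
-- position for the head. It is needed because `penalty` depends on the order of a tuple while
-- `fourEdges` does not.
symmetrise : ∀ {A : Set} {k} → (Vec A k → ℤ) → Vec A k → ℤ
symmetrise f []               = f []
symmetrise {k = suc k} f (x ∷ v) = ∑[ i < suc k ] symmetrise (λ w → f (insertAt w i x)) v

symmetrise-cong : ∀ {A : Set} {k} {f g : Vec A k → ℤ} → (∀ v → f v ≡ g v) → ∀ v → symmetrise f v ≡ symmetrise g v
symmetrise-cong f≗g []      = f≗g []
symmetrise-cong f≗g (x ∷ v) = sum-cong-≗ λ i → symmetrise-cong (λ w → f≗g (insertAt w i x)) v

symmetrise-map : ∀ {A B : Set} {k} (f : Vec B k → ℤ) (h : A → B) (v : Vec A k) →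
           symmetrise f (map h v) ≡ symmetrise (λ w → f (map h w)) v
symmetrise-map f h []      = refl
symmetrise-map f h (x ∷ v) = sum-cong-≗ λ i → trans
  (symmetrise-map (λ w → f (insertAt w i (h x))) h v)
  (symmetrise-cong (λ w → cong f (sym (Vec.map-insertAt h x w i))) v)

factorial : ℕ → ℤ
factorial zero    = + 1
factorial (suc k) = + suc k * factorial k

-- Rearranging positions permutes the set of all tuples, so each of the k! terms has the same total.
∑ᵛ-symmetrise : ∀ {n} k (f : Vec (Fin n) k → ℤ) → ∑ᵛ k (symmetrise f) ≡ factorial k * ∑ᵛ k f
∑ᵛ-symmetrise zero    f = sym (*-identityˡ (f []))
∑ᵛ-symmetrise {n} (suc k) f = begin
  ∑[ x < n ] ∑ᵛ k (λ v → ∑[ i < suc k ] symmetrise (λ w → f (insertAt w i x)) v)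
    ≡⟨ sum-cong-≗ (λ x → ∑ᵛ-sum k (λ i → symmetrise (λ w → f (insertAt w i x)))) ⟩
  ∑[ x < n ] ∑[ i < suc k ] ∑ᵛ k (symmetrise (λ w → f (insertAt w i x)))
    ≡⟨ ∑-comm (λ x i → ∑ᵛ k (symmetrise (λ w → f (insertAt w i x)))) ⟩
  ∑[ i < suc k ] ∑[ x < n ] ∑ᵛ k (symmetrise (λ w → f (insertAt w i x)))
    ≡⟨ sum-cong-≗ {suc k} (λ i → sum-cong-≗ {n} (λ x → ∑ᵛ-symmetrise k (λ w → f (insertAt w i x)))) ⟩
  ∑[ i < suc k ] ∑[ x < n ] (factorial k * ∑ᵛ k (λ w → f (insertAt w i x)))
    ≡⟨ sum-cong-≗ {suc k} (λ i → sym (*-distribˡ-sum (factorial k) (λ x → ∑ᵛ k (λ w → f (insertAt w i x))))) ⟩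
  ∑[ i < suc k ] (factorial k * ∑[ x < n ] ∑ᵛ k (λ w → f (insertAt w i x)))
    ≡⟨ sum-cong-≗ {suc k} (λ i → cong (factorial k *_) (∑ᵛ-insertAt k i f)) ⟩
  ∑[ i < suc k ] (factorial k * ∑ᵛ (suc k) f)
    ≡⟨ sum-const (suc k) _ ⟩
  + suc k * (factorial k * ∑ᵛ (suc k) f)
    ≡⟨ *-assoc (+ suc k) (factorial k) (∑ᵛ (suc k) f) ⟨
  factorial (suc k) * ∑ᵛ (suc k) f ∎
  where open ≡-Reasoning

∑∈ : ∀ {A : Set} {k} → (A → ℤ) → Vec A k → ℤ
∑∈ φ []      = + 0
∑∈ φ (x ∷ v) = φ x + ∑∈ φ v

∑pairs : ∀ {A : Set} {k} → (A → A → ℤ) → Vec A k → ℤ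
∑pairs ω []      = + 0
∑pairs ω (x ∷ v) = ∑∈ (ω x) v + ∑pairs ω v

∑ᵛ-∑∈ : ∀ {n} k (φ : Fin n → ℤ) → ∑ᵛ (suc k) (∑∈ φ) ≡ + suc k * ((+ n) ^ k * sum φ)
∑ᵛ-∑∈ {n} k φ = begin
  ∑[ x < n ] ∑ᵛ k (λ v → φ x + ∑∈ φ v)
    ≡⟨ sum-cong-≗ (λ x → trans (∑ᵛ-+ k (λ _ → φ x) (∑∈ φ)) (cong (_+ ∑ᵛ k (∑∈ φ)) (∑ᵛ-const k (φ x)))) ⟩
  ∑[ x < n ] ((+ n) ^ k * φ x + ∑ᵛ k (∑∈ φ))
    ≡⟨ ∑-distrib-+ (λ x → (+ n) ^ k * φ x) (λ _ → ∑ᵛ k (∑∈ φ)) ⟩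
  ∑[ x < n ] ((+ n) ^ k * φ x) + ∑[ x < n ] ∑ᵛ k (∑∈ φ)
    ≡⟨ cong₂ _+_ (sym (*-distribˡ-sum ((+ n) ^ k) φ)) (sum-const n _) ⟩
  (+ n) ^ k * sum φ + + n * ∑ᵛ k (∑∈ φ)
    ≡⟨ cong (_+_ ((+ n) ^ k * sum φ)) (rest k) ⟩
  (+ n) ^ k * sum φ + + k * ((+ n) ^ k * sum φ)
    ≡⟨ regroup ((+ n) ^ k * sum φ) (+ k) ⟩
  + suc k * ((+ n) ^ k * sum φ) ∎
  where
  open ≡-Reasoning
  regroup : ∀ a b → a + b * a ≡ (+ 1 + b) * a
  regroup = solve-∀
  regroup′ : ∀ a b c d → a * (b * (c * d)) ≡ b * (a * c * d)
  regroup′ = solve-∀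
  -- The lemma one length lower, multiplied by n so that length zero fits the same formula.
  rest : ∀ k → + n * ∑ᵛ k (∑∈ φ) ≡ + k * ((+ n) ^ k * sum φ)
  rest zero    = trans (*-zeroʳ (+ n)) (sym (*-zeroˡ (+ 1 * sum φ)))
  rest (suc k) = trans (cong (+ n *_) (∑ᵛ-∑∈ k φ)) (regroup′ (+ n) (+ suc k) ((+ n) ^ k) (sum φ))

binomial₂ : ℕ → ℤ
binomial₂ zero    = + 0
binomial₂ (suc k) = + k + binomial₂ k

-- Each pair of positions contributes `ω` summed over all vertex pairs, while the other k entries
-- are free. It is applied with `wrong` and with `equal` as `ω`.
∑ᵛ-∑pairs : ∀ {n} k (ω : Fin n → Fin n → ℤ) →
            ∑ᵛ (suc (suc k)) (∑pairs ω) ≡ binomial₂ (suc (suc k)) * ((+ n) ^ k * ∑[ x < n ] ∑[ y < n ] ω x y)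
∑ᵛ-∑pairs {n} k ω = begin
  ∑[ x < n ] ∑ᵛ (suc k) (λ v → ∑∈ (ω x) v + ∑pairs ω v)
    ≡⟨ sum-cong-≗ (λ x → trans (∑ᵛ-+ (suc k) (∑∈ (ω x)) (∑pairs ω)) (cong (_+ P) (∑ᵛ-∑∈ k (ω x)))) ⟩
  ∑[ x < n ] (+ suc k * ((+ n) ^ k * sum (ω x)) + P)
    ≡⟨ ∑-distrib-+ (λ x → + suc k * ((+ n) ^ k * sum (ω x))) (λ _ → P) ⟩
  ∑[ x < n ] (+ suc k * ((+ n) ^ k * sum (ω x))) + ∑[ x < n ] P
    ≡⟨ cong₂ _+_ (trans (sym (*-distribˡ-sum (+ suc k) (λ x → (+ n) ^ k * sum (ω x))))
                        (cong (+ suc k *_) (sym (*-distribˡ-sum ((+ n) ^ k) (λ x → sum (ω x))))))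
                 (trans (sum-const n P) (rest k)) ⟩
  + suc k * ((+ n) ^ k * W) + binomial₂ (suc k) * ((+ n) ^ k * W)
    ≡⟨ *-distribʳ-+ ((+ n) ^ k * W) (+ suc k) (binomial₂ (suc k)) ⟨
  binomial₂ (suc (suc k)) * ((+ n) ^ k * W) ∎
  where
  open ≡-Reasoning
  W = ∑[ x < n ] ∑[ y < n ] ω x y
  P = ∑ᵛ (suc k) (∑pairs ω)
  regroup′ : ∀ a b c d → a * (b * (c * d)) ≡ b * (a * c * d)
  regroup′ = solve-∀
  rest : ∀ k → + n * ∑ᵛ (suc k) (∑pairs ω) ≡ binomial₂ (suc k) * ((+ n) ^ k * W)
  rest zero    = trans (cong (+ n *_) (trans (sum-const n (+ 0)) (*-zeroʳ (+ n))))
                       (trans (*-zeroʳ (+ n)) (sym (*-zeroˡ (+ 1 * W))))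
  rest (suc k) = trans (cong (+ n *_) (∑ᵛ-∑pairs k ω))
                       (regroup′ (+ n) (binomial₂ (suc (suc k))) ((+ n) ^ k) W)

-- The five-vertex certificate

flag : (t₀ t₁ t₂ t₃ t₄ t₅ t₆ t₇ : ℤ) → Bool → Bool → Bool → ℤ
flag t₀ t₁ t₂ t₃ t₄ t₅ t₆ t₇ false false false = t₀
flag t₀ t₁ t₂ t₃ t₄ t₅ t₆ t₇ false false true  = t₁
flag t₀ t₁ t₂ t₃ t₄ t₅ t₆ t₇ false true  false = t₂
flag t₀ t₁ t₂ t₃ t₄ t₅ t₆ t₇ false true  true  = t₃
flag t₀ t₁ t₂ t₃ t₄ t₅ t₆ t₇ true  false false = t₄
flag t₀ t₁ t₂ t₃ t₄ t₅ t₆ t₇ true  false true  = t₅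
flag t₀ t₁ t₂ t₃ t₄ t₅ t₆ t₇ true  true  false = t₆
flag t₀ t₁ t₂ t₃ t₄ t₅ t₆ t₇ true  true  true  = t₇

-- The weights and forms come from rounding a numerical solution of the semidefinite
-- program for flags on four vertices.  The first three bits of a form give the
-- edges of the type xyz, the last three join x, y and z to the flag vertex.
weight : Fin 5 → ℤ
weight 0F = + 5
weight 1F = + 35
weight 2F = + 9
weight 3F = + 18
weight 4F = + 50

form : Fin 5 → Bool → Bool → Bool → Bool → Bool → Bool → ℤ
form 0F true  true  true  = flag (- + 2) (+ 4) (+ 4) (- + 1) (+ 4) (- + 1) (- + 1) (+ 2)
form 1F true  false false = flag (+ 0) (- + 2) (- + 1) (+ 2) (- + 1) (+ 2) (+ 2) (+ 0)
form 2F false false false = flag (- + 1) (- + 2) (- + 2) (+ 2) (- + 2) (+ 2) (+ 2) (+ 4)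
form 3F true  false false = flag (- + 2) (+ 0) (- + 1) (+ 1) (- + 1) (+ 1) (+ 0) (+ 4)
form 4F true  false false = flag (+ 0) (+ 0) (- + 2) (- + 1) (+ 2) (+ 1) (+ 0) (+ 0)
-- Each form lives on one labelled type; other labellings of that type are reached by reordering the
-- tuple.
form _  _     _     _     = λ _ _ _ → + 0

even : Bool → Bool → Bool → Bool
even a b c = not (a xor b xor c)

module _ {V : Set} (A : V → V → Bool) where

  formAt : Fin 5 → V → V → V → V → ℤ
  formAt k x y z u = form k (A x y) (A x z) (A y z) (A x u) (A y u) (A z u)

  -- `u` and `w` are two independent flag vertices over the same `x`, `y`, `z`; summing over both
  -- gives the square of the form summed over one, with no correction for coincidences.
  quadratic : Vec V 5 → ℤ
  quadratic (x ∷ y ∷ z ∷ u ∷ w ∷ []) = ∑[ k < 5 ] (weight k * (formAt k x y z u * formAt k x y z w))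

  evenTriple : V → V → V → ℤ
  evenTriple x y z = 𝟙 (even (A x y) (A x z) (A y z))

  penalty : Vec V 5 → ℤ
  penalty v@(x ∷ y ∷ z ∷ _ ∷ _ ∷ []) = + 2 * quadratic v + evenTriple x y z

  edges : ∀ {k} → Vec V k → ℤ
  edges = ∑pairs λ x y → 𝟙 (A x y)

  fourEdges : Vec V 5 → ℤ
  fourEdges v = 𝟙 ⌊ edges v ≟ + 4 ⌋

  -- 7680 is 64 times the 120 orders of a 5-tuple, to match the symmetrised penalty; the bound 4800
  -- is likewise 40 times 120.
  value : Vec V 5 → ℤ
  value v = + 7680 * fourEdges v + symmetrise penalty v

vertices : Vec (Fin 5) 5
vertices = 0F ∷ 1F ∷ 2F ∷ 3F ∷ 4F ∷ []

fromBits : Vec Bool 10 → Fin 5 → Fin 5 → Bool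
fromBits (a ∷ b ∷ c ∷ d ∷ e ∷ f ∷ g ∷ h ∷ i ∷ j ∷ []) = matrix
  where
  matrix : Fin 5 → Fin 5 → Bool
  matrix 0F 1F = a
  matrix 0F 2F = b
  matrix 0F 3F = c
  matrix 0F 4F = d
  matrix 1F 2F = e
  matrix 1F 3F = f
  matrix 1F 4F = g
  matrix 2F 3F = h
  matrix 2F 4F = i
  matrix 3F 4F = j
  matrix 1F 0F = a
  matrix 2F 0F = b
  matrix 3F 0F = c
  matrix 4F 0F = d
  matrix 2F 1F = e
  matrix 3F 1F = f
  matrix 4F 1F = g
  matrix 3F 2F = h
  matrix 4F 2F = i
  matrix 4F 3F = j
  matrix 0F 0F = true
  matrix 1F 1F = true
  matrix 2F 2F = true
  matrix 3F 3F = true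
  matrix 4F 4F = true

allBits : ∀ k → (Vec Bool k → Bool) → Bool
allBits zero    P = P []
allBits (suc k) P = allBits k (λ v → P (true ∷ v)) ∧ allBits k (λ v → P (false ∷ v))

allBits-sound : ∀ k (P : Vec Bool k → Bool) → allBits k P ≡ true → ∀ v → P v ≡ true
allBits-sound zero    P h []          = h
allBits-sound (suc k) P h (true ∷ v)  = allBits-sound k _ (∧-conicalˡ _ _ h) v
allBits-sound (suc k) P h (false ∷ v) = allBits-sound k _ (∧-conicalʳ _ _ h) v

decided : ∀ {P : Set} (P? : Dec P) → ⌊ P? ⌋ ≡ true → P
decided (yes p) _ = p
decided (no _)  ()

allBits-≤ : ∀ k (f g : Vec Bool k → ℤ) → allBits k (λ v → ⌊ f v ≤? g v ⌋) ≡ true → ∀ v → f v ≤ g v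
allBits-≤ k f g h v = decided (f v ≤? g v) (allBits-sound k (λ v → ⌊ f v ≤? g v ⌋) h v)

allBits-≡ : ∀ k (f g : Vec Bool k → ℤ) → allBits k (λ v → ⌊ f v ≟ g v ⌋) ≡ true → ∀ v → f v ≡ g v
allBits-≡ k f g h v = decided (f v ≟ g v) (allBits-sound k (λ v → ⌊ f v ≟ g v ⌋) h v)

-- Verified by evaluation on the 1024 reflexive symmetric relations on five points, each over all
-- 120 orders.
certificate : ∀ b → value (fromBits b) vertices ≤ + 4800
certificate = allBits-≤ 10 (λ b → value (fromBits b) vertices) (λ _ → + 4800) refl

-- From five points to arbitrary relations and to unions of two cliques

same : Bool → Bool → Bool
same a b = not (a xor b)

±1 : Bool → ℤ
±1 true  = + 1
±1 false = - + 1

formAt-cong : ∀ {V : Set} {A B : V → V → Bool} → (∀ x y → A x y ≡ B x y) →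
              ∀ k x y z u → formAt A k x y z u ≡ formAt B k x y z u
formAt-cong A≗B k x y z u rewrite A≗B x y | A≗B x z | A≗B y z | A≗B x u | A≗B y u | A≗B z u = refl

penalty-cong : ∀ {V : Set} {A B : V → V → Bool} → (∀ x y → A x y ≡ B x y) → ∀ v → penalty A v ≡ penalty B v
penalty-cong {A = A} {B} A≗B v@(x ∷ y ∷ z ∷ u ∷ w ∷ []) = cong₂ (λ q e → + 2 * q + e)
  {x = quadratic A v} {y = quadratic B v} {u = evenTriple A x y z} {v = evenTriple B x y z}
  (sum-cong-≗ {5} λ k → cong₂ (λ p q → weight k * (p * q)) (formAt-cong A≗B k x y z u) (formAt-cong A≗B k x y z w))
  (cong 𝟙 (trans (cong (λ a → even a (A x z) (A y z)) (A≗B x y)) (cong₂ (even (B x y)) (A≗B x z) (A≗B y z))))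

∑∈-cong : ∀ {V : Set} {φ ψ : V → ℤ} → (∀ x → φ x ≡ ψ x) → ∀ {k} (v : Vec V k) → ∑∈ φ v ≡ ∑∈ ψ v
∑∈-cong φ≗ψ []      = refl
∑∈-cong φ≗ψ (x ∷ v) = cong₂ _+_ (φ≗ψ x) (∑∈-cong φ≗ψ v)

∑pairs-cong : ∀ {V : Set} {φ ψ : V → V → ℤ} → (∀ x y → φ x y ≡ ψ x y) →
              ∀ {k} (v : Vec V k) → ∑pairs φ v ≡ ∑pairs ψ v
∑pairs-cong φ≗ψ []      = refl
∑pairs-cong φ≗ψ (x ∷ v) = cong₂ _+_ (∑∈-cong (φ≗ψ x) v) (∑pairs-cong φ≗ψ v)

edges-cong : ∀ {V : Set} {A B : V → V → Bool} → (∀ x y → A x y ≡ B x y) →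
             ∀ {k} (v : Vec V k) → edges A v ≡ edges B v
edges-cong A≗B = ∑pairs-cong λ x y → cong 𝟙 (A≗B x y)

fourEdges-cong : ∀ {V : Set} {A B : V → V → Bool} → (∀ x y → A x y ≡ B x y) →
                 ∀ v → fourEdges A v ≡ fourEdges B v
fourEdges-cong A≗B v = cong (λ e → 𝟙 ⌊ e ≟ + 4 ⌋) (edges-cong A≗B v)

value-cong : ∀ {V : Set} {A B : V → V → Bool} → (∀ x y → A x y ≡ B x y) → ∀ v → value A v ≡ value B v
value-cong {A = A} {B} A≗B v = cong₂ (λ e p → + 7680 * e + p)
  {x = fourEdges A v} {y = fourEdges B v} {u = symmetrise (penalty A) v} {v = symmetrise (penalty B) v}
  (fourEdges-cong A≗B v) (symmetrise-cong (penalty-cong A≗B) v)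

module _ {V W : Set} (A : V → V → Bool) (g : W → V) where

  private
    A∘g : W → W → Bool
    A∘g i j = A (g i) (g j)

  ∑∈-map : ∀ (φ : V → ℤ) {k} (w : Vec W k) → ∑∈ φ (map g w) ≡ ∑∈ (λ i → φ (g i)) w
  ∑∈-map φ []      = refl
  ∑∈-map φ (x ∷ w) = cong (_+_ (φ (g x))) (∑∈-map φ w)

  edges-map : ∀ {k} (w : Vec W k) → edges A (map g w) ≡ edges A∘g w
  edges-map []      = refl
  edges-map (x ∷ w) = cong₂ _+_ (∑∈-map (λ y → 𝟙 (A (g x) y)) w) (edges-map w)

  fourEdges-map : ∀ w → fourEdges A (map g w) ≡ fourEdges A∘g w
  fourEdges-map w = cong (λ e → 𝟙 ⌊ e ≟ + 4 ⌋) (edges-map w)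

  penalty-map : ∀ w → penalty A (map g w) ≡ penalty A∘g w
  penalty-map (_ ∷ _ ∷ _ ∷ _ ∷ _ ∷ []) = refl

  -- The relation is read only through the entries of the tuple. This transfers the finite checks,
  -- from five positions to any vertex set and from the two-point set of sides to any union of two
  -- cliques.
  value-map : ∀ w → value A (map g w) ≡ value A∘g w
  value-map w = cong₂ (λ e p → + 7680 * e + p) (fourEdges-map w)
    (trans (symmetrise-map (penalty A) g w) (symmetrise-cong penalty-map w))

map-lookup-vertices : ∀ {V : Set} (v : Vec V 5) → map (lookup v) vertices ≡ v
map-lookup-vertices (_ ∷ _ ∷ _ ∷ _ ∷ _ ∷ []) = refl

value-lookup : ∀ {V : Set} (A : V → V → Bool) (v : Vec V 5) →
               value A v ≡ value (λ i j → A (lookup v i) (lookup v j)) vertices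
value-lookup A v = trans (cong (value A) (sym (map-lookup-vertices v))) (value-map A (lookup v) vertices)

-- A tuple pulls `A` back to its five positions. Reflexivity turns a repetition into an edge, so
-- tuples with repeated entries fall under the same 1024 cases.
pointwise-bound : ∀ {V : Set} (A : V → V → Bool) → (∀ x y → A x y ≡ A y x) → (∀ x → A x x ≡ true) →
                  ∀ v → value A v ≤ + 4800
pointwise-bound A A-sym A-refl v = subst (_≤ + 4800)
  (sym (trans (value-lookup A v) (value-cong {A = R} {B = fromBits bits} agree vertices)))
  (certificate bits)
  where
  R : Fin 5 → Fin 5 → Bool
  R i j = A (lookup v i) (lookup v j)
  bits : Vec Bool 10
  bits = R 0F 1F ∷ R 0F 2F ∷ R 0F 3F ∷ R 0F 4F ∷ R 1F 2F ∷ R 1F 3F ∷ R 1F 4F ∷ R 2F 3F ∷ R 2F 4F ∷ R 3F 4F ∷ []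
  agree : ∀ i j → R i j ≡ fromBits bits i j
  agree 0F 1F = refl
  agree 0F 2F = refl
  agree 0F 3F = refl
  agree 0F 4F = refl
  agree 1F 2F = refl
  agree 1F 3F = refl
  agree 1F 4F = refl
  agree 2F 3F = refl
  agree 2F 4F = refl
  agree 3F 4F = refl
  agree 1F 0F = A-sym _ _
  agree 2F 0F = A-sym _ _
  agree 3F 0F = A-sym _ _
  agree 4F 0F = A-sym _ _
  agree 2F 1F = A-sym _ _
  agree 3F 1F = A-sym _ _
  agree 4F 1F = A-sym _ _
  agree 3F 2F = A-sym _ _
  agree 4F 2F = A-sym _ _
  agree 4F 3F = A-sym _ _
  agree 0F 0F = A-refl _
  agree 1F 1F = A-refl _
  agree 2F 2F = A-refl _
  agree 3F 3F = A-refl _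
  agree 4F 4F = A-refl _

-- A union of two cliques is the pullback of `same` along the map to the two sides, so the 32
-- patterns of sides decide equality for all of them.
value-same : ∀ b → value same b ≡ + 4800
value-same = allBits-≡ 5 (value same) (λ _ → + 4800) refl

module _ {V : Set} (h : V → Bool) where

  balanced : V → V → Bool
  balanced x y = same (h x) (h y)

  pointwise-balanced : ∀ v → value balanced v ≡ + 4800
  pointwise-balanced v = trans (sym (value-map same h v)) (value-same (map h v))

  signs : ∀ {k} → Vec V k → ℤ
  signs []      = + 1
  signs (x ∷ v) = ±1 (h x) * signs v

  -- Five vertices of two cliques span four edges exactly when they split 3 to 2, and eight times
  -- the indicator of this is 5 - e₂ + e₄ in the elementary symmetric polynomials of the signs. The
  -- ten products of e₂ and the five of e₄ are replaced by one representative each, to be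
  -- symmetrised later.
  signPolynomial : Vec V 5 → ℤ
  signPolynomial (x ∷ y ∷ z ∷ u ∷ _ ∷ []) =
    + 5 + ((- + 10) * signs (x ∷ y ∷ []) + + 5 * signs (x ∷ y ∷ z ∷ u ∷ []))

signPolynomial-id : ∀ b → + 960 * fourEdges same b ≡ symmetrise (signPolynomial (λ a → a)) b
signPolynomial-id = allBits-≡ 5 (λ b → + 960 * fourEdges same b) (symmetrise (signPolynomial (λ a → a))) refl

pointwise-signPolynomial : ∀ {V : Set} (h : V → Bool) v →
  + 960 * fourEdges (balanced h) v ≡ symmetrise (signPolynomial h) v
pointwise-signPolynomial h v = trans (cong (+ 960 *_) (sym (fourEdges-map same h v)))
  (trans (signPolynomial-id (map h v))
  (trans (symmetrise-map (signPolynomial (λ a → a)) h v) (symmetrise-cong natural v)))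
  where
  natural : ∀ w → signPolynomial (λ a → a) (map h w) ≡ signPolynomial h w
  natural (_ ∷ _ ∷ _ ∷ _ ∷ _ ∷ []) = refl

-- On a union of two cliques every form is linear in the sign of its last vertex.
slope : Fin 5 → Bool → Bool → Bool → ℤ
slope k a b c = form k (same a b) (same a c) (same b c) a b c

-- The flags on the two sides of `u` carry opposite values, and for `u` on the side `true` the form
-- is `slope` itself. Summed over `u` it becomes a multiple of the bias, so the squares vanish for
-- cliques of equal size, as tightness there demands.
form-balanced : ∀ k a b c u → form k (same a b) (same a c) (same b c) (same a u) (same b u) (same c u)
                            ≡ slope k a b c * ±1 u
form-balanced k a b c u = allBits-≡ 4 (lhs k) (rhs k) (tested k) (a ∷ b ∷ c ∷ u ∷ [])
  where
  lhs rhs : Fin 5 → Vec Bool 4 → ℤ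
  lhs k (a ∷ b ∷ c ∷ u ∷ []) = form k (same a b) (same a c) (same b c) (same a u) (same b u) (same c u)
  rhs k (a ∷ b ∷ c ∷ u ∷ []) = slope k a b c * ±1 u
  tested : ∀ k → allBits 4 (λ v → ⌊ lhs k v ≟ rhs k v ⌋) ≡ true
  tested 0F = refl
  tested 1F = refl
  tested 2F = refl
  tested 3F = refl
  tested 4F = refl

formVec : Fin 5 → Vec Bool 6 → ℤ
formVec k (a ∷ b ∷ c ∷ p ∷ q ∷ r ∷ []) = form k a b c p q r

formVec≤4 : ∀ k v → formVec k v ≤ + 4
formVec≤4 k = allBits-≤ 6 (formVec k) (λ _ → + 4) (tested k)
  where
  tested : ∀ k → allBits 6 (λ v → ⌊ formVec k v ≤? + 4 ⌋) ≡ true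
  tested 0F = refl
  tested 1F = refl
  tested 2F = refl
  tested 3F = refl
  tested 4F = refl

-4≤formVec : ∀ k v → - + 4 ≤ formVec k v
-4≤formVec k = allBits-≤ 6 (λ _ → - + 4) (formVec k) (tested k)
  where
  tested : ∀ k → allBits 6 (λ v → ⌊ - + 4 ≤? formVec k v ⌋) ≡ true
  tested 0F = refl
  tested 1F = refl
  tested 2F = refl
  tested 3F = refl
  tested 4F = refl

-- Change of the forms under change of single pairs

hamming : ∀ {k} → Vec Bool k → Vec Bool k → ℤ
hamming []      []      = + 0
hamming (a ∷ v) (b ∷ w) = 𝟙 (a xor b) + hamming v w

0≤hamming : ∀ {k} (v w : Vec Bool k) → + 0 ≤ hamming v w
0≤hamming []      []      = ≤-refl
0≤hamming (a ∷ v) (b ∷ w) = 0≤+ (0≤𝟙 (a xor b)) (0≤hamming v w)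

-- The first differing bit already pays for the whole range from -4 to 4, whence the constant 8.
hamming-lipschitz : ∀ {k} (F : Vec Bool k → ℤ) → (∀ v → - + 4 ≤ F v) → (∀ v → F v ≤ + 4) →
                    ∀ v w → F v - F w ≤ + 8 * hamming v w
hamming-lipschitz F lo hi [] [] = ≤-reflexive (+-inverseʳ (F []))
hamming-lipschitz F lo hi (a ∷ v) (b ∷ w) = step a b
  where
  regroup : ∀ x y h → + 8 * (+ 1 + h) ≡ x - y + ((+ 4 - x) + ((y - - + 4) + + 8 * h))
  regroup = solve-∀
  flipped : ∀ a b → F (a ∷ v) - F (b ∷ w) ≤ + 8 * (+ 1 + hamming v w)
  flipped a b = ≤-by _
    (0≤+ (0≤-gap (hi (a ∷ v))) (0≤+ (0≤-gap (lo (b ∷ w))) (0≤* {+ 8} (+≤+ ℕ.z≤n) (0≤hamming v w))))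
    (regroup (F (a ∷ v)) (F (b ∷ w)) (hamming v w))
  unflipped : ∀ a → F (a ∷ v) - F (a ∷ w) ≤ + 8 * (+ 0 + hamming v w)
  unflipped a = subst (λ t → F (a ∷ v) - F (a ∷ w) ≤ + 8 * t) (sym (+-identityˡ (hamming v w)))
    (hamming-lipschitz (λ v → F (a ∷ v)) (λ v → lo (a ∷ v)) (λ v → hi (a ∷ v)) v w)
  step : ∀ a b → F (a ∷ v) - F (b ∷ w) ≤ + 8 * (𝟙 (a xor b) + hamming v w)
  step true  true  = unflipped true
  step true  false = flipped true false
  step false true  = flipped false true
  step false false = unflipped false

wrong : {V : Set} → (V → V → Bool) → (V → V → Bool) → V → V → ℤ
wrong A B x y = 𝟙 (A x y xor B x y)

formAt-lipschitz : ∀ {V : Set} (A B : V → V → Bool) k x y z u →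
  formAt A k x y z u - formAt B k x y z u ≤ + 8 * ∑pairs (wrong A B) (x ∷ y ∷ z ∷ u ∷ [])
formAt-lipschitz A B k x y z u = ≤-trans
  (hamming-lipschitz (formVec k) (-4≤formVec k) (formVec≤4 k) (bits A) (bits B))
  (≤-reflexive (regroup (wrong A B x y) (wrong A B x z) (wrong A B y z) (wrong A B x u) (wrong A B y u) (wrong A B z u)))
  where
  bits : (_ → _ → Bool) → Vec Bool 6
  bits A = A x y ∷ A x z ∷ A y z ∷ A x u ∷ A y u ∷ A z u ∷ []
  regroup : ∀ a b c p q r → + 8 * (a + (b + (c + (p + (q + (r + + 0))))))
            ≡ + 8 * ((a + (b + (p + + 0))) + ((c + (q + + 0)) + ((r + + 0) + (+ 0 + + 0))))
  regroup = solve-∀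

-- Totals over all tuples

module _ {n : ℕ} where

  ∑ᵛ-factor : ∀ k (φ : Fin n → ℤ) (f : Vec (Fin n) k → ℤ) →
              ∑[ x < n ] ∑ᵛ k (λ v → φ x * f v) ≡ sum φ * ∑ᵛ k f
  ∑ᵛ-factor k φ f = trans (sum-cong-≗ λ x → ∑ᵛ-* k (φ x) f) (sum-*ʳ φ (∑ᵛ k f))

  ∑ᵛ-prefix : ∀ j k (f : Vec (Fin n) j → ℤ) →
              ∑ᵛ (j ℕ.+ k) (λ v → f (take j v)) ≡ (+ n) ^ k * ∑ᵛ j f
  ∑ᵛ-prefix zero    k f = ∑ᵛ-const k (f [])
  ∑ᵛ-prefix (suc j) k f = trans
    (sum-cong-≗ λ x → ∑ᵛ-prefix j k (λ v → f (x ∷ v)))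
    (sym (*-distribˡ-sum ((+ n) ^ k) (λ x → ∑ᵛ j (λ v → f (x ∷ v)))))

  ∑ᵛ-signs : ∀ k (h : Fin n → Bool) → ∑ᵛ k (signs h) ≡ (∑[ x < n ] ±1 (h x)) ^ k
  ∑ᵛ-signs zero    h = refl
  ∑ᵛ-signs (suc k) h = trans (∑ᵛ-factor k (λ x → ±1 (h x)) (signs h))
                             (cong ((∑[ x < n ] ±1 (h x)) *_) (∑ᵛ-signs k h))

  fourCount squareSum : (Fin n → Fin n → Bool) → ℤ
  fourCount A = ∑ᵛ 5 (fourEdges A)
  squareSum A = ∑ᵛ 5 (quadratic A)

  evenCount : (Fin n → Fin n → Bool) → ℤ
  evenCount A = ∑[ x < n ] ∑[ y < n ] ∑[ z < n ] evenTriple A x y z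

  wrongCount : (A B : Fin n → Fin n → Bool) → ℤ
  wrongCount A B = ∑[ x < n ] ∑[ y < n ] wrong A B x y

  bias : (Fin n → Bool) → ℤ
  bias h = ∑[ x < n ] ±1 (h x)

  private
    N : ℤ
    N = + n

  ∑ᵛ-value : ∀ A → ∑ᵛ 5 (value A) ≡ + 120 * (+ 64 * fourCount A + (+ 2 * squareSum A + N ^ 2 * evenCount A))
  ∑ᵛ-value A = begin
    ∑ᵛ 5 (value A)
      ≡⟨ ∑ᵛ-+ 5 (λ v → + 7680 * fourEdges A v) (symmetrise (penalty A)) ⟩
    ∑ᵛ 5 (λ v → + 7680 * fourEdges A v) + ∑ᵛ 5 (symmetrise (penalty A))
      ≡⟨ cong₂ _+_ (∑ᵛ-* 5 (+ 7680) (fourEdges A)) (∑ᵛ-symmetrise 5 (penalty A)) ⟩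
    + 7680 * fourCount A + + 120 * ∑ᵛ 5 (penalty A)
      ≡⟨ cong (λ p → + 7680 * fourCount A + + 120 * p) penalties ⟩
    + 7680 * fourCount A + + 120 * (+ 2 * squareSum A + N ^ 2 * evenCount A)
      ≡⟨ regroup (fourCount A) (+ 2 * squareSum A + N ^ 2 * evenCount A) ⟩
    + 120 * (+ 64 * fourCount A + (+ 2 * squareSum A + N ^ 2 * evenCount A)) ∎
    where
    open ≡-Reasoning
    regroup : ∀ f p → + 7680 * f + + 120 * p ≡ + 120 * (+ 64 * f + p)
    regroup = solve-∀
    triple : Vec (Fin n) 3 → ℤ
    triple (x ∷ y ∷ z ∷ []) = evenTriple A x y z
    split : ∀ v → penalty A v ≡ + 2 * quadratic A v + triple (take 3 v)
    split (x ∷ y ∷ z ∷ _ ∷ _ ∷ []) = refl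
    penalties : ∑ᵛ 5 (penalty A) ≡ + 2 * squareSum A + N ^ 2 * evenCount A
    penalties = trans (∑ᵛ-cong 5 split)
      (trans (∑ᵛ-+ 5 (λ v → + 2 * quadratic A v) (λ v → triple (take 3 v)))
             (cong₂ _+_ (∑ᵛ-* 5 (+ 2) (quadratic A)) (∑ᵛ-prefix 3 2 triple)))

  count-bound : ∀ A → (∀ x y → A x y ≡ A y x) → (∀ x → A x x ≡ true) →
                + 64 * fourCount A + (+ 2 * squareSum A + N ^ 2 * evenCount A) ≤ + 40 * N ^ 5
  count-bound A A-sym A-refl = *-cancelˡ-≤-pos
    (+ 64 * fourCount A + (+ 2 * squareSum A + N ^ 2 * evenCount A)) (+ 40 * N ^ 5) (+ 120)
    (subst₂ _≤_ (∑ᵛ-value A) (trans (∑ᵛ-const {n} 5 (+ 4800)) (regroup (N ^ 5)))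
      (∑ᵛ-mono 5 {g = λ _ → + 4800} (pointwise-bound A A-sym A-refl)))
    where
    regroup : ∀ m → m * + 4800 ≡ + 120 * (+ 40 * m)
    regroup = solve-∀

  module _ (h : Fin n → Bool) where

    private
      B : Fin n → Fin n → Bool
      B = balanced h

    evenCount-balanced : evenCount B ≡ + 0
    evenCount-balanced = trans
      (sum-cong-≗ {n} λ x → trans
        (sum-cong-≗ {n} λ y → trans (sum-cong-≗ {n} λ z → odd (h x) (h y) (h z)) (zeroes n))
        (zeroes n))
      (zeroes n)
      where
      odd : ∀ a b c → 𝟙 (even (same a b) (same a c) (same b c)) ≡ + 0
      odd true  true  true  = refl
      odd true  true  false = refl
      odd true  false true  = refl
      odd true  false false = refl
      odd false true  true  = refl
      odd false true  false = refl
      odd false false true  = refl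
      odd false false false = refl
      zeroes : ∀ n → ∑[ i < n ] (+ 0) ≡ + 0
      zeroes n = trans (sum-const n (+ 0)) (*-zeroʳ (+ n))

    count-balanced : + 64 * fourCount B + + 2 * squareSum B ≡ + 40 * N ^ 5
    count-balanced = *-cancelˡ-≡ (+ 120) (+ 64 * fourCount B + + 2 * squareSum B) (+ 40 * N ^ 5)
      (trans (sym (trans (∑ᵛ-value B) (cong (+ 120 *_) noEven)))
             (trans (trans (∑ᵛ-cong 5 {g = λ _ → + 4800} (pointwise-balanced h)) (∑ᵛ-const {n} 5 (+ 4800))) (regroup (N ^ 5))))
      where
      regroup : ∀ m → m * + 4800 ≡ + 120 * (+ 40 * m)
      regroup = solve-∀
      drop : ∀ f s m → + 64 * f + (+ 2 * s + m * + 0) ≡ + 64 * f + + 2 * s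
      drop = solve-∀
      noEven : + 64 * fourCount B + (+ 2 * squareSum B + N ^ 2 * evenCount B) ≡ + 64 * fourCount B + + 2 * squareSum B
      noEven = trans (cong (λ u → + 64 * fourCount B + (+ 2 * squareSum B + N ^ 2 * u)) evenCount-balanced)
                     (drop (fourCount B) (squareSum B) (N ^ 2))

    -- Signs at different positions sum independently, so a product of j signs totals n^(5-j) times
    -- the j-th power of the bias.
    fourCount-balanced : + 8 * fourCount B ≡ + 5 * N ^ 5 - + 10 * (N ^ 3 * bias h ^ 2) + + 5 * (N * bias h ^ 4)
    fourCount-balanced = *-cancelˡ-≡ (+ 120) (+ 8 * fourCount B)
      (+ 5 * N ^ 5 - + 10 * (N ^ 3 * bias h ^ 2) + + 5 * (N * bias h ^ 4)) (begin
      + 120 * (+ 8 * fourCount B)          ≡⟨ regroup (fourCount B) ⟩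
      + 960 * fourCount B                  ≡⟨ ∑ᵛ-* 5 (+ 960) (fourEdges B) ⟨
      ∑ᵛ 5 (λ v → + 960 * fourEdges B v)   ≡⟨ ∑ᵛ-cong 5 (pointwise-signPolynomial h) ⟩
      ∑ᵛ 5 (symmetrise (signPolynomial h)) ≡⟨ ∑ᵛ-symmetrise 5 (signPolynomial h) ⟩
      + 120 * ∑ᵛ 5 (signPolynomial h)      ≡⟨ cong (+ 120 *_) polynomial ⟩
      + 120 * (+ 5 * N ^ 5 - + 10 * (N ^ 3 * bias h ^ 2) + + 5 * (N * bias h ^ 4)) ∎)
      where
      open ≡-Reasoning
      regroup : ∀ f → + 120 * (+ 8 * f) ≡ + 960 * f
      regroup = solve-∀
      first2 first4 : Vec (Fin n) 5 → ℤ
      first2 v = signs h (take 2 v)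
      first4 v = signs h (take 4 v)
      split : ∀ v → signPolynomial h v ≡ + 5 + ((- + 10) * first2 v + + 5 * first4 v)
      split (x ∷ y ∷ z ∷ u ∷ _ ∷ []) = refl
      twos : ∑ᵛ 5 first2 ≡ N ^ 3 * bias h ^ 2
      twos = trans (∑ᵛ-prefix 2 3 (signs h)) (cong (N ^ 3 *_) (∑ᵛ-signs 2 h))
      fours : ∑ᵛ 5 first4 ≡ N ^ 1 * bias h ^ 4
      fours = trans (∑ᵛ-prefix 4 1 (signs h)) (cong (N ^ 1 *_) (∑ᵛ-signs 4 h))
      tidy : ∀ m p n q → m * + 5 + ((- + 10) * p + + 5 * ((n * + 1) * q)) ≡ + 5 * m - + 10 * p + + 5 * (n * q)
      tidy = solve-∀
      polynomial : ∑ᵛ 5 (signPolynomial h) ≡ + 5 * N ^ 5 - + 10 * (N ^ 3 * bias h ^ 2) + + 5 * (N * bias h ^ 4)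
      polynomial = begin
        ∑ᵛ 5 (signPolynomial h)
          ≡⟨ ∑ᵛ-cong 5 split ⟩
        ∑ᵛ 5 (λ v → + 5 + ((- + 10) * first2 v + + 5 * first4 v))
          ≡⟨ ∑ᵛ-+ 5 (λ _ → + 5) (λ v → (- + 10) * first2 v + + 5 * first4 v) ⟩
        ∑ᵛ {n} 5 (λ _ → + 5) + ∑ᵛ 5 (λ v → (- + 10) * first2 v + + 5 * first4 v)
          ≡⟨ cong₂ _+_ (∑ᵛ-const {n} 5 (+ 5)) (∑ᵛ-+ 5 (λ v → (- + 10) * first2 v) (λ v → + 5 * first4 v)) ⟩
        N ^ 5 * + 5 + (∑ᵛ 5 (λ v → (- + 10) * first2 v) + ∑ᵛ 5 (λ v → + 5 * first4 v))
          ≡⟨ cong (_+_ (N ^ 5 * + 5)) (cong₂ _+_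
               (trans (∑ᵛ-* 5 (- + 10) first2) (cong ((- + 10) *_) twos))
               (trans (∑ᵛ-* 5 (+ 5) first4) (cong (+ 5 *_) fours))) ⟩
        N ^ 5 * + 5 + ((- + 10) * (N ^ 3 * bias h ^ 2) + + 5 * (N ^ 1 * bias h ^ 4))
          ≡⟨ tidy (N ^ 5) (N ^ 3 * bias h ^ 2) N (bias h ^ 4) ⟩
        + 5 * N ^ 5 - + 10 * (N ^ 3 * bias h ^ 2) + + 5 * (N * bias h ^ 4) ∎

-- Squares of a relation against those of a union of two cliques

0≤weight : ∀ k → + 0 ≤ weight k
0≤weight 0F = +≤+ ℕ.z≤n
0≤weight 1F = +≤+ ℕ.z≤n
0≤weight 2F = +≤+ ℕ.z≤n
0≤weight 3F = +≤+ ℕ.z≤n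
0≤weight 4F = +≤+ ℕ.z≤n

0≤lit : ∀ n → + 0 ≤ + n
0≤lit n = +≤+ ℕ.z≤n

-- The tangent-line bound (q a)² ≥ 2 (q a)(p b) - (p b)², with the cross term
-- estimated through ∣ b ∣ ≤ 4 d and ∣ a - b ∣ ≤ 8 e.
tangent : ∀ p q a b d e → + 0 ≤ p * q → - (+ 4 * d) ≤ b → b ≤ + 4 * d →
          a - b ≤ + 8 * e → b - a ≤ + 8 * e →
          (+ 2 * (p * q) - p * p) * (b * b) ≤ q * q * (a * a) + + 64 * (p * q) * (d * e)
tangent p q a b d e 0≤pq lo hi a-b b-a = ≤-by _
  (0≤+ (0≤sq (q * a - p * b))
       (0≤* 0≤pq (0≤+ (0≤* (0≤-gap lo) (0≤-gap b-a)) (0≤* (0≤-gap hi) (0≤-gap a-b)))))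
  (identity p q a b d e)
  where
  identity : ∀ p q a b d e → q * q * (a * a) + + 64 * (p * q) * (d * e) ≡
    (+ 2 * (p * q) - p * p) * (b * b) +
    ((q * a - p * b) * (q * a - p * b) +
     p * q * ((b - - (+ 4 * d)) * (+ 8 * e - (b - a)) + (+ 4 * d - b) * (+ 8 * e - (a - b))))
  identity = solve-∀

sum-- : ∀ {n} (f g : Fin n → ℤ) → sum f - sum g ≡ ∑[ i < n ] (f i - g i)
sum-- {zero}  f g = refl
sum-- {suc n} f g = trans (regroup (f zero) (sum (λ i → f (suc i))) (g zero) (sum (λ i → g (suc i))))
                          (cong (_+_ (f zero - g zero)) (sum-- (λ i → f (suc i)) (λ i → g (suc i))))
  where
  regroup : ∀ a b c d → a + b - (c + d) ≡ a - c + (b - d)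
  regroup = solve-∀

sum-product : ∀ {m n} (f : Fin m → ℤ) (g : Fin n → ℤ) →
              ∑[ i < m ] ∑[ j < n ] (f i * g j) ≡ sum f * sum g
sum-product f g = trans (sum-cong-≗ λ i → sym (*-distribˡ-sum (f i) g)) (sum-*ʳ f (sum g))

module _ {n : ℕ} where

  private
    N : ℤ
    N = + n

  linear : (Fin n → Fin n → Bool) → Fin 5 → Fin n → Fin n → Fin n → ℤ
  linear A k x y z = ∑[ u < n ] formAt A k x y z u

  squares : (Fin n → Fin n → Bool) → Vec (Fin n) 3 → ℤ
  squares A (x ∷ y ∷ z ∷ []) = ∑[ k < 5 ] (weight k * (linear A k x y z * linear A k x y z))

  squareSum-linear : ∀ A → squareSum A ≡ ∑ᵛ 3 (squares A)
  squareSum-linear A = sum-cong-≗ {n} λ x → sum-cong-≗ {n} λ y → sum-cong-≗ {n} λ z → inner x y z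
    where
    inner : ∀ x y z → ∑[ u < n ] ∑[ w < n ] ∑[ k < 5 ] (weight k * (formAt A k x y z u * formAt A k x y z w))
                      ≡ squares A (x ∷ y ∷ z ∷ [])
    inner x y z = begin
      ∑[ u < n ] ∑[ w < n ] ∑[ k < 5 ] (weight k * (f k u * f k w))
        ≡⟨ sum-cong-≗ {n} (λ u → ∑-comm (λ w k → weight k * (f k u * f k w))) ⟩
      ∑[ u < n ] ∑[ k < 5 ] ∑[ w < n ] (weight k * (f k u * f k w))
        ≡⟨ ∑-comm (λ u k → ∑[ w < n ] (weight k * (f k u * f k w))) ⟩
      ∑[ k < 5 ] ∑[ u < n ] ∑[ w < n ] (weight k * (f k u * f k w))
        ≡⟨ sum-cong-≗ {5} (λ k → trans
             (sum-cong-≗ {n} (λ u → sym (*-distribˡ-sum (weight k) (λ w → f k u * f k w))))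
             (sym (*-distribˡ-sum (weight k) (λ u → ∑[ w < n ] (f k u * f k w))))) ⟩
      ∑[ k < 5 ] (weight k * ∑[ u < n ] ∑[ w < n ] (f k u * f k w))
        ≡⟨ sum-cong-≗ {5} (λ k → cong (weight k *_) (sum-product (f k) (f k))) ⟩
      ∑[ k < 5 ] (weight k * (sum (f k) * sum (f k))) ∎
      where
      open ≡-Reasoning
      f : Fin 5 → Fin n → ℤ
      f k u = formAt A k x y z u

  wrong-sym : ∀ (A B : Fin n → Fin n → Bool) x y → wrong A B x y ≡ wrong B A x y
  wrong-sym A B x y with A x y | B x y
  ... | true  | true  = refl
  ... | true  | false = refl
  ... | false | true  = refl
  ... | false | false = refl

  linear-lipschitz : ∀ A B k x y z →
    linear A k x y z - linear B k x y z ≤ + 8 * ∑[ u < n ] ∑pairs (wrong A B) (x ∷ y ∷ z ∷ u ∷ [])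
  linear-lipschitz A B k x y z = subst₂ _≤_
    (sym (sum-- (formAt A k x y z) (formAt B k x y z)))
    (sym (*-distribˡ-sum (+ 8) (λ u → ∑pairs (wrong A B) (x ∷ y ∷ z ∷ u ∷ []))))
    (sum-mono λ u → formAt-lipschitz A B k x y z u)

  module _ (A : Fin n → Fin n → Bool) (h : Fin n → Bool) (d : ℤ) (-d≤D : - d ≤ bias h) (D≤d : bias h ≤ d) where

    private
      B : Fin n → Fin n → Bool
      B = balanced h

      W : ℤ
      W = wrongCount A B

    linear-balanced : ∀ k x y z → linear B k x y z ≡ slope k (h x) (h y) (h z) * bias h
    linear-balanced k x y z = trans
      (sum-cong-≗ {n} λ u → form-balanced k (h x) (h y) (h z) (h u))
      (sym (*-distribˡ-sum (slope k (h x) (h y) (h z)) (λ u → ±1 (h u))))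

    -- Twice each slack is a sum of two products of gaps; this bilinear form avoids distinguishing
    -- the signs of `s` and of the bias.
    scaled-bias : ∀ s → - + 4 ≤ s → s ≤ + 4 → - (+ 4 * d) ≤ s * bias h × s * bias h ≤ + 4 * d
    scaled-bias s lo hi = half (lower s (bias h) d)
                               (0≤+ (0≤* (0≤-gap lo) (0≤-gap -d≤D)) (0≤* (0≤-gap hi) (0≤-gap D≤d)))
                        , half (upper s (bias h) d)
                               (0≤+ (0≤* (0≤-gap lo) (0≤-gap D≤d)) (0≤* (0≤-gap hi) (0≤-gap -d≤D)))
      where
      half : ∀ {a b c} → + 2 * b ≡ + 2 * a + c → + 0 ≤ c → a ≤ b
      half {a} {b} {c} eq 0≤c = *-cancelˡ-≤-pos a b (+ 2) (≤-by c 0≤c eq)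
      lower : ∀ s D d → + 2 * (s * D) ≡
        + 2 * (- (+ 4 * d)) + ((s - - + 4) * (D - - d) + (+ 4 - s) * (d - D))
      lower = solve-∀
      upper : ∀ s D d → + 2 * (+ 4 * d) ≡
        + 2 * (s * D) + ((s - - + 4) * (d - D) + (+ 4 - s) * (D - - d))
      upper = solve-∀

    squares-bound : ∀ p q → + 0 ≤ p * q → ∀ x y z →
      (+ 2 * (p * q) - p * p) * squares B (x ∷ y ∷ z ∷ []) ≤
      q * q * squares A (x ∷ y ∷ z ∷ []) +
      + 7488 * (p * q) * (d * ∑[ u < n ] ∑pairs (wrong A B) (x ∷ y ∷ z ∷ u ∷ []))
    squares-bound p q 0≤pq x y z = subst₂ _≤_
      (sym (*-distribˡ-sum {5} c (λ k → weight k * (b k * b k))))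
      (trans (∑-distrib-+ {5} (λ k → q * q * (weight k * (a k * a k))) (λ k → weight k * r))
             (cong₂ _+_ (sym (*-distribˡ-sum {5} (q * q) (λ k → weight k * (a k * a k)))) (total (p * q) (d * E))))
      (sum-mono {5} λ k → subst₂ _≤_ (left (weight k) c (b k * b k)) (right (weight k) (q * q) (a k * a k) r)
        (*-monoˡ-≤-nonNeg′ (0≤weight k)
          (tangent p q (a k) (b k) d E 0≤pq (proj₁ (bound k)) (proj₂ (bound k))
            (linear-lipschitz A B k x y z)
            (≤-trans (linear-lipschitz B A k x y z) (≤-reflexive (cong (+ 8 *_) flip))))))
      where
      E c r : ℤ
      E = ∑[ u < n ] ∑pairs (wrong A B) (x ∷ y ∷ z ∷ u ∷ [])
      c = + 2 * (p * q) - p * p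
      r = + 64 * (p * q) * (d * E)
      a b : Fin 5 → ℤ
      a k = linear A k x y z
      b k = linear B k x y z
      bound : ∀ k → - (+ 4 * d) ≤ b k × b k ≤ + 4 * d
      bound k = subst (λ t → - (+ 4 * d) ≤ t × t ≤ + 4 * d) (sym (linear-balanced k x y z))
        (scaled-bias (slope k (h x) (h y) (h z)) (-4≤formVec k v) (formVec≤4 k v))
        where
        v : Vec Bool 6
        v = same (h x) (h y) ∷ same (h x) (h z) ∷ same (h y) (h z) ∷ h x ∷ h y ∷ h z ∷ []
      flip : ∑[ u < n ] ∑pairs (wrong B A) (x ∷ y ∷ z ∷ u ∷ []) ≡ E
      flip = sum-cong-≗ {n} λ u → ∑pairs-cong (wrong-sym B A) (x ∷ y ∷ z ∷ u ∷ [])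
      *-monoˡ-≤-nonNeg′ : ∀ {w s t} → + 0 ≤ w → s ≤ t → w * s ≤ w * t
      *-monoˡ-≤-nonNeg′ {w} {s} {t} 0≤w s≤t = ≤-by (w * (t - s)) (0≤* 0≤w (0≤-gap s≤t)) (distrib w s t)
        where
        distrib : ∀ w s t → w * t ≡ w * s + w * (t - s)
        distrib = solve-∀
      left : ∀ w c s → w * (c * s) ≡ c * (w * s)
      left = solve-∀
      right : ∀ w c s r → w * (c * s + r) ≡ c * (w * s) + w * r
      right = solve-∀
      total : ∀ m e → + 5 * (+ 64 * m * e) + (+ 35 * (+ 64 * m * e) + (+ 9 * (+ 64 * m * e)
                + (+ 18 * (+ 64 * m * e) + (+ 50 * (+ 64 * m * e) + + 0)))) ≡ + 7488 * m * e
      total = solve-∀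

    -- With r = p/q it reads S(A) ≥ (2r - r²) S(B) - 44928 r d n² W: a small r scales down the error
    -- together with the main term. The values taken later are r = 1 and r = 1/M.
    squareSum-bound : ∀ p q → + 0 ≤ p * q →
      (+ 2 * (p * q) - p * p) * squareSum B ≤ q * q * squareSum A + + 44928 * (p * q) * d * (N ^ 2 * W)
    squareSum-bound p q 0≤pq = subst₂ _≤_
      (trans (∑ᵛ-* 3 c (squares B)) (cong (c *_) (sym (squareSum-linear B))))
      (trans (∑ᵛ-+ 3 (λ v → q * q * squares A v) (λ v → m * (d * E v)))
             (cong₂ _+_ (trans (∑ᵛ-* 3 (q * q) (squares A)) (cong (q * q *_) (sym (squareSum-linear A))))
                        errors))
      (∑ᵛ-mono 3 {f = λ v → c * squares B v} {g = λ v → q * q * squares A v + m * (d * E v)} λ { (x ∷ y ∷ z ∷ []) → squares-bound p q 0≤pq x y z })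
      where
      c m : ℤ
      c = + 2 * (p * q) - p * p
      m = + 7488 * (p * q)
      E : Vec (Fin n) 3 → ℤ
      E (x ∷ y ∷ z ∷ []) = ∑[ u < n ] ∑pairs (wrong A B) (x ∷ y ∷ z ∷ u ∷ [])
      -- Together with the sum over `u` this is definitionally a sum over 4-tuples, whose six pairs
      -- give the factor.
      E-total : ∑ᵛ 3 E ≡ + 6 * (N ^ 2 * W)
      E-total = ∑ᵛ-∑pairs 2 (wrong A B)
      regroup : ∀ m d s → + 7488 * m * (d * (+ 6 * s)) ≡ + 44928 * m * d * s
      regroup = solve-∀
      errors : ∑ᵛ 3 (λ v → m * (d * E v)) ≡ + 44928 * (p * q) * d * (N ^ 2 * W)
      errors = trans (∑ᵛ-* 3 m (λ v → d * E v))
        (trans (cong (m *_) (trans (∑ᵛ-* 3 d E) (cong (d *_) E-total))) (regroup (p * q) d (N ^ 2 * W)))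

even-wrong : ∀ a b c → 𝟙 (even a b c) ≡ 𝟙 (c xor same a b)
even-wrong true  true  true  = refl
even-wrong true  true  false = refl
even-wrong true  false true  = refl
even-wrong true  false false = refl
even-wrong false true  true  = refl
even-wrong false true  false = refl
even-wrong false false true  = refl
even-wrong false false false = refl

-- Splitting the vertices into the neighbours and the non-neighbours of v, the
-- wrong pairs are exactly those forming an even triple with v.
evenCount-wrong : ∀ {n} (A : Fin n → Fin n → Bool) →
                  evenCount A ≡ ∑[ v < n ] wrongCount A (balanced (A v))
evenCount-wrong {n} A = sum-cong-≗ {n} λ v → sum-cong-≗ {n} λ y → sum-cong-≗ {n} λ z →
  even-wrong (A v y) (A v z) (A y z)

-- Nearly equal and very unequal cliques

module _ (κ M N d Φ S U W F T : ℤ) (1≤κ : + 1 ≤ κ) (M-big : + 2 * κ ≤ M) (0≤N : + 0 ≤ N) (0≤W : + 0 ≤ W) (0≤d : + 0 ≤ d)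
         (count : + 64 * Φ + (+ 2 * S + N ^ 2 * U) ≤ + 40 * N ^ 5) (NW≤U : N * W ≤ U)
         (balT : + 64 * F + + 2 * T ≡ + 40 * N ^ 5) where

  private
    0≤κ : + 0 ≤ κ
    0≤κ = ≤-trans (0≤lit 1) 1≤κ

    1≤M : + 1 ≤ M
    1≤M = ≤-trans (≤-trans 1≤κ (≤-by κ 0≤κ (double κ))) M-big
      where
      double : ∀ κ → + 2 * κ ≡ κ + κ
      double = solve-∀

    0≤M : + 0 ≤ M
    0≤M = ≤-trans (0≤lit 1) 1≤M

    0≤N² : + 0 ≤ N * N
    0≤N² = 0≤* 0≤N 0≤N

    0≤N³ : + 0 ≤ N * N * N
    0≤N³ = 0≤* 0≤N² 0≤N

  -- `F` and `T` are the values of `Φ` and `S` on the union of two cliques. Comparing its equality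
  -- with the bound for the graph, the even triples contribute 2 N³ W to 128 (F - Φ), and the error
  -- 4 κ d N² W consumes at most half of that.
  close-arithmetic :
    (+ 2 * (+ 1 * + 1) - + 1 * + 1) * T ≤ + 1 * + 1 * S + κ * (+ 1 * + 1) * d * (N ^ 2 * W) →
    + 2 * M * d ≤ N → + 128 * Φ + N ^ 3 * W ≤ + 128 * F
  close-arithmetic bound 2Md≤N = ≤-by _
    (0≤+ (0≤* (0≤lit 2) (0≤-gap count′)) (0≤+ (0≤* (0≤lit 4) (0≤-gap bound))
    (0≤+ (0≤* (0≤* (0≤lit 2) 0≤N²) (0≤-gap NW≤U))
         (0≤* (0≤* 0≤N² 0≤W) (0≤+ (0≤-gap 2Md≤N) (0≤* (0≤* (0≤lit 2) 0≤d) (0≤-gap M-big)))))))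
    (identity κ M N d Φ S U W F T)
    where
    count′ : + 64 * Φ + (+ 2 * S + N ^ 2 * U) ≤ + 64 * F + + 2 * T
    count′ = subst (+ 64 * Φ + (+ 2 * S + N ^ 2 * U) ≤_) (sym balT) count
    identity : ∀ κ M N d Φ S U W F T → + 128 * F ≡ + 128 * Φ + (N * (N * (N * + 1))) * W +
      (+ 2 * (+ 64 * F + + 2 * T - (+ 64 * Φ + (+ 2 * S + (N * (N * + 1)) * U))) +
      (+ 4 * (+ 1 * + 1 * S + κ * (+ 1 * + 1) * d * ((N * (N * + 1)) * W) - (+ 2 * (+ 1 * + 1) - + 1 * + 1) * T) +
      (+ 2 * (N * N) * (U - N * W) +
       N * N * W * (N - + 2 * M * d + + 2 * d * (M - + 2 * κ)))))
    identity = solve-∀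

  -- At slope 1/M the even triples absorb the error for every d ≤ N, because 2 κ ≤ M. About 1/M of
  -- `T` is kept; it has order N³ d², and N ≤ 2 M d makes this a deficit of order N⁵ / M³.
  far-arithmetic :
    (+ 2 * (+ 1 * M) - + 1 * + 1) * T ≤ M * M * S + κ * (+ 1 * M) * d * (N ^ 2 * W) →
    + 8 * F ≡ + 5 * N ^ 5 - + 10 * (N ^ 3 * d ^ 2) + + 5 * (N * d ^ 4) →
    d ≤ N → N ≤ + 2 * M * d →
    + 32 * (M * M * M) * Φ + + 5 * N ^ 5 ≤ + 20 * (M * M * M) * N ^ 5
  far-arithmetic bound balF d≤N N≤2Md = *-cancelˡ-≤-pos _ _ (+ 8) (≤-by _
    (0≤+ (0≤* (0≤* (0≤lit 4) (0≤* 0≤M 0≤M)) (0≤-gap scaled))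
         (0≤* (0≤* (0≤lit 40) 0≤N³) (0≤* (0≤-gap N≤2Md) (0≤+ (0≤* (0≤* (0≤lit 2) 0≤M) 0≤d) 0≤N))))
    (identity₄ M N d Φ))
    where
    identity₁ : ∀ κ M N d Φ S U W T → + 40 * (M * M) * (N * (N * (N * (N * (N * + 1))))) ≡
      + 64 * (M * M) * Φ + (+ 2 * M - + 1) * (+ 2 * T) +
      (M * M * (+ 40 * (N * (N * (N * (N * (N * + 1))))) - (+ 64 * Φ + (+ 2 * S + (N * (N * + 1)) * U))) +
      (+ 2 * (M * M * S + κ * (+ 1 * M) * d * ((N * (N * + 1)) * W) - (+ 2 * (+ 1 * M) - + 1 * + 1) * T) +
      (M * M * (N * N) * (U - N * W) +
       M * (N * N) * W * ((M - + 2 * κ) * N + + 2 * κ * (N - d)))))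
    identity₁ = solve-∀
    gap : + 64 * (M * M) * Φ + (+ 2 * M - + 1) * (+ 2 * T) ≤ + 40 * (M * M) * N ^ 5
    gap = ≤-by _
      (0≤+ (0≤* (0≤* 0≤M 0≤M) (0≤-gap count)) (0≤+ (0≤* (0≤lit 2) (0≤-gap bound))
      (0≤+ (0≤* (0≤* (0≤* 0≤M 0≤M) 0≤N²) (0≤-gap NW≤U))
           (0≤* (0≤* (0≤* 0≤M 0≤N²) 0≤W)
                (0≤+ (0≤* (0≤-gap M-big) 0≤N) (0≤* (0≤* (0≤lit 2) 0≤κ) (0≤-gap d≤N)))))))
      (identity₁ κ M N d Φ S U W T)
    identity₂ : ∀ F T N d → + 40 * (N * (N * (N * (N * (N * + 1))))) - + 8 * (+ 5 * (N * (N * (N * (N * (N * + 1))))) - + 10 * ((N * (N * (N * + 1))) * (d * (d * + 1))) + + 5 * (N * (d * (d * (d * (d * + 1)))))) ≡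
                + 80 * ((N * (N * (N * + 1))) * (d * (d * + 1))) - + 40 * (N * (d * (d * (d * (d * + 1)))))
    identity₂ = solve-∀
    isolate : ∀ F T → + 2 * T ≡ + 64 * F + + 2 * T - + 8 * (+ 8 * F)
    isolate = solve-∀
    -- Eliminating `F` from its two evaluations, the tight certificate and the sign polynomial,
    -- expresses `T` through d.
    T-value : + 2 * T ≡ + 80 * (N ^ 3 * d ^ 2) - + 40 * (N * d ^ 4)
    T-value = trans (isolate F T) (trans (cong₂ (λ a b → a - + 8 * b) balT balF) (identity₂ F T N d))
    identity₃ : ∀ M N d Φ → + 40 * (M * M) * (N * (N * (N * (N * (N * + 1))))) ≡
      M * (+ 64 * M * Φ + + 40 * ((N * (N * (N * + 1))) * (d * (d * + 1)))) +
      ((+ 40 * (M * M) * (N * (N * (N * (N * (N * + 1))))) - (+ 64 * (M * M) * Φ + (+ 2 * M - + 1) * (+ 80 * ((N * (N * (N * + 1))) * (d * (d * + 1))) - + 40 * (N * (d * (d * (d * (d * + 1)))))))) +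
      (+ 40 * (M - + 1) * (N * N * N * (d * d)) +
       + 40 * (M - + 1 + M) * (N * (d * d) * ((N - d) * (N + d)))))
    identity₃ = solve-∀
    -- As d ≤ N, the value of 2 T is at least 40 N³ d²; and 2 M - 1 is at least M, so a factor M
    -- cancels.
    scaled : + 64 * M * Φ + + 40 * (N ^ 3 * d ^ 2) ≤ + 40 * M * N ^ 5
    scaled = *-cancelˡ-≤-pos _ _ M {{positive (<-≤-trans (+<+ (ℕ.s≤s ℕ.z≤n)) 1≤M)}} (≤-by _
      (0≤+ (0≤-gap (subst (λ t → + 64 * (M * M) * Φ + (+ 2 * M - + 1) * t ≤ + 40 * (M * M) * N ^ 5) T-value gap))
      (0≤+ (0≤* (0≤* (0≤lit 40) (0≤-gap 1≤M)) (0≤* 0≤N³ (0≤* 0≤d 0≤d)))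
           (0≤* (0≤* (0≤lit 40) (0≤+ (0≤-gap 1≤M) 0≤M))
                (0≤* (0≤* 0≤N (0≤* 0≤d 0≤d)) (0≤* (0≤-gap d≤N) (0≤+ 0≤N 0≤d))))))
      (trans (commute M N) (identity₃ M N d Φ)))
      where
      commute : ∀ M N → M * (+ 40 * M * (N * (N * (N * (N * (N * + 1)))))) ≡ + 40 * (M * M) * (N * (N * (N * (N * (N * + 1)))))
      commute = solve-∀
    identity₄ : ∀ M N d Φ → + 8 * (+ 20 * (M * M * M) * (N * (N * (N * (N * (N * + 1)))))) ≡
      + 8 * (+ 32 * (M * M * M) * Φ + + 5 * (N * (N * (N * (N * (N * + 1)))))) +
      (+ 4 * (M * M) * (+ 40 * M * (N * (N * (N * (N * (N * + 1))))) - (+ 64 * M * Φ + + 40 * ((N * (N * (N * + 1))) * (d * (d * + 1))))) +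
       + 40 * (N * N * N) * ((+ 2 * M * d - N) * (+ 2 * M * d + N)))
    identity₄ = solve-∀

±1-bounds : ∀ b → - + 1 ≤ ±1 b × ±1 b ≤ + 1
±1-bounds true  = -≤+ , ≤-refl
±1-bounds false = ≤-refl , -≤+

∣bias∣≤ : ∀ {n} (h : Fin n → Bool) → + ∣ bias h ∣ ≤ + n
∣bias∣≤ {n} h = absolute (bias h)
  (≤-trans (≤-reflexive (sym (trans (sum-const n (- + 1)) (negate (+ n))))) (sum-mono λ x → proj₁ (±1-bounds (h x))))
  (≤-trans (sum-mono λ x → proj₂ (±1-bounds (h x))) (≤-reflexive (trans (sum-const n (+ 1)) (*-identityʳ (+ n)))))
  where
  negate : ∀ m → m * - + 1 ≡ - m
  negate = solve-∀
  absolute : ∀ D {b} → - b ≤ D → D ≤ b → + ∣ D ∣ ≤ b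
  absolute (+ m)     _  hi = hi
  absolute -[1+ m ] {b} lo _ = subst (+ suc m ≤_) (neg-involutive b) (neg-mono-≤ lo)

module _ {n : ℕ} where

  private
    N : ℤ
    N = + n

  0≤wrongCount : ∀ (A B : Fin n → Fin n → Bool) → + 0 ≤ wrongCount A B
  0≤wrongCount A B = 0≤sum λ x → 0≤sum λ y → 0≤𝟙 (A x y xor B x y)

  wrongCount≤ : ∀ (A B : Fin n → Fin n → Bool) → wrongCount A B ≤ N * N
  wrongCount≤ A B = ≤-trans
    (sum-mono λ x → ≤-trans (sum-mono λ y → 𝟙≤1 (A x y xor B x y))
                            (≤-reflexive (trans (sum-const n (+ 1)) (*-identityʳ N))))
    (≤-reflexive (sum-const n N))

  fourCount-∣bias∣ : ∀ (h : Fin n → Bool) → let d = + ∣ bias h ∣ in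
    + 8 * fourCount (balanced h) ≡ + 5 * N ^ 5 - + 10 * (N ^ 3 * d ^ 2) + + 5 * (N * d ^ 4)
  fourCount-∣bias∣ h = trans (fourCount-balanced h)
    (cong₂ (λ a b → + 5 * N ^ 5 - + 10 * (N ^ 3 * a) + + 5 * (N * b)) (square (bias h)) (fourth (bias h)))
    where
    square : ∀ D → D ^ 2 ≡ (+ ∣ D ∣) ^ 2
    square (+ m)    = refl
    square -[1+ m ] = flip (+ suc m)
      where
      flip : ∀ d → - d * (- d * + 1) ≡ d * (d * + 1)
      flip = solve-∀
    fourth : ∀ D → D ^ 4 ≡ (+ ∣ D ∣) ^ 4
    fourth (+ m)    = refl
    fourth -[1+ m ] = flip (+ suc m)
      where
      flip : ∀ d → - d * (- d * (- d * (- d * + 1))) ≡ d * (d * (d * (d * + 1)))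
      flip = solve-∀

-- The error constant 44928 is 64 (from tangent) times the total weight 117 of the
-- forms times the 6 pairs among four vertices.
close-or-far : ∀ {n} M → + 89856 ≤ M → + 1 ≤ + n → (A : Fin n → Fin n → Bool) →
  (∀ x y → A x y ≡ A y x) → (∀ x → A x x ≡ true) →
  Σ[ h ∈ (Fin n → Bool) ]
    (+ 128 * fourCount A + (+ n) ^ 3 * wrongCount A (balanced h) ≤ + 128 * fourCount (balanced h)
    ⊎ + 32 * (M * M * M) * fourCount A + + 5 * (+ n) ^ 5 ≤ + 20 * (M * M * M) * (+ n) ^ 5)
close-or-far {n} M M-big 1≤n A A-sym A-refl = h , decide (≤-total (+ 2 * M * d) (+ n))
  where
  average : Σ[ v ∈ Fin n ] + n * wrongCount A (balanced (A v)) ≤ evenCount A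
  average = let v , below = below-average 1≤n (λ v → wrongCount A (balanced (A v))) in
            v , ≤-trans below (≤-reflexive (sym (evenCount-wrong A)))
  h : Fin n → Bool
  -- By reflexivity the chosen vertex lies on the side of its neighbours.
  h = A (proj₁ average)
  d : ℤ
  d = + ∣ bias h ∣
  -d≤D : - d ≤ bias h
  -d≤D with bias h
  ... | + m    = ≤-trans (neg-mono-≤ (0≤lit m)) (0≤lit m)
  ... | -[1+ m ] = ≤-refl
  D≤d : bias h ≤ d
  D≤d with bias h
  ... | + m    = ≤-refl
  ... | -[1+ m ] = -≤+
  0≤M : + 0 ≤ M
  0≤M = ≤-trans (0≤lit 89856) M-big
  decide : (+ 2 * M * d ≤ + n) ⊎ (+ n ≤ + 2 * M * d) → _
  decide (inj₁ close) = inj₁ (close-arithmetic (+ 44928) M (+ n) d (fourCount A) (squareSum A) (evenCount A)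
    (wrongCount A (balanced h)) (fourCount (balanced h)) (squareSum (balanced h))
    (+≤+ (ℕ.s≤s ℕ.z≤n)) M-big (0≤lit n) (0≤wrongCount A (balanced h)) (0≤lit ∣ bias h ∣)
    (count-bound A A-sym A-refl) (proj₂ average) (count-balanced h)
    (squareSum-bound A h d -d≤D D≤d (+ 1) (+ 1) (0≤lit 1)) close)
  decide (inj₂ far) = inj₂ (far-arithmetic (+ 44928) M (+ n) d (fourCount A) (squareSum A) (evenCount A)
    (wrongCount A (balanced h)) (fourCount (balanced h)) (squareSum (balanced h))
    (+≤+ (ℕ.s≤s ℕ.z≤n)) M-big (0≤lit n) (0≤wrongCount A (balanced h)) (0≤lit ∣ bias h ∣)
    (count-bound A A-sym A-refl) (proj₂ average) (count-balanced h)
    (squareSum-bound A h d -d≤D D≤d (+ 1) M (0≤* (0≤lit 1) 0≤M)) (fourCount-∣bias∣ h)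
    (∣bias∣≤ h) far)

-- Pairs of equal entries

equal : ∀ {n} → Fin n → Fin n → ℤ
equal x y = 𝟙 (does (x Fin.≟ y))

sum-equal : ∀ {n} (y : Fin n) (φ : Fin n → ℤ) → ∑[ x < n ] (equal x y * φ x) ≡ φ y
sum-equal {suc n} zero φ = begin
  + 1 * φ zero + ∑[ x < n ] (+ 0 * φ (suc x))
    ≡⟨ cong₂ _+_ (*-identityˡ (φ zero)) (sym (*-distribˡ-sum (+ 0) (λ x → φ (suc x)))) ⟩
  φ zero + + 0 * ∑[ x < n ] φ (suc x)
    ≡⟨ cong (_+_ (φ zero)) (*-zeroˡ (∑[ x < n ] φ (suc x))) ⟩
  φ zero + + 0
    ≡⟨ +-identityʳ (φ zero) ⟩
  φ zero ∎
  where open ≡-Reasoning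
sum-equal {suc n} (suc y) φ = trans
  (cong (λ t → t + ∑[ x < n ] (equal x y * φ (suc x))) (*-zeroˡ (φ zero)))
  (trans (+-identityˡ _) (sum-equal y (λ x → φ (suc x))))

sum-equal-pairs : ∀ n → ∑[ x < n ] ∑[ y < n ] equal x y ≡ + n
sum-equal-pairs n = trans (∑-comm {n} {n} equal)
  (trans (sum-cong-≗ {n} λ y → trans (sum-cong-≗ {n} λ x → sym (*-identityʳ (equal x y))) (sum-equal y (λ _ → + 1)))
         (trans (sum-const n (+ 1)) (*-identityʳ (+ n))))

equalPairs : ∀ {n k} → Vec (Fin n) k → ℤ
equalPairs = ∑pairs equal

-- For all 5-tuples the sum of ∑pairs ω has order n³ W; counting only the repeated
-- entries saves a factor n.
module _ {n : ℕ} (ω : Fin n → Fin n → ℤ) (ω-sym : ∀ x y → ω x y ≡ ω y x) (ω-irrefl : ∀ x → ω x x ≡ + 0) where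

  private
    N W : ℤ
    N = + n
    W = ∑[ x < n ] ∑[ y < n ] ω x y

    degree : Fin n → ℤ
    degree x = ∑[ y < n ] ω x y

    weighted degrees : ℕ → ℤ
    weighted k = ∑ᵛ {n} k (λ v → equalPairs v * ∑pairs ω v)
    degrees k = ∑ᵛ {n} k (λ v → equalPairs v * ∑∈ degree v)

  sum-∑∈ : ∀ {k} (φ : Fin n → Fin n → ℤ) (v : Vec (Fin n) k) →
           ∑[ x < n ] ∑∈ (φ x) v ≡ ∑∈ (λ y → ∑[ x < n ] φ x y) v
  sum-∑∈ φ []      = trans (sum-const n (+ 0)) (*-zeroʳ N)
  sum-∑∈ φ (y ∷ v) = trans (∑-distrib-+ (λ x → φ x y) (λ x → ∑∈ (φ x) v))
                           (cong (_+_ (∑[ x < n ] φ x y)) (sum-∑∈ φ v))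

  ∑∈-* : ∀ {k} (φ : Fin n → ℤ) c (v : Vec (Fin n) k) → ∑∈ φ v * c ≡ ∑∈ (λ y → φ y * c) v
  ∑∈-* φ c []      = *-zeroˡ c
  ∑∈-* φ c (y ∷ v) = trans (*-distribʳ-+ c (φ y) (∑∈ φ v)) (cong (_+_ (φ y * c)) (∑∈-* φ c v))

  ∑∈-+ : ∀ {k} (φ ψ : Fin n → ℤ) (v : Vec (Fin n) k) → ∑∈ (λ y → φ y + ψ y) v ≡ ∑∈ φ v + ∑∈ ψ v
  ∑∈-+ φ ψ []      = refl
  ∑∈-+ φ ψ (y ∷ v) = trans (cong (_+_ (φ y + ψ y)) (∑∈-+ φ ψ v)) (regroup (φ y) (ψ y) (∑∈ φ v) (∑∈ ψ v))
    where
    regroup : ∀ a b c d → a + b + (c + d) ≡ a + c + (b + d)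
    regroup = solve-∀

  ∑∈-const : ∀ {k} c (v : Vec (Fin n) k) → ∑∈ (λ _ → c) v ≡ + k * c
  ∑∈-const c []      = sym (*-zeroˡ c)
  ∑∈-const {suc k} c (y ∷ v) = trans (cong (_+_ c) (∑∈-const c v)) (regroup c (+ k))
    where
    regroup : ∀ c k → c + k * c ≡ (+ 1 + k) * c
    regroup = solve-∀

  sum-equal-∑∈ : ∀ {k} (v : Vec (Fin n) k) (φ : Fin n → ℤ) → ∑[ x < n ] (∑∈ (equal x) v * φ x) ≡ ∑∈ φ v
  sum-equal-∑∈ v φ = trans (sum-cong-≗ {n} λ x → ∑∈-* (equal x) (φ x) v)
    (trans (sum-∑∈ (λ x y → equal x y * φ x) v) (∑∈-cong (λ y → sum-equal y φ) v))

  -- Every pair of positions is met from both ends, and the diagonal vanishes.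
  ∑∈-∑∈ : ∀ {k} (v : Vec (Fin n) k) → ∑∈ (λ x → ∑∈ (ω x) v) v ≡ + 2 * ∑pairs ω v
  ∑∈-∑∈ []      = refl
  ∑∈-∑∈ (y ∷ v) = begin
    ω y y + ∑∈ (ω y) v + ∑∈ (λ x → ω x y + ∑∈ (ω x) v) v
      ≡⟨ cong₂ (λ a b → a + ∑∈ (ω y) v + b) (ω-irrefl y) (∑∈-+ (λ x → ω x y) (λ x → ∑∈ (ω x) v) v) ⟩
    + 0 + ∑∈ (ω y) v + (∑∈ (λ x → ω x y) v + ∑∈ (λ x → ∑∈ (ω x) v) v)
      ≡⟨ cong₂ (λ a b → + 0 + ∑∈ (ω y) v + (a + b)) (∑∈-cong (λ x → ω-sym x y) v) (∑∈-∑∈ v) ⟩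
    + 0 + ∑∈ (ω y) v + (∑∈ (ω y) v + + 2 * ∑pairs ω v)
      ≡⟨ regroup (∑∈ (ω y) v) (∑pairs ω v) ⟩
    + 2 * (∑∈ (ω y) v + ∑pairs ω v) ∎
    where
    open ≡-Reasoning
    regroup : ∀ a b → + 0 + a + (a + + 2 * b) ≡ + 2 * (a + b)
    regroup = solve-∀

  private
    swap-head : ∀ k (f : Vec (Fin n) (suc k) → ℤ) → ∑ᵛ (suc k) f ≡ ∑ᵛ k (λ v → ∑[ x < n ] f (x ∷ v))
    swap-head k f = sym (∑ᵛ-sum k (λ x v → f (x ∷ v)))

    expand : ∀ {k} (v : Vec (Fin n) k) (φ : Fin n → ℤ) c →
      ∑[ x < n ] ((∑∈ (equal x) v + equalPairs v) * (φ x + c)) ≡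
      ∑∈ φ v + + k * c + (equalPairs v * sum φ + N * (equalPairs v * c))
    expand {k} v φ c = begin
      ∑[ x < n ] ((e x + E) * (φ x + c))
        ≡⟨ sum-cong-≗ {n} (λ x → distribute (e x) E (φ x) c) ⟩
      ∑[ x < n ] (e x * φ x + e x * c + (E * φ x + E * c))
        ≡⟨ trans (∑-distrib-+ (λ x → e x * φ x + e x * c) (λ x → E * φ x + E * c))
                 (cong₂ _+_ (∑-distrib-+ (λ x → e x * φ x) (λ x → e x * c))
                            (∑-distrib-+ (λ x → E * φ x) (λ _ → E * c))) ⟩
      ∑[ x < n ] (e x * φ x) + ∑[ x < n ] (e x * c) + (∑[ x < n ] (E * φ x) + ∑[ x < n ] (E * c))
        ≡⟨ cong₂ _+_ (cong₂ _+_ (sum-equal-∑∈ v φ) (trans (sum-equal-∑∈ v (λ _ → c)) (∑∈-const c v)))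
                     (cong₂ _+_ (sym (*-distribˡ-sum E φ)) (sum-const n (E * c))) ⟩
      ∑∈ φ v + + k * c + (E * sum φ + N * (E * c)) ∎
      where
      open ≡-Reasoning
      E : ℤ
      E = equalPairs v
      e : Fin n → ℤ
      e x = ∑∈ (equal x) v
      distribute : ∀ e E p c → (e + E) * (p + c) ≡ e * p + e * c + (E * p + E * c)
      distribute = solve-∀

    degrees-step : ∀ k → degrees (suc k) ≡
      + suc k * ∑ᵛ k (∑∈ degree) + (W * ∑ᵛ {n} k equalPairs + N * degrees k)
    degrees-step k = begin
      degrees (suc k)
        ≡⟨ swap-head k (λ v → equalPairs v * ∑∈ degree v) ⟩
      ∑ᵛ k (λ v → ∑[ x < n ] ((∑∈ (equal x) v + equalPairs v) * (degree x + ∑∈ degree v)))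
        ≡⟨ ∑ᵛ-cong k (λ v → trans (expand v degree (∑∈ degree v))
             (regroup (∑∈ degree v) (+ k) (equalPairs v) W N)) ⟩
      ∑ᵛ k (λ v → + suc k * ∑∈ degree v + (W * equalPairs v + N * (equalPairs v * ∑∈ degree v)))
        ≡⟨ trans (∑ᵛ-+ k (λ v → + suc k * ∑∈ degree v) (λ v → W * equalPairs v + N * (equalPairs v * ∑∈ degree v)))
             (cong₂ _+_ (∑ᵛ-* k (+ suc k) (∑∈ degree))
               (trans (∑ᵛ-+ k (λ v → W * equalPairs v) (λ v → N * (equalPairs v * ∑∈ degree v)))
                      (cong₂ _+_ (∑ᵛ-* k W equalPairs) (∑ᵛ-* k N (λ v → equalPairs v * ∑∈ degree v))))) ⟩
      + suc k * ∑ᵛ k (∑∈ degree) + (W * ∑ᵛ {n} k equalPairs + N * degrees k) ∎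
      where
      open ≡-Reasoning
      regroup : ∀ c k E W N → c + k * c + (E * W + N * (E * c)) ≡ (+ 1 + k) * c + (W * E + N * (E * c))
      regroup = solve-∀

    -- An equality at the new head identifies it with an entry of the tail, while the values of `ω`
    -- at the head sum to degrees of tail entries. The recursion therefore closes only together with
    -- `degrees`.
    weighted-step : ∀ k → weighted (suc k) ≡ (+ 2 + + k) * ∑ᵛ k (∑pairs ω) + (degrees k + N * weighted k)
    weighted-step k = begin
      weighted (suc k)
        ≡⟨ swap-head k (λ v → equalPairs v * ∑pairs ω v) ⟩
      ∑ᵛ k (λ v → ∑[ x < n ] ((∑∈ (equal x) v + equalPairs v) * (∑∈ (ω x) v + ∑pairs ω v)))
        ≡⟨ ∑ᵛ-cong k (λ v → trans (expand v (λ x → ∑∈ (ω x) v) (∑pairs ω v)) (inner v)) ⟩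
      ∑ᵛ k (λ v → (+ 2 + + k) * ∑pairs ω v + (equalPairs v * ∑∈ degree v + N * (equalPairs v * ∑pairs ω v)))
        ≡⟨ trans (∑ᵛ-+ k (λ v → (+ 2 + + k) * ∑pairs ω v)
                         (λ v → equalPairs v * ∑∈ degree v + N * (equalPairs v * ∑pairs ω v)))
             (cong₂ _+_ (∑ᵛ-* k (+ 2 + + k) (∑pairs ω))
               (trans (∑ᵛ-+ k (λ v → equalPairs v * ∑∈ degree v) (λ v → N * (equalPairs v * ∑pairs ω v)))
                      (cong (_+_ (degrees k)) (∑ᵛ-* k N (λ v → equalPairs v * ∑pairs ω v))))) ⟩
      (+ 2 + + k) * ∑ᵛ k (∑pairs ω) + (degrees k + N * weighted k) ∎
      where
      open ≡-Reasoning
      regroup : ∀ p k E d N → + 2 * p + k * p + (E * d + N * (E * p)) ≡ (+ 2 + k) * p + (E * d + N * (E * p))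
      regroup = solve-∀
      inner : ∀ v → ∑∈ (λ x → ∑∈ (ω x) v) v + + k * ∑pairs ω v
                    + (equalPairs v * ∑[ x < n ] ∑∈ (ω x) v + N * (equalPairs v * ∑pairs ω v))
                  ≡ (+ 2 + + k) * ∑pairs ω v + (equalPairs v * ∑∈ degree v + N * (equalPairs v * ∑pairs ω v))
      inner v = trans
        (cong₂ (λ a b → a + + k * ∑pairs ω v + (equalPairs v * b + N * (equalPairs v * ∑pairs ω v)))
          (∑∈-∑∈ v)
          (trans (sum-∑∈ ω v) (∑∈-cong (λ y → sum-cong-≗ {n} λ x → ω-sym x y) v)))
        (regroup (∑pairs ω v) (+ k) (equalPairs v) (∑∈ degree v) N)

  -- Of the 10 · 10 choices of a pair of positions for `equal` and one for `ω`, the 30 disjoint ones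
  -- and the 60 sharing one position contribute N² W each; the 10 coincident ones vanish since `ω`
  -- is zero on the diagonal.
  ∑ᵛ-equalPairs-∑pairs : ∑ᵛ {n} 5 (λ v → equalPairs v * ∑pairs ω v) ≡ + 90 * (N * N * W)
  ∑ᵛ-equalPairs-∑pairs = begin
    weighted 5 ≡⟨ step 4 (sums 2) d₄ w₄ ⟩
    _          ≡⟨ ring₅ N W ⟩
    + 90 * (N * N * W) ∎
    where
    open ≡-Reasoning
    sums : ∀ k → ∑ᵛ (suc (suc k)) (∑pairs ω) ≡ binomial₂ (suc (suc k)) * (N ^ k * W)
    sums k = ∑ᵛ-∑pairs k ω
    T₁ : ∑ᵛ 1 (∑pairs ω) ≡ + 0
    T₁ = trans (sum-const n (+ 0)) (*-zeroʳ N)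
    E₁ : ∑ᵛ {n} 1 equalPairs ≡ + 0
    E₁ = trans (sum-const n (+ 0)) (*-zeroʳ N)
    E : ∀ k → ∑ᵛ {n} (suc (suc k)) equalPairs ≡ binomial₂ (suc (suc k)) * (N ^ k * N)
    E k = trans (∑ᵛ-∑pairs k equal) (cong (λ t → binomial₂ (suc (suc k)) * (N ^ k * t)) (sum-equal-pairs n))
    dstep : ∀ k {r e d} → ∑ᵛ k (∑∈ degree) ≡ r → ∑ᵛ {n} k equalPairs ≡ e → degrees k ≡ d →
            degrees (suc k) ≡ + suc k * r + (W * e + N * d)
    dstep k refl refl refl = degrees-step k
    step : ∀ k {t d w} → ∑ᵛ k (∑pairs ω) ≡ t → degrees k ≡ d → weighted k ≡ w →
           weighted (suc k) ≡ (+ 2 + + k) * t + (d + N * w)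
    step k refl refl refl = weighted-step k
    d₁ : degrees 1 ≡ + 0
    d₁ = trans (dstep 0 refl refl refl) (ring N W)
      where
      ring : ∀ N W → + 1 * + 0 + (W * + 0 + N * + 0) ≡ + 0
      ring = solve-∀
    d₂ : degrees 2 ≡ + 2 * W
    d₂ = trans (dstep 1 (∑ᵛ-∑∈ 0 degree) E₁ d₁) (ring N W)
      where
      ring : ∀ N W → + 2 * (+ 1 * (+ 1 * W)) + (W * + 0 + N * + 0) ≡ + 2 * W
      ring = solve-∀
    d₃ : degrees 3 ≡ + 9 * (N * W)
    d₃ = trans (dstep 2 (∑ᵛ-∑∈ 1 degree) (E 0) d₂) (ring N W)
      where
      ring : ∀ N W → + 3 * (+ 2 * ((N * + 1) * W)) + (W * (+ 1 * (+ 1 * N)) + N * (+ 2 * W)) ≡ + 9 * (N * W)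
      ring = solve-∀
    d₄ : degrees 4 ≡ + 24 * (N * N * W)
    d₄ = trans (dstep 3 (∑ᵛ-∑∈ 2 degree) (E 1) d₃) (ring N W)
      where
      ring : ∀ N W → + 4 * (+ 3 * ((N * (N * + 1)) * W)) + (W * (+ 3 * ((N * + 1) * N)) + N * (+ 9 * (N * W)))
             ≡ + 24 * (N * N * W)
      ring = solve-∀
    w₁ : weighted 1 ≡ + 0
    w₁ = trans (step 0 {w = + 0} refl refl refl) (ring N)
      where
      ring : ∀ N → (+ 2 + + 0) * + 0 + (+ 0 + N * + 0) ≡ + 0
      ring = solve-∀
    w₂ : weighted 2 ≡ + 0
    w₂ = trans (step 1 T₁ d₁ w₁) (ring N)
      where
      ring : ∀ N → (+ 2 + + 1) * + 0 + (+ 0 + N * + 0) ≡ + 0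
      ring = solve-∀
    w₃ : weighted 3 ≡ + 6 * W
    w₃ = trans (step 2 (sums 0) d₂ w₂) (ring N W)
      where
      ring : ∀ N W → (+ 2 + + 2) * (+ 1 * (+ 1 * W)) + (+ 2 * W + N * + 0) ≡ + 6 * W
      ring = solve-∀
    w₄ : weighted 4 ≡ + 30 * (N * W)
    w₄ = trans (step 3 (sums 1) d₃ w₃) (ring N W)
      where
      ring : ∀ N W → (+ 2 + + 3) * (+ 3 * ((N * + 1) * W)) + (+ 9 * (N * W) + N * (+ 6 * W)) ≡ + 30 * (N * W)
      ring = solve-∀
    ring₅ : ∀ N W → (+ 2 + + 4) * (+ 6 * ((N * (N * + 1)) * W)) + (+ 24 * (N * N * W) + N * (+ 30 * (N * W)))
            ≡ + 90 * (N * N * W)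
    ring₅ = solve-∀

-- Tuples with repeated vertices

fresh : ∀ {n k} → Fin n → Vec (Fin n) k → Bool
fresh x []      = true
fresh x (y ∷ v) = not (does (x Fin.≟ y)) ∧ fresh x v

distinct : ∀ {n k} → Vec (Fin n) k → Bool
distinct []      = true
distinct (x ∷ v) = fresh x v ∧ distinct v

1-𝟙∧ : ∀ a b {s t} → + 1 - 𝟙 a ≤ s → + 1 - 𝟙 b ≤ t → + 1 - 𝟙 (a ∧ b) ≤ s + t
1-𝟙∧ a b p q = ≤-trans (cases a b) (+-mono-≤ p q)
  where
  cases : ∀ a b → + 1 - 𝟙 (a ∧ b) ≤ + 1 - 𝟙 a + (+ 1 - 𝟙 b)
  cases true  true  = ≤-refl
  cases true  false = ≤-refl
  cases false true  = ≤-refl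
  cases false false = +≤+ (ℕ.s≤s ℕ.z≤n)

1-fresh : ∀ {n k} (x : Fin n) (v : Vec (Fin n) k) → + 1 - 𝟙 (fresh x v) ≤ ∑∈ (equal x) v
1-fresh x []      = ≤-refl
1-fresh x (y ∷ v) = 1-𝟙∧ (not (does (x Fin.≟ y))) (fresh x v) (≤-reflexive (1-not (does (x Fin.≟ y)))) (1-fresh x v)
  where
  1-not : ∀ b → + 1 - 𝟙 (not b) ≡ 𝟙 b
  1-not true  = refl
  1-not false = refl

-- A union bound over the pairs of positions.
1-distinct : ∀ {n k} (v : Vec (Fin n) k) → + 1 - 𝟙 (distinct v) ≤ equalPairs v
1-distinct []      = ≤-refl
1-distinct (x ∷ v) = 1-𝟙∧ (fresh x v) (distinct v) (1-fresh x v) (1-distinct v)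

module _ {V : Set} where

  0≤∑∈ : ∀ {φ : V → ℤ} → (∀ x → + 0 ≤ φ x) → ∀ {k} (v : Vec V k) → + 0 ≤ ∑∈ φ v
  0≤∑∈ 0≤φ []      = ≤-refl
  0≤∑∈ 0≤φ (x ∷ v) = 0≤+ (0≤φ x) (0≤∑∈ 0≤φ v)

  0≤∑pairs : ∀ {ω : V → V → ℤ} → (∀ x y → + 0 ≤ ω x y) → ∀ {k} (v : Vec V k) → + 0 ≤ ∑pairs ω v
  0≤∑pairs 0≤ω []      = ≤-refl
  0≤∑pairs 0≤ω (x ∷ v) = 0≤+ (0≤∑∈ (0≤ω x) v) (0≤∑pairs 0≤ω v)

  private
    add : ∀ {a b c d s t} → + 0 ≤ s → + 0 ≤ t → a ≡ b ⊎ + 1 ≤ s → c ≡ d ⊎ + 1 ≤ t → a + c ≡ b + d ⊎ + 1 ≤ s + t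
    add _   _   (inj₁ refl) (inj₁ refl) = inj₁ refl
    add 0≤s _   (inj₁ _)    (inj₂ 1≤t)  = inj₂ (+-mono-≤ 0≤s 1≤t)
    add _   0≤t (inj₂ 1≤s)  _           = inj₂ (+-mono-≤ 1≤s 0≤t)

    bit : ∀ a b → 𝟙 a ≡ 𝟙 b ⊎ + 1 ≤ 𝟙 (a xor b)
    bit true  true  = inj₁ refl
    bit true  false = inj₂ ≤-refl
    bit false true  = inj₂ ≤-refl
    bit false false = inj₁ refl

  module _ (A B : V → V → Bool) where

    0≤wrong : ∀ x y → + 0 ≤ wrong A B x y
    0≤wrong x y = 0≤𝟙 (A x y xor B x y)

    private
      row : ∀ x {k} (v : Vec V k) → ∑∈ (λ y → 𝟙 (A x y)) v ≡ ∑∈ (λ y → 𝟙 (B x y)) v ⊎ + 1 ≤ ∑∈ (wrong A B x) v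
      row x []      = inj₁ refl
      row x (y ∷ v) = add (0≤wrong x y) (0≤∑∈ (0≤wrong x) v) (bit (A x y) (B x y)) (row x v)

    edges-agree-or-wrong : ∀ {k} (v : Vec V k) → edges A v ≡ edges B v ⊎ + 1 ≤ ∑pairs (wrong A B) v
    edges-agree-or-wrong []      = inj₁ refl
    edges-agree-or-wrong (x ∷ v) =
      add (0≤∑∈ (0≤wrong x) v) (0≤∑pairs 0≤wrong v) (row x v) (edges-agree-or-wrong v)

    fourEdges-lipschitz : ∀ v → fourEdges B v - fourEdges A v ≤ ∑pairs (wrong A B) v
    fourEdges-lipschitz v with edges-agree-or-wrong v
    ... | inj₁ eq  = ≤-trans (≤-reflexive (trans (cong (λ e → 𝟙 ⌊ e ≟ + 4 ⌋ - fourEdges A v) (sym eq))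
                                                 (+-inverseʳ (fourEdges A v))))
                             (0≤∑pairs 0≤wrong v)
    ... | inj₂ 1≤w = ≤-trans (+-mono-≤ (𝟙≤1 ⌊ edges B v ≟ + 4 ⌋) (neg-mono-≤ (0≤𝟙 ⌊ edges A v ≟ + 4 ⌋))) 1≤w

module _ {n : ℕ} where

  private
    N : ℤ
    N = + n

  distinctCount : (Fin n → Fin n → Bool) → ℤ
  distinctCount A = ∑ᵛ {n} 5 (λ v → 𝟙 (distinct v) * fourEdges A v)

  0≤fourEdges : ∀ (A : Fin n → Fin n → Bool) v → + 0 ≤ fourEdges A v
  0≤fourEdges A v = 0≤𝟙 ⌊ edges A v ≟ + 4 ⌋

  fourEdges≤1 : ∀ (A : Fin n → Fin n → Bool) v → fourEdges A v ≤ + 1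
  fourEdges≤1 A v = 𝟙≤1 ⌊ edges A v ≟ + 4 ⌋

  distinctCount≤fourCount : ∀ A → distinctCount A ≤ fourCount A
  distinctCount≤fourCount A = ∑ᵛ-mono 5 {f = λ v → 𝟙 (distinct v) * fourEdges A v} {g = fourEdges A} λ v → ≤-by _
    (0≤* (0≤-gap (𝟙≤1 (distinct v))) (0≤fourEdges A v)) (regroup (𝟙 (distinct v)) (fourEdges A v))
    where
    regroup : ∀ d f → f ≡ d * f + (+ 1 - d) * f
    regroup = solve-∀

  -- Ten pairs of positions may coincide, each in n⁴ tuples.
  fourCount≤distinctCount : ∀ A → fourCount A ≤ distinctCount A + + 10 * N ^ 4
  fourCount≤distinctCount A = subst (fourCount A ≤_) total
    (∑ᵛ-mono 5 {f = fourEdges A} {g = λ v → 𝟙 (distinct v) * fourEdges A v + equalPairs v} λ v → ≤-by _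
      (0≤+ (0≤* (0≤-gap (𝟙≤1 (distinct v))) (0≤-gap (fourEdges≤1 A v))) (0≤-gap (1-distinct v)))
      (regroup (𝟙 (distinct v)) (fourEdges A v) (equalPairs v)))
    where
    regroup : ∀ d f e → d * f + e ≡ f + ((+ 1 - d) * (+ 1 - f) + (e - (+ 1 - d)))
    regroup = solve-∀
    reassoc : ∀ N → + 10 * ((N * (N * (N * + 1))) * N) ≡ + 10 * (N * (N * (N * (N * + 1))))
    reassoc = solve-∀
    total : ∑ᵛ {n} 5 (λ v → 𝟙 (distinct v) * fourEdges A v + equalPairs v) ≡ distinctCount A + + 10 * N ^ 4
    total = trans (∑ᵛ-+ 5 (λ v → 𝟙 (distinct v) * fourEdges A v) equalPairs)
      (cong (_+_ (distinctCount A)) (trans (∑ᵛ-∑pairs {n} 3 equal)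
        (trans (cong (λ t → + 10 * (N ^ 3 * t)) (sum-equal-pairs n)) (reassoc N))))

  module _ (A B : Fin n → Fin n → Bool)
    (A-sym : ∀ x y → A x y ≡ A y x) (A-refl : ∀ x → A x x ≡ true)
    (B-sym : ∀ x y → B x y ≡ B y x) (B-refl : ∀ x → B x x ≡ true) where

    -- Discarding repeated tuples for `A` and `B` separately would cost order n⁴, more than a gain
    -- of order n³ W when W is small against n. On a repeated tuple the two indicators differ only
    -- if some pair is wrong, so `equalPairs` times the number of wrong pairs bounds the difference,
    -- and its total is proportional to W.
    fourCount-distinctCount : fourCount B + distinctCount A ≤ fourCount A + distinctCount B + + 90 * (N * N * wrongCount A B)
    fourCount-distinctCount = subst₂ _≤_
      (∑ᵛ-+ 5 (fourEdges B) (λ v → 𝟙 (distinct v) * fourEdges A v))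
      (trans (∑ᵛ-+ 5 (λ v → fourEdges A v + 𝟙 (distinct v) * fourEdges B v) (λ v → equalPairs v * ∑pairs (wrong A B) v))
             (cong₂ _+_ (∑ᵛ-+ 5 (fourEdges A) (λ v → 𝟙 (distinct v) * fourEdges B v))
                        (∑ᵛ-equalPairs-∑pairs (wrong A B) wrong-symm wrong-irrefl)))
      (∑ᵛ-mono 5
        {f = λ v → fourEdges B v + 𝟙 (distinct v) * fourEdges A v}
        {g = λ v → fourEdges A v + 𝟙 (distinct v) * fourEdges B v + equalPairs v * ∑pairs (wrong A B) v} λ v → ≤-by _
        (0≤+ (0≤* (0≤-gap (𝟙≤1 (distinct v))) (0≤-gap (fourEdges-lipschitz A B v)))
             (0≤* (0≤-gap (1-distinct v)) (0≤∑pairs (0≤wrong A B) v)))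
        (regroup (𝟙 (distinct v)) (fourEdges A v) (fourEdges B v) (equalPairs v) (∑pairs (wrong A B) v)))
      where
      wrong-symm : ∀ x y → wrong A B x y ≡ wrong A B y x
      wrong-symm x y = cong₂ (λ a b → 𝟙 (a xor b)) (A-sym x y) (B-sym x y)
      wrong-irrefl : ∀ x → wrong A B x x ≡ + 0
      wrong-irrefl x = cong₂ (λ a b → 𝟙 (a xor b)) (A-refl x) (B-refl x)
      regroup : ∀ d a b e w → a + d * b + e * w ≡
        b + d * a + ((+ 1 - d) * (w - (b - a)) + (e - (+ 1 - d)) * w)
      regroup = solve-∀

-- Counting five-vertex subsets

𝟙-∧ : ∀ a b → 𝟙 (a ∧ b) ≡ 𝟙 a * 𝟙 b
𝟙-∧ true  true  = refl
𝟙-∧ true  false = refl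
𝟙-∧ false true  = refl
𝟙-∧ false false = refl

module _ {A : Set} where

  ∑ˡ : (A → ℤ) → List A → ℤ
  ∑ˡ f []       = + 0
  ∑ˡ f (x ∷ xs) = f x + ∑ˡ f xs

  ∑ˡ-++ : ∀ f xs ys → ∑ˡ f (xs ++ ys) ≡ ∑ˡ f xs + ∑ˡ f ys
  ∑ˡ-++ f []       ys = sym (+-identityˡ (∑ˡ f ys))
  ∑ˡ-++ f (x ∷ xs) ys = trans (cong (_+_ (f x)) (∑ˡ-++ f xs ys)) (sym (+-assoc (f x) (∑ˡ f xs) (∑ˡ f ys)))

  length-filter : ∀ {P : A → Set} (P? : ∀ x → Dec (P x)) xs → + length (filter P? xs) ≡ ∑ˡ (λ x → 𝟙 (does (P? x))) xs
  length-filter P? []       = refl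
  length-filter P? (x ∷ xs) with does (P? x)
  ... | true  = cong (_+_ (+ 1)) (length-filter P? xs)
  ... | false = trans (length-filter P? xs) (sym (+-identityˡ _))

  ∑ˡ-filter : ∀ {P : A → Set} f (P? : ∀ x → Dec (P x)) xs →
              ∑ˡ f (filter P? xs) ≡ ∑ˡ (λ x → 𝟙 (does (P? x)) * f x) xs
  ∑ˡ-filter f P? []       = refl
  ∑ˡ-filter f P? (x ∷ xs) with does (P? x)
  ... | true  = cong₂ _+_ (sym (*-identityˡ (f x))) (∑ˡ-filter f P? xs)
  ... | false = trans (∑ˡ-filter f P? xs) (sym (trans (cong (λ t → t + rest) (*-zeroˡ (f x))) (+-identityˡ rest)))
    where
    rest : ℤ
    rest = ∑ˡ (λ x → 𝟙 (does (P? x)) * f x) xs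

∑ˡ-map : ∀ {A B : Set} (f : B → ℤ) (g : A → B) xs → ∑ˡ f (List.map g xs) ≡ ∑ˡ (λ x → f (g x)) xs
∑ˡ-map f g []       = refl
∑ˡ-map f g (x ∷ xs) = cong (_+_ (f (g x))) (∑ˡ-map f g xs)

∑ˡ-cartesianProductWith : ∀ {A B C : Set} (f : C → ℤ) (g : A → B → C) xs ys →
  ∑ˡ f (cartesianProductWith g xs ys) ≡ ∑ˡ (λ x → ∑ˡ (λ y → f (g x y)) ys) xs
∑ˡ-cartesianProductWith f g []       ys = refl
∑ˡ-cartesianProductWith f g (x ∷ xs) ys = trans (∑ˡ-++ f (List.map (g x) ys) (cartesianProductWith g xs ys))
  (cong₂ _+_ (∑ˡ-map f (g x) ys) (∑ˡ-cartesianProductWith f g xs ys))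

∑ˡ-tabulate : ∀ {A : Set} {n} (f : A → ℤ) (g : Fin n → A) → ∑ˡ f (List.tabulate g) ≡ ∑[ i < n ] f (g i)
∑ˡ-tabulate {n = zero}  f g = refl
∑ˡ-tabulate {n = suc n} f g = cong (_+_ (f (g zero))) (∑ˡ-tabulate f (λ i → g (suc i)))

countPairs-sum : ∀ {n} (P : Fin n → Fin n → Bool) →
  + countPairs P ≡ ∑[ i < n ] ∑[ j < n ] (𝟙 (does (i Fin.<? j)) * 𝟙 (P i j))
countPairs-sum {n} P = begin
  + countPairs P
    ≡⟨ length-filter (λ ij → T? (uncurry P ij)) (pairs n) ⟩
  ∑ˡ (λ ij → 𝟙 (uncurry P ij)) (pairs n)
    ≡⟨ ∑ˡ-filter (λ ij → 𝟙 (uncurry P ij)) (uncurry Fin._<?_) (cartesianProduct (allFin n) (allFin n)) ⟩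
  ∑ˡ (λ ij → 𝟙 (does (proj₁ ij Fin.<? proj₂ ij)) * 𝟙 (uncurry P ij)) (cartesianProduct (allFin n) (allFin n))
    ≡⟨ ∑ˡ-cartesianProductWith (λ ij → 𝟙 (does (proj₁ ij Fin.<? proj₂ ij)) * 𝟙 (uncurry P ij)) _,_ (allFin n) (allFin n) ⟩
  ∑ˡ (λ i → ∑ˡ (λ j → 𝟙 (does (i Fin.<? j)) * 𝟙 (P i j)) (allFin n)) (allFin n)
    ≡⟨ ∑ˡ-tabulate (λ i → ∑ˡ (λ j → 𝟙 (does (i Fin.<? j)) * 𝟙 (P i j)) (allFin n)) (λ i → i) ⟩
  ∑[ i < n ] ∑ˡ (λ j → 𝟙 (does (i Fin.<? j)) * 𝟙 (P i j)) (allFin n)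
    ≡⟨ sum-cong-≗ {n} (λ i → ∑ˡ-tabulate (λ j → 𝟙 (does (i Fin.<? j)) * 𝟙 (P i j)) (λ j → j)) ⟩
  ∑[ i < n ] ∑[ j < n ] (𝟙 (does (i Fin.<? j)) * 𝟙 (P i j)) ∎
  where open ≡-Reasoning

2*countPairs : ∀ {n} (P : Fin n → Fin n → Bool) → (∀ i j → P i j ≡ P j i) → (∀ i → P i i ≡ false) →
               + 2 * + countPairs P ≡ ∑[ i < n ] ∑[ j < n ] 𝟙 (P i j)
2*countPairs {n} P P-sym P-irrefl = begin
  + 2 * + countPairs P
    ≡⟨ double (+ countPairs P) ⟩
  + countPairs P + + countPairs P
    ≡⟨ cong₂ _+_ (countPairs-sum P) (trans (countPairs-sum P) (∑-comm below)) ⟩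
  ∑[ i < n ] ∑[ j < n ] below i j + ∑[ i < n ] ∑[ j < n ] below j i
    ≡⟨ trans (sum-cong-≗ {n} (λ i → ∑-distrib-+ (below i) (λ j → below j i)))
             (∑-distrib-+ (λ i → ∑[ j < n ] below i j) (λ i → ∑[ j < n ] below j i)) ⟨
  ∑[ i < n ] ∑[ j < n ] (below i j + below j i)
    ≡⟨ sum-cong-≗ {n} (λ i → sum-cong-≗ {n} (λ j → split i j)) ⟩
  ∑[ i < n ] ∑[ j < n ] 𝟙 (P i j) ∎
  where
  open ≡-Reasoning
  below : Fin n → Fin n → ℤ
  below i j = 𝟙 (does (i Fin.<? j)) * 𝟙 (P i j)
  double : ∀ a → + 2 * a ≡ a + a
  double = solve-∀
  split : ∀ i j → below i j + below j i ≡ 𝟙 (P i j)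
  split i j with Fin.<-cmp i j
  ... | tri< i<j _ j≮i rewrite dec-true (i Fin.<? j) i<j | dec-false (j Fin.<? i) j≮i =
    trans (cong₂ _+_ (*-identityˡ (𝟙 (P i j))) (*-zeroˡ (𝟙 (P j i)))) (+-identityʳ _)
  ... | tri≈ i≮i refl _ rewrite dec-false (i Fin.<? i) i≮i | P-irrefl i = refl
  ... | tri> i≮j _ j<i rewrite dec-false (i Fin.<? j) i≮j | dec-true (j Fin.<? i) j<i =
    trans (cong₂ _+_ (*-zeroˡ (𝟙 (P i j))) (*-identityˡ (𝟙 (P j i)))) (trans (+-identityˡ _) (cong 𝟙 (P-sym j i)))

∑ˢ : ∀ {n} → (Subset n → ℤ) → ℤ
∑ˢ {zero}  f = f []
∑ˢ {suc n} f = ∑ˢ (λ S → f (true ∷ S)) + ∑ˢ (λ S → f (false ∷ S))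

∑ˢ-cong : ∀ {n} {f g : Subset n → ℤ} → (∀ S → f S ≡ g S) → ∑ˢ f ≡ ∑ˢ g
∑ˢ-cong {zero}  f≗g = f≗g []
∑ˢ-cong {suc n} f≗g = cong₂ _+_ (∑ˢ-cong λ S → f≗g (true ∷ S)) (∑ˢ-cong λ S → f≗g (false ∷ S))

∑ˢ-* : ∀ {n} c (f : Subset n → ℤ) → ∑ˢ (λ S → c * f S) ≡ c * ∑ˢ f
∑ˢ-* {zero}  c f = refl
∑ˢ-* {suc n} c f = trans (cong₂ _+_ (∑ˢ-* c (λ S → f (true ∷ S))) (∑ˢ-* c (λ S → f (false ∷ S))))
                         (sym (*-distribˡ-+ c (∑ˢ (λ S → f (true ∷ S))) (∑ˢ (λ S → f (false ∷ S)))))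

∑ˢ-sum : ∀ {n m} (f : Fin m → Subset n → ℤ) → ∑ˢ (λ S → ∑[ i < m ] f i S) ≡ ∑[ i < m ] ∑ˢ (f i)
∑ˢ-sum {zero}      f = refl
∑ˢ-sum {suc n} {m} f = trans (cong₂ _+_ (∑ˢ-sum (λ i S → f i (true ∷ S))) (∑ˢ-sum (λ i S → f i (false ∷ S))))
  (sym (∑-distrib-+ {m} (λ i → ∑ˢ (λ S → f i (true ∷ S))) (λ i → ∑ˢ (λ S → f i (false ∷ S)))))

∑ˡ-vectors : ∀ n (f : Subset n → ℤ) → ∑ˡ f (vectors bools n) ≡ ∑ˢ f
∑ˡ-vectors zero    f = +-identityʳ (f [])
∑ˡ-vectors (suc n) f = trans (∑ˡ-cartesianProductWith f _∷_ bools (vectors bools n))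
  (cong₂ _+_ (∑ˡ-vectors n (λ S → f (true ∷ S)))
    (trans (+-identityʳ _) (∑ˡ-vectors n (λ S → f (false ∷ S)))))

sum-lookup : ∀ {n} (S : Subset n) → ∑[ x < n ] 𝟙 (lookup S x) ≡ + size S
sum-lookup []          = refl
sum-lookup (true ∷ S)  = cong (_+_ (+ 1)) (sum-lookup S)
sum-lookup (false ∷ S) = trans (+-identityˡ _) (sum-lookup S)

-- Adding `x` maps the subsets avoiding it bijectively onto those containing it.
∑ˢ-insert : ∀ {n} (x : Fin n) (ψ : Subset n → ℤ) →
  ∑ˢ (λ S → 𝟙 (lookup S x) * ψ S) ≡ ∑ˢ (λ T → 𝟙 (not (lookup T x)) * ψ (T [ x ]≔ true))
∑ˢ-insert {suc n} zero ψ = trans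
  (cong₂ _+_ (∑ˢ-* (+ 1) (λ S → ψ (true ∷ S))) (∑ˢ-* (+ 0) (λ S → ψ (false ∷ S))))
  (trans (regroup (∑ˢ (λ S → ψ (true ∷ S))) (∑ˢ (λ S → ψ (false ∷ S))))
  (sym (cong₂ _+_ (∑ˢ-* (+ 0) (λ S → ψ (true ∷ S))) (∑ˢ-* (+ 1) (λ S → ψ (true ∷ S))))))
  where
  regroup : ∀ a b → + 1 * a + + 0 * b ≡ + 0 * a + + 1 * a
  regroup = solve-∀
∑ˢ-insert {suc n} (suc x) ψ =
  cong₂ _+_ (∑ˢ-insert x (λ S → ψ (true ∷ S))) (∑ˢ-insert x (λ S → ψ (false ∷ S)))

size-insert : ∀ {n} (T : Subset n) x → lookup T x ≡ false → size (T [ x ]≔ true) ≡ suc (size T)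
size-insert (false ∷ T) zero    _ = refl
size-insert (true ∷ T)  (suc x) e = cong suc (size-insert T x e)
size-insert (false ∷ T) (suc x) e = size-insert T x e

ofSize : ℕ → ∀ {n} → Subset n → ℤ
ofSize k S = 𝟙 (does (size S ℕ.≟ k))

-- Double counting of the pairs of a subset and one of its elements: a set of size k + 1 is counted
-- k + 1 times, and removing the element leaves a set of size k.
∑ˢ-peel : ∀ {n} k (φ : Subset n → ℤ) → + suc k * ∑ˢ (λ S → ofSize (suc k) S * φ S) ≡
  ∑[ x < n ] ∑ˢ (λ T → ofSize k T * (𝟙 (not (lookup T x)) * φ (T [ x ]≔ true)))
∑ˢ-peel {n} k φ = begin
  + suc k * ∑ˢ (λ S → ofSize (suc k) S * φ S)
    ≡⟨ ∑ˢ-* (+ suc k) (λ S → ofSize (suc k) S * φ S) ⟨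
  ∑ˢ (λ S → + suc k * (ofSize (suc k) S * φ S))
    ≡⟨ ∑ˢ-cong weigh ⟩
  ∑ˢ (λ S → ∑[ x < n ] (𝟙 (lookup S x) * (ofSize (suc k) S * φ S)))
    ≡⟨ ∑ˢ-sum (λ x S → 𝟙 (lookup S x) * (ofSize (suc k) S * φ S)) ⟩
  ∑[ x < n ] ∑ˢ (λ S → 𝟙 (lookup S x) * (ofSize (suc k) S * φ S))
    ≡⟨ sum-cong-≗ {n} (λ x → trans (∑ˢ-insert x (λ S → ofSize (suc k) S * φ S)) (∑ˢ-cong (shrink x))) ⟩
  ∑[ x < n ] ∑ˢ (λ T → ofSize k T * (𝟙 (not (lookup T x)) * φ (T [ x ]≔ true))) ∎
  where
  open ≡-Reasoning
  replace : ∀ m → + suc k * 𝟙 (does (m ℕ.≟ suc k)) ≡ + m * 𝟙 (does (m ℕ.≟ suc k))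
  replace m with m ℕ.≡ᵇ suc k in eq
  ... | true  = cong (λ t → + t * + 1) (sym (ℕ.≡ᵇ⇒≡ m (suc k) (subst T (sym eq) _)))
  ... | false = trans (*-zeroʳ (+ suc k)) (sym (*-zeroʳ (+ m)))
  weigh : ∀ S → + suc k * (ofSize (suc k) S * φ S) ≡ ∑[ x < n ] (𝟙 (lookup S x) * (ofSize (suc k) S * φ S))
  weigh S = begin
    + suc k * (ofSize (suc k) S * φ S) ≡⟨ *-assoc (+ suc k) (ofSize (suc k) S) (φ S) ⟨
    + suc k * ofSize (suc k) S * φ S   ≡⟨ cong (_* φ S) (replace (size S)) ⟩
    + size S * ofSize (suc k) S * φ S  ≡⟨ *-assoc (+ size S) (ofSize (suc k) S) (φ S) ⟩
    + size S * (ofSize (suc k) S * φ S) ≡⟨ cong (_* (ofSize (suc k) S * φ S)) (sum-lookup S) ⟨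
    (∑[ x < n ] 𝟙 (lookup S x)) * (ofSize (suc k) S * φ S)
      ≡⟨ sum-*ʳ (λ x → 𝟙 (lookup S x)) (ofSize (suc k) S * φ S) ⟨
    ∑[ x < n ] (𝟙 (lookup S x) * (ofSize (suc k) S * φ S)) ∎
  shrink : ∀ x T → 𝟙 (not (lookup T x)) * (ofSize (suc k) (T [ x ]≔ true) * φ (T [ x ]≔ true)) ≡
                   ofSize k T * (𝟙 (not (lookup T x)) * φ (T [ x ]≔ true))
  shrink x T with lookup T x in eq
  ... | true  = trans (*-zeroˡ (ofSize (suc k) (T [ x ]≔ true) * φ (T [ x ]≔ true)))
                (sym (trans (cong (ofSize k T *_) (*-zeroˡ (φ (T [ x ]≔ true)))) (*-zeroʳ (ofSize k T))))
  ... | false = trans (*-identityˡ _)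
    (cong₂ _*_ (cong (λ m → 𝟙 (does (m ℕ.≟ suc k))) (size-insert T x eq)) (sym (*-identityˡ (φ (T [ x ]≔ true)))))

toSubset : ∀ {n k} → Vec (Fin n) k → Subset n
toSubset []      = replicate _ false
toSubset (x ∷ v) = toSubset v [ x ]≔ true

lookup-insert : ∀ {n} (T : Subset n) x i → lookup (T [ x ]≔ true) i ≡ does (i Fin.≟ x) ∨ lookup T i
lookup-insert (_ ∷ T) zero    zero    = refl
lookup-insert (_ ∷ T) zero    (suc i) = refl
lookup-insert (_ ∷ T) (suc x) zero    = refl
lookup-insert (_ ∷ T) (suc x) (suc i) = lookup-insert T x i

not-lookup-toSubset : ∀ {n k} (v : Vec (Fin n) k) x → not (lookup (toSubset v) x) ≡ fresh x v
not-lookup-toSubset []      x = cong not (Vec.lookup-replicate x false)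
not-lookup-toSubset (y ∷ v) x = trans (cong not (lookup-insert (toSubset v) y x))
  (trans (deMorgan (does (x Fin.≟ y)) (lookup (toSubset v) x))
         (cong (not (does (x Fin.≟ y)) ∧_) (not-lookup-toSubset v x)))
  where
  deMorgan : ∀ a b → not (a ∨ b) ≡ not a ∧ not b
  deMorgan true  b = refl
  deMorgan false b = refl

-- A k-subset is listed by k! tuples with distinct entries; peeling off one element at a time
-- chooses the entries in turn.
∑ˢ-ofSize : ∀ {n} k (φ : Subset n → ℤ) →
  factorial k * ∑ˢ (λ S → ofSize k S * φ S) ≡ ∑ᵛ k (λ v → 𝟙 (distinct v) * φ (toSubset v))
∑ˢ-ofSize zero φ = trans (*-identityˡ _) (empty φ)
  where
  tooBig : ∀ {n} (φ : Subset n → ℤ) → ∑ˢ (λ S → + 0 * φ S) ≡ + 0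
  tooBig φ = trans (∑ˢ-* (+ 0) φ) (*-zeroˡ (∑ˢ φ))
  empty : ∀ {n} (φ : Subset n → ℤ) → ∑ˢ (λ S → ofSize 0 S * φ S) ≡ + 1 * φ (replicate n false)
  empty {zero}  φ = refl
  empty {suc n} φ = trans (cong₂ _+_ (tooBig (λ S → φ (true ∷ S))) (empty (λ S → φ (false ∷ S)))) (+-identityˡ _)
∑ˢ-ofSize {n} (suc k) φ = begin
  + suc k * factorial k * ∑ˢ (λ S → ofSize (suc k) S * φ S)
    ≡⟨ regroup (+ suc k) (factorial k) (∑ˢ (λ S → ofSize (suc k) S * φ S)) ⟩
  factorial k * (+ suc k * ∑ˢ (λ S → ofSize (suc k) S * φ S))
    ≡⟨ cong (factorial k *_) (∑ˢ-peel k φ) ⟩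
  factorial k * ∑[ x < n ] ∑ˢ (λ T → ofSize k T * ψ x T)
    ≡⟨ *-distribˡ-sum (factorial k) (λ x → ∑ˢ (λ T → ofSize k T * ψ x T)) ⟩
  ∑[ x < n ] (factorial k * ∑ˢ (λ T → ofSize k T * ψ x T))
    ≡⟨ sum-cong-≗ {n} (λ x → trans (∑ˢ-ofSize k (ψ x)) (∑ᵛ-cong k (join x))) ⟩
  ∑[ x < n ] ∑ᵛ k (λ v → 𝟙 (distinct (x ∷ v)) * φ (toSubset (x ∷ v))) ∎
  where
  open ≡-Reasoning
  ψ : Fin n → Subset n → ℤ
  ψ x T = 𝟙 (not (lookup T x)) * φ (T [ x ]≔ true)
  regroup : ∀ a b c → a * b * c ≡ b * (a * c)
  regroup = solve-∀
  join : ∀ x v → 𝟙 (distinct v) * ψ x (toSubset v) ≡ 𝟙 (distinct (x ∷ v)) * φ (toSubset (x ∷ v))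
  join x v = begin
    𝟙 (distinct v) * (𝟙 (not (lookup (toSubset v) x)) * φ (toSubset (x ∷ v)))
      ≡⟨ cong (λ b → 𝟙 (distinct v) * (𝟙 b * φ (toSubset (x ∷ v)))) (not-lookup-toSubset v x) ⟩
    𝟙 (distinct v) * (𝟙 (fresh x v) * φ (toSubset (x ∷ v)))
      ≡⟨ regroup′ (𝟙 (distinct v)) (𝟙 (fresh x v)) (φ (toSubset (x ∷ v))) ⟩
    𝟙 (fresh x v) * 𝟙 (distinct v) * φ (toSubset (x ∷ v))
      ≡⟨ cong (_* φ (toSubset (x ∷ v))) (𝟙-∧ (fresh x v) (distinct v)) ⟨
    𝟙 (fresh x v ∧ distinct v) * φ (toSubset (x ∷ v)) ∎
    where
    regroup′ : ∀ a b c → a * (b * c) ≡ b * a * c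
    regroup′ = solve-∀

module _ {n : ℕ} (G : Graph n) where

  open Graph G using (adj)

  looped : Fin n → Fin n → Bool
  looped x y = adj x y ∨ does (x Fin.≟ y)

  looped-sym : ∀ x y → looped x y ≡ looped y x
  looped-sym x y = cong₂ _∨_ (Graph.symm G x y) (does-sym x y)
    where
    does-sym : ∀ x y → does (x Fin.≟ y) ≡ does (y Fin.≟ x)
    does-sym x y with x Fin.≟ y
    ... | yes refl = sym (dec-true (x Fin.≟ x) refl)
    ... | no  x≢y  = sym (dec-false (y Fin.≟ x) λ y≡x → x≢y (sym y≡x))

  looped-refl : ∀ x → looped x x ≡ true
  looped-refl x = trans (cong (adj x x ∨_) (dec-true (x Fin.≟ x) refl)) (∨-zeroʳ (adj x x))

  private
    within : Subset n → Fin n → Fin n → Bool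
    within S i j = adj i j ∧ lookup S i ∧ lookup S j

    2*edgesWithin : ∀ S → + 2 * + edgesWithin G S ≡ ∑[ i < n ] ∑[ j < n ] 𝟙 (within S i j)
    2*edgesWithin S = 2*countPairs (within S)
      (λ i j → cong₂ _∧_ (Graph.symm G i j) (∧-comm (lookup S i) (lookup S j)))
      (λ i → cong (_∧ (lookup S i ∧ lookup S i)) (Graph.irrefl G i))

    insert-indicator : ∀ (T : Subset n) (x : Fin n) → lookup T x ≡ false → ∀ i → 𝟙 (lookup (T [ x ]≔ true) i) ≡ equal i x + 𝟙 (lookup T i)
    insert-indicator T x x∉T i rewrite lookup-insert T x i with i Fin.≟ x
    ... | yes refl rewrite x∉T = refl
    ... | no  _    = sym (+-identityˡ (𝟙 (lookup T i)))

    degreeInto : Subset n → Fin n → ℤ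
    degreeInto T x = ∑[ j < n ] (𝟙 (lookup T j) * 𝟙 (adj x j))

    degreeInto-insert : ∀ T x y → lookup T x ≡ false → degreeInto (T [ x ]≔ true) y ≡ 𝟙 (adj y x) + degreeInto T y
    degreeInto-insert T x y x∉T = begin
      ∑[ j < n ] (𝟙 (lookup (T [ x ]≔ true) j) * 𝟙 (adj y j))
        ≡⟨ sum-cong-≗ {n} (λ j → trans (cong (_* 𝟙 (adj y j)) (insert-indicator T x x∉T j))
                                       (*-distribʳ-+ (𝟙 (adj y j)) (equal j x) (𝟙 (lookup T j)))) ⟩
      ∑[ j < n ] (equal j x * 𝟙 (adj y j) + 𝟙 (lookup T j) * 𝟙 (adj y j))
        ≡⟨ ∑-distrib-+ (λ j → equal j x * 𝟙 (adj y j)) (λ j → 𝟙 (lookup T j) * 𝟙 (adj y j)) ⟩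
      ∑[ j < n ] (equal j x * 𝟙 (adj y j)) + degreeInto T y
        ≡⟨ cong (_+ degreeInto T y) (sum-equal x (λ j → 𝟙 (adj y j))) ⟩
      𝟙 (adj y x) + degreeInto T y ∎
      where open ≡-Reasoning

    2*edgesWithin-degrees : ∀ S → + 2 * + edgesWithin G S ≡ ∑[ i < n ] (𝟙 (lookup S i) * degreeInto S i)
    2*edgesWithin-degrees S = trans (2*edgesWithin S) (sum-cong-≗ {n} λ i → trans
      (sum-cong-≗ {n} λ j → trans (𝟙-∧ (adj i j) (lookup S i ∧ lookup S j))
        (trans (cong (𝟙 (adj i j) *_) (𝟙-∧ (lookup S i) (lookup S j)))
               (regroup (𝟙 (adj i j)) (𝟙 (lookup S i)) (𝟙 (lookup S j)))))
      (sym (*-distribˡ-sum (𝟙 (lookup S i)) (λ j → 𝟙 (lookup S j) * 𝟙 (adj i j)))))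
      where
      regroup : ∀ a b c → a * (b * c) ≡ b * (c * a)
      regroup = solve-∀

    -- `countPairs` refers to the order of the vertices. Doubled, it is a symmetric sum over ordered
    -- pairs, in which a new vertex contributes its degree once in each coordinate.
    edgesWithin-insert : ∀ T x → lookup T x ≡ false →
      + edgesWithin G (T [ x ]≔ true) ≡ degreeInto T x + + edgesWithin G T
    edgesWithin-insert T x x∉T = *-cancelˡ-≡ (+ 2) (+ edgesWithin G (T [ x ]≔ true)) (degreeInto T x + + edgesWithin G T) (begin
      + 2 * + edgesWithin G (T [ x ]≔ true)
        ≡⟨ 2*edgesWithin-degrees (T [ x ]≔ true) ⟩
      ∑[ i < n ] (𝟙 (lookup (T [ x ]≔ true) i) * degreeInto (T [ x ]≔ true) i)
        ≡⟨ sum-cong-≗ {n} (λ i → trans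
             (cong₂ _*_ (insert-indicator T x x∉T i) (degreeInto-insert T x i x∉T))
             (expand (equal i x) (𝟙 (lookup T i)) (𝟙 (adj i x)) (degreeInto T i))) ⟩
      ∑[ i < n ] (equal i x * (𝟙 (adj i x) + degreeInto T i) + (𝟙 (lookup T i) * 𝟙 (adj i x) + 𝟙 (lookup T i) * degreeInto T i))
        ≡⟨ trans (∑-distrib-+ (λ i → equal i x * (𝟙 (adj i x) + degreeInto T i))
                              (λ i → 𝟙 (lookup T i) * 𝟙 (adj i x) + 𝟙 (lookup T i) * degreeInto T i))
                 (cong₂ _+_ (sum-equal x (λ i → 𝟙 (adj i x) + degreeInto T i))
                            (∑-distrib-+ (λ i → 𝟙 (lookup T i) * 𝟙 (adj i x)) (λ i → 𝟙 (lookup T i) * degreeInto T i))) ⟩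
      𝟙 (adj x x) + degreeInto T x + (∑[ i < n ] (𝟙 (lookup T i) * 𝟙 (adj i x)) + ∑[ i < n ] (𝟙 (lookup T i) * degreeInto T i))
        ≡⟨ cong₂ _+_ (cong (λ b → 𝟙 b + degreeInto T x) (Graph.irrefl G x))
             (cong₂ _+_ (sum-cong-≗ {n} λ i → cong (λ b → 𝟙 (lookup T i) * 𝟙 b) (Graph.symm G i x))
                        (sym (2*edgesWithin-degrees T))) ⟩
      + 0 + degreeInto T x + (degreeInto T x + + 2 * + edgesWithin G T)
        ≡⟨ collect (degreeInto T x) (+ edgesWithin G T) ⟩
      + 2 * (degreeInto T x + + edgesWithin G T) ∎)
      where
      open ≡-Reasoning
      expand : ∀ e t a d → (e + t) * (a + d) ≡ e * (a + d) + (t * a + t * d)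
      expand = solve-∀
      collect : ∀ d e → + 0 + d + (d + + 2 * e) ≡ + 2 * (d + e)
      collect = solve-∀

    fresh⇒∉ : ∀ {k} x (v : Vec (Fin n) k) → fresh x v ≡ true → lookup (toSubset v) x ≡ false
    fresh⇒∉ x v fx with lookup (toSubset v) x | not-lookup-toSubset v x
    ... | false | _  = refl
    ... | true  | eq = contradiction (trans eq fx) λ ()

    degreeInto-empty : ∀ x → degreeInto (replicate n false) x ≡ + 0
    degreeInto-empty x = trans
      (sum-cong-≗ {n} λ j → trans (cong (λ b → 𝟙 b * 𝟙 (adj x j)) (Vec.lookup-replicate j false)) (*-zeroˡ (𝟙 (adj x j))))
      (trans (sum-const n (+ 0)) (*-zeroʳ (+ n)))

    degreeInto-toSubset : ∀ {k} x (v : Vec (Fin n) k) → distinct v ≡ true →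
                          degreeInto (toSubset v) x ≡ ∑∈ (λ y → 𝟙 (adj x y)) v
    degreeInto-toSubset x []      _ = degreeInto-empty x
    degreeInto-toSubset x (y ∷ v) d = trans
      (degreeInto-insert (toSubset v) y x (fresh⇒∉ y v (∧-conicalˡ (fresh y v) (distinct v) d)))
      (cong (_+_ (𝟙 (adj x y))) (degreeInto-toSubset x v (∧-conicalʳ (fresh y v) (distinct v) d)))

    ∑∈-looped : ∀ {k} x (v : Vec (Fin n) k) → fresh x v ≡ true →
                ∑∈ (λ y → 𝟙 (adj x y)) v ≡ ∑∈ (λ y → 𝟙 (looped x y)) v
    ∑∈-looped x []      _ = refl
    ∑∈-looped x (y ∷ v) f with does (x Fin.≟ y)
    ... | false = cong₂ _+_ (cong 𝟙 (sym (∨-identityʳ (adj x y)))) (∑∈-looped x v f)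

    edgesWithin-toSubset : ∀ {k} (v : Vec (Fin n) k) → distinct v ≡ true →
                           + edgesWithin G (toSubset v) ≡ edges looped v
    edgesWithin-toSubset []      _ = *-cancelˡ-≡ (+ 2) (+ edgesWithin G (replicate n false)) (+ 0)
      (trans (2*edgesWithin-degrees (replicate n false))
      (trans (sum-cong-≗ {n} λ i → trans (cong (𝟙 (lookup (replicate n false) i) *_) (degreeInto-empty i))
                                         (*-zeroʳ (𝟙 (lookup (replicate n false) i))))
             (trans (sum-const n (+ 0)) (*-zeroʳ (+ n)))))
    edgesWithin-toSubset (x ∷ v) d = trans
      (edgesWithin-insert (toSubset v) x (fresh⇒∉ x v fx))
      (cong₂ _+_ (trans (degreeInto-toSubset x v dv) (∑∈-looped x v fx)) (edgesWithin-toSubset v dv))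
      where
      fx : fresh x v ≡ true
      fx = ∧-conicalˡ (fresh x v) (distinct v) d
      dv : distinct v ≡ true
      dv = ∧-conicalʳ (fresh x v) (distinct v) d

  -- Each 5-set is listed in 120 orders, and among distinct vertices the added loops are invisible.
  inducedCount-distinctCount : + 120 * + inducedCount 5 4 G ≡ distinctCount looped
  inducedCount-distinctCount = begin
    + 120 * + inducedCount 5 4 G
      ≡⟨ cong (+ 120 *_) (trans
           (length-filter (λ S → (size S ℕ.≟ 5) ×-dec (edgesWithin G S ℕ.≟ 4)) (vectors bools n))
           (∑ˡ-vectors n (λ S → 𝟙 (does ((size S ℕ.≟ 5) ×-dec (edgesWithin G S ℕ.≟ 4)))))) ⟩
    + 120 * ∑ˢ (λ S → 𝟙 (does (size S ℕ.≟ 5) ∧ does (edgesWithin G S ℕ.≟ 4)))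
      ≡⟨ cong (+ 120 *_) (∑ˢ-cong λ S → 𝟙-∧ (does (size S ℕ.≟ 5)) (does (edgesWithin G S ℕ.≟ 4))) ⟩
    + 120 * ∑ˢ (λ S → ofSize 5 S * φ S)
      ≡⟨ ∑ˢ-ofSize 5 φ ⟩
    ∑ᵛ 5 (λ v → 𝟙 (distinct v) * φ (toSubset v))
      ≡⟨ ∑ᵛ-cong 5 {f = λ v → 𝟙 (distinct v) * φ (toSubset v)} {g = λ v → 𝟙 (distinct v) * fourEdges looped v} agree ⟩
    distinctCount looped ∎
    where
    open ≡-Reasoning
    φ : Subset n → ℤ
    φ S = 𝟙 (does (edgesWithin G S ℕ.≟ 4))
    agree : ∀ v → 𝟙 (distinct v) * φ (toSubset v) ≡ 𝟙 (distinct v) * fourEdges looped v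
    agree v with distinct v in d
    ... | false = trans (*-zeroˡ (φ (toSubset v))) (sym (*-zeroˡ (fourEdges looped v)))
    ... | true  = cong (+ 1 *_) (cong 𝟙 (trans (sym (isYes≗does (+ edgesWithin G (toSubset v) ≟ + 4)))
                    (cong (λ e → ⌊ e ≟ + 4 ⌋) (edgesWithin-toSubset v d))))

-- Blowups of the pattern as unions of two cliques

side : Fin 2 → Bool
side zero       = true
side (suc zero) = false

colour : Bool → Fin 2
colour true  = zero
colour false = suc zero

side-colour : ∀ b → side (colour b) ≡ b
side-colour true  = refl
side-colour false = refl

same-refl : ∀ b → same b b ≡ true
same-refl true  = refl
same-refl false = refl

same-sym : ∀ a b → same a b ≡ same b a
same-sym true  true  = refl
same-sym true  false = refl
same-sym false true  = refl
same-sym false false = refl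

twoLoops-same : ∀ a b → Pattern.adj twoLoops a b ≡ same (side a) (side b)
twoLoops-same zero       zero       = refl
twoLoops-same zero       (suc zero) = refl
twoLoops-same (suc zero) zero       = refl
twoLoops-same (suc zero) (suc zero) = refl

module _ {n : ℕ} (c : Fin n → Fin 2) where

  sides : Fin n → Bool
  sides x = side (c x)

  looped-blowup : ∀ x y → looped (blowup twoLoops c) x y ≡ balanced sides x y
  looped-blowup x y with x Fin.≟ y
  ... | yes refl = sym (same-refl (sides x))
  ... | no  _    = trans (∨-identityʳ _) (twoLoops-same (c x) (c y))

  inducedCount-blowup : + 120 * + inducedCount 5 4 (blowup twoLoops c) ≡ distinctCount (balanced sides)
  inducedCount-blowup = trans (inducedCount-distinctCount (blowup twoLoops c))
    (∑ᵛ-cong 5 {f = λ v → 𝟙 (distinct v) * fourEdges (looped (blowup twoLoops c)) v}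
               {g = λ v → 𝟙 (distinct v) * fourEdges (balanced sides) v}
               λ v → cong (𝟙 (distinct v) *_) (fourEdges-cong looped-blowup v))

  2*symmDiff : ∀ (G : Graph n) → + 2 * + symmDiff G (blowup twoLoops c) Perm.id ≡ wrongCount (looped G) (balanced sides)
  2*symmDiff G = trans
    (2*countPairs P
      (λ i j → cong₂ _xor_ (Graph.symm G i j) (Graph.symm H i j))
      (λ i → cong₂ _xor_ (Graph.irrefl G i) (Graph.irrefl H i)))
    (sum-cong-≗ {n} λ i → sum-cong-≗ {n} λ j → cong 𝟙 (agree i j))
    where
    H : Graph n
    H = blowup twoLoops c
    P : Fin n → Fin n → Bool
    P i j = Graph.adj G i j xor Graph.adj H i j
    agree : ∀ i j → P i j ≡ looped G i j xor balanced sides i j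
    agree i j with i Fin.≟ j
    ... | yes refl rewrite Graph.irrefl G i | same-refl (sides i) = refl
    ... | no  _    = cong₂ _xor_ (sym (∨-identityʳ (Graph.adj G i j))) (twoLoops-same (c i) (c j))

  -- Both minima in the edit distance are bounded by their values at `c` and at the identity
  -- bijection; `wrongCount` sees every pair in both orders.
  2*distance≤wrongCount : ∀ (G : Graph n) → + 2 * + distanceToBlowups twoLoops G ≤ wrongCount (looped G) (balanced sides)
  2*distance≤wrongCount G = ≤-trans
    (*-monoˡ-≤-nonNeg (+ 2) (+≤+ (ℕ.≤-trans (distanceToBlowups≤editDistance twoLoops G c)
                                              (editDistance≤symmDiff G (blowup twoLoops c) Perm.id))))
    (≤-reflexive (2*symmDiff G))

∑ˢ-ofSize-C : ∀ n k → ∑ˢ {n} (ofSize k) ≡ + (n C k)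
∑ˢ-ofSize-C zero    zero    = refl
∑ˢ-ofSize-C zero    (suc k) = cong +_ (sym (k>n⇒nCk≡0 {0} {suc k} (ℕ.s≤s ℕ.z≤n)))
∑ˢ-ofSize-C (suc n) zero    = trans (cong₂ _+_ (vanish n) (∑ˢ-ofSize-C n 0)) refl
  where
  vanish : ∀ n → ∑ˢ {n} (λ _ → + 0) ≡ + 0
  vanish zero    = refl
  vanish (suc n) = cong₂ _+_ (vanish n) (vanish n)
∑ˢ-ofSize-C (suc n) (suc k) = trans (cong₂ _+_ (∑ˢ-ofSize-C n k) (∑ˢ-ofSize-C n (suc k)))
  (cong +_ (nCk+nC[k+1]≡[n+1]C[k+1] n k))

0≤^ : ∀ {x} k → + 0 ≤ x → + 0 ≤ x ^ k
0≤^ zero    _   = 0≤lit 1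
0≤^ (suc k) 0≤x = 0≤* 0≤x (0≤^ k 0≤x)

module _ (n : ℕ) where

  private
    N : ℤ
    N = + n

    tuples : + 120 * + (n C 5) ≡ ∑ᵛ {n} 5 (λ v → 𝟙 (distinct v))
    tuples = trans (cong (+ 120 *_) (sym (trans
        (∑ˢ-cong {n} {g = ofSize 5} λ S → *-identityʳ (ofSize 5 S)) (∑ˢ-ofSize-C n 5))))
      (trans (∑ˢ-ofSize {n} 5 (λ _ → + 1))
             (∑ᵛ-cong {n} 5 {f = λ v → 𝟙 (distinct v) * + 1} {g = λ v → 𝟙 (distinct v)} λ v → *-identityʳ (𝟙 (distinct v))))

  120*C≤ : + 120 * + (n C 5) ≤ N ^ 5
  120*C≤ = subst₂ _≤_ (sym tuples) (trans (∑ᵛ-const {n} 5 (+ 1)) (*-identityʳ (N ^ 5)))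
    (∑ᵛ-mono {n} 5 {f = λ v → 𝟙 (distinct v)} {g = λ _ → + 1} λ v → 𝟙≤1 (distinct v))

  ≤120*C : N ^ 5 ≤ + 120 * + (n C 5) + + 10 * N ^ 4
  ≤120*C = subst₂ _≤_ (trans (∑ᵛ-const {n} 5 (+ 1)) (*-identityʳ (N ^ 5))) total
    (∑ᵛ-mono {n} 5 {f = λ _ → + 1} {g = λ v → 𝟙 (distinct v) + equalPairs v} λ v →
      ≤-by _ (0≤-gap (1-distinct v)) (regroup (𝟙 (distinct v)) (equalPairs v)))
    where
    regroup : ∀ d e → d + e ≡ + 1 + (e - (+ 1 - d))
    regroup = solve-∀
    reassoc : ∀ N → + 10 * ((N * (N * (N * + 1))) * N) ≡ + 10 * (N * (N * (N * (N * + 1))))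
    reassoc = solve-∀
    total : ∑ᵛ {n} 5 (λ v → 𝟙 (distinct v) + equalPairs v) ≡ + 120 * + (n C 5) + + 10 * N ^ 4
    total = trans (∑ᵛ-+ {n} 5 (λ v → 𝟙 (distinct v)) equalPairs)
      (cong₂ _+_ (sym tuples) (trans (∑ᵛ-∑pairs {n} 3 equal)
        (trans (cong (λ t → + 10 * (N ^ 3 * t)) (sum-equal-pairs n)) (reassoc N))))

module _ {n : ℕ} where

  private
    N : ℤ
    N = + n

  0≤squareSum : ∀ (A : Fin n → Fin n → Bool) → + 0 ≤ squareSum A
  0≤squareSum A = subst (+ 0 ≤_) (sym (squareSum-linear A))
    (0≤sum λ x → 0≤sum λ y → 0≤sum λ z → 0≤sum {5} λ k → 0≤* (0≤weight k) (0≤sq (linear A k x y z)))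

  0≤evenCount : ∀ (A : Fin n → Fin n → Bool) → + 0 ≤ evenCount A
  0≤evenCount A = 0≤sum λ x → 0≤sum λ y → 0≤sum λ z → 0≤𝟙 (even (A x y) (A x z) (A y z))

  -- The certificate with its nonnegative terms, the squares and the even triples, dropped; 960 is 8
  -- times 120.
  inducedCount≤ : ∀ (G : Graph n) → + 960 * + inducedCount 5 4 G ≤ + 5 * N ^ 5
  inducedCount≤ G = *-cancelˡ-≤-pos (+ 960 * + inducedCount 5 4 G) (+ 5 * N ^ 5) (+ 8) (≤-by _
    (0≤+ (0≤-gap (count-bound (looped G) (looped-sym G) (looped-refl G)))
    (0≤+ (0≤* (0≤lit 64) (0≤-gap (distinctCount≤fourCount (looped G))))
    (0≤+ (0≤* (0≤lit 2) (0≤squareSum (looped G)))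
         (0≤* (0≤^ 2 (0≤lit n)) (0≤evenCount (looped G))))))
    (trans (regroup (fourCount (looped G)) (squareSum (looped G)) (evenCount (looped G)) (distinctCount (looped G)) (N ^ 2) (N ^ 5))
           (cong (λ t → t + (+ 40 * N ^ 5 - (+ 64 * fourCount (looped G) + (+ 2 * squareSum (looped G) + N ^ 2 * evenCount (looped G))) + (+ 64 * (fourCount (looped G) - distinctCount (looped G)) + (+ 2 * squareSum (looped G) + N ^ 2 * evenCount (looped G))))) (trans (cong (+ 64 *_) (sym (inducedCount-distinctCount G))) (scale (+ inducedCount 5 4 G))))))
    where
    scale : ∀ I → + 64 * (+ 120 * I) ≡ + 8 * (+ 960 * I)
    scale = solve-∀
    regroup : ∀ f s e d n² n⁵ → + 8 * (+ 5 * n⁵) ≡ + 64 * d +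
      ((+ 40 * n⁵ - (+ 64 * f + (+ 2 * s + n² * e))) + (+ 64 * (f - d) + (+ 2 * s + n² * e)))
    regroup = solve-∀

  partSize-sum : ∀ (c : Fin n → Fin 2) → + partSize c zero ≡ ∑[ x < n ] 𝟙 (sides c x)
  partSize-sum c = trans (length-filter (λ x → c x Fin.≟ zero) (allFin n))
    (trans (∑ˡ-tabulate (λ x → 𝟙 (does (c x Fin.≟ zero))) (λ x → x)) (sum-cong-≗ {n} λ x → cong 𝟙 (zero? (c x))))
    where
    zero? : ∀ a → does (a Fin.≟ zero {1}) ≡ side a
    zero? zero       = refl
    zero? (suc zero) = refl

  partSize-one : ∀ (c : Fin n → Fin 2) → + partSize c (suc zero) ≡ N - + partSize c zero
  partSize-one c = begin
    + partSize c (suc zero)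
      ≡⟨ trans (length-filter (λ x → c x Fin.≟ suc zero) (allFin n))
           (∑ˡ-tabulate (λ x → 𝟙 (does (c x Fin.≟ suc zero))) (λ x → x)) ⟩
    ∑[ x < n ] 𝟙 (does (c x Fin.≟ suc zero))
      ≡⟨ sum-cong-≗ {n} (λ x → one? (c x)) ⟩
    ∑[ x < n ] (+ 1 - 𝟙 (sides c x))
      ≡⟨ sum-- {n} (λ _ → + 1) (λ x → 𝟙 (sides c x)) ⟨
    ∑[ x < n ] (+ 1) - ∑[ x < n ] 𝟙 (sides c x)
      ≡⟨ cong₂ _-_ (trans (sum-const n (+ 1)) (*-identityʳ N)) (sym (partSize-sum c)) ⟩
    N - + partSize c zero ∎
    where
    open ≡-Reasoning
    one? : ∀ a → 𝟙 (does (a Fin.≟ suc {1} zero)) ≡ + 1 - 𝟙 (side a)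
    one? zero       = refl
    one? (suc zero) = refl

  partSize≤ : ∀ (c : Fin n → Fin 2) → + partSize c zero ≤ N
  partSize≤ c = ≤-by _ (0≤lit (partSize c (suc zero)))
    (trans (regroup N (+ partSize c zero)) (cong (_+_ (+ partSize c zero)) (sym (partSize-one c))))
    where
    regroup : ∀ N a → N ≡ a + (N - a)
    regroup = solve-∀

  bias-partSize : ∀ (c : Fin n → Fin 2) → bias (sides c) ≡ + 2 * + partSize c zero - N
  bias-partSize c = begin
    ∑[ x < n ] ±1 (sides c x)
      ≡⟨ sum-cong-≗ {n} (λ x → affine (sides c x)) ⟩
    ∑[ x < n ] (+ 2 * 𝟙 (sides c x) - + 1)
      ≡⟨ sum-- {n} (λ x → + 2 * 𝟙 (sides c x)) (λ _ → + 1) ⟨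
    ∑[ x < n ] (+ 2 * 𝟙 (sides c x)) - ∑[ x < n ] (+ 1)
      ≡⟨ cong₂ _-_ (trans (sym (*-distribˡ-sum {n} (+ 2) (λ x → 𝟙 (sides c x)))) (cong (+ 2 *_) (sym (partSize-sum c))))
                   (trans (sum-const n (+ 1)) (*-identityʳ N)) ⟩
    + 2 * + partSize c zero - N ∎
    where
    open ≡-Reasoning
    affine : ∀ b → ±1 b ≡ + 2 * 𝟙 b - + 1
    affine true  = refl
    affine false = refl

  module _ (c : Fin n → Fin 2) where

    private
      a ab : ℤ
      a = + partSize c zero
      ab = a * (N - a)

    -- With parts of sizes a and b the 3 to 2 splits number 10 (a³ b² + a² b³), and a + b = N.
    fourCount-blowup : fourCount (balanced (sides c)) ≡ + 10 * N * (ab * ab)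
    fourCount-blowup = *-cancelˡ-≡ (+ 8) (fourCount (balanced (sides c))) (+ 10 * N * (ab * ab))
      (trans (fourCount-balanced (sides c))
      (trans (cong (λ D → + 5 * N ^ 5 - + 10 * (N ^ 3 * D ^ 2) + + 5 * (N * D ^ 4)) (bias-partSize c))
             (regroup N a)))
      where
      regroup : ∀ N a → + 5 * (N * (N * (N * (N * (N * + 1)))))
        - + 10 * ((N * (N * (N * + 1))) * ((+ 2 * a - N) * ((+ 2 * a - N) * + 1)))
        + + 5 * (N * ((+ 2 * a - N) * ((+ 2 * a - N) * ((+ 2 * a - N) * ((+ 2 * a - N) * + 1)))))
        ≡ + 8 * (+ 10 * N * ((a * (N - a)) * (a * (N - a))))
      regroup = solve-∀

    inducedCount-blowup≤ : + 120 * + inducedCount 5 4 (blowup twoLoops c) ≤ + 10 * N * (ab * ab)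
    inducedCount-blowup≤ = subst₂ _≤_ (sym (inducedCount-blowup c)) fourCount-blowup
      (distinctCount≤fourCount (balanced (sides c)))

    ≤inducedCount-blowup : + 10 * N * (ab * ab) ≤ + 120 * + inducedCount 5 4 (blowup twoLoops c) + + 10 * N ^ 4
    ≤inducedCount-blowup = subst₂ _≤_ fourCount-blowup (cong (λ t → t + + 10 * N ^ 4) (sym (inducedCount-blowup c)))
      (fourCount≤distinctCount (balanced (sides c)))

initial : ∀ {n} → ℕ → Fin n → Fin 2
initial k x = colour (toℕ x ℕ.<ᵇ k)

partSize-initial : ∀ n k → k ℕ.≤ n → partSize (initial {n} k) zero ≡ k
partSize-initial n k k≤n = +-injective (trans (partSize-sum {n} (initial k))
  (trans (sum-cong-≗ {n} λ (x : Fin n) → cong 𝟙 (side-colour (toℕ x ℕ.<ᵇ k))) (count n k k≤n)))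
  where
  count : ∀ n k → k ℕ.≤ n → ∑[ x < n ] 𝟙 (toℕ x ℕ.<ᵇ k) ≡ + k
  count n       zero    _           = trans (sum-const n (+ 0)) (*-zeroʳ (+ n))
  count (suc n) (suc k) (ℕ.s≤s k≤n) = cong (_+_ (+ 1)) (count n k k≤n)

-- Stability for the counts

-- Induction in steps of two adds one vertex to each part and so respects the parity of n, on which
-- the defect 1 depends.
half : ∀ n → Σ[ k ∈ ℕ ] k ℕ.≤ n × + n * + n - + 1 ≤ + 4 * (+ k * (+ n - + k))
half 0             = 0 , ℕ.z≤n , -≤+
half 1             = 0 , ℕ.z≤n , ≤-refl
half (suc (suc n)) = let k , k≤n , bound = half n in
  suc k , ℕ.s≤s (ℕ.m≤n⇒m≤1+n k≤n) , ≤-by _ (0≤-gap bound) (identity (+ n) (+ k))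
  where
  identity : ∀ N k → + 4 * ((+ 1 + k) * ((+ 2 + N) - (+ 1 + k))) ≡
    (+ 2 + N) * (+ 2 + N) - + 1 + (+ 4 * (k * (N - k)) - (N * N - + 1))
  identity = solve-∀

balanced-cong : ∀ {n} {h h′ : Fin n → Bool} → (∀ x → h x ≡ h′ x) → ∀ x y → balanced h x y ≡ balanced h′ x y
balanced-cong h≗h′ x y = cong₂ same (h≗h′ x) (h≗h′ y)

fourCount-cong : ∀ {n} {A B : Fin n → Fin n → Bool} → (∀ x y → A x y ≡ B x y) → fourCount A ≡ fourCount B
fourCount-cong {n} {A} {B} A≗B = ∑ᵛ-cong {n} 5 {f = fourEdges A} {g = fourEdges B} (fourEdges-cong A≗B)

wrongCount-cong : ∀ {n} (A : Fin n → Fin n → Bool) {B C : Fin n → Fin n → Bool} →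
                  (∀ x y → B x y ≡ C x y) → wrongCount A B ≡ wrongCount A C
wrongCount-cong {n} A B≗C = sum-cong-≗ {n} λ x → sum-cong-≗ {n} λ y → cong (λ b → 𝟙 (A x y xor b)) (B≗C x y)

module _ (M³ N : ℤ) (2≤M³ : + 2 ≤ M³) (0≤N : + 0 ≤ N) where

  private
    0≤M³ : + 0 ≤ M³
    0≤M³ = ≤-trans (0≤lit 2) 2≤M³

    halve : ∀ {x y c} → + 0 ≤ c → + 2 * y ≡ + 2 * x + c → x ≤ y
    halve {x} {y} {c} 0≤c eq = *-cancelˡ-≤-pos x y (+ 2) (≤-by c 0≤c eq)

  -- The gain is N³ W / 128 and the repeated tuples cost κ N² W, at most half of it when 256 κ ≤ N;
  -- with κ = 90 this is the threshold 23040. The factor 64 M³ is generous here and chosen to agree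
  -- with `far-gap`.
  close-gap : ∀ κ ΦA ΦB dA dB W δ → + 0 ≤ W → + 2 * δ ≤ W → + 0 ≤ κ → + 256 * κ ≤ N →
    + 128 * ΦA + N ^ 3 * W ≤ + 128 * ΦB → ΦB + dA ≤ ΦA + dB + κ * (N * N * W) →
    N ^ 3 * δ + + 64 * M³ * dA ≤ + 64 * M³ * dB
  close-gap κ ΦA ΦB dA dB W δ 0≤W 2δ≤W 0≤κ N-big close repeats = halve
    (0≤+ (0≤* (0≤-gap 256≤) (0≤-gap dA≤dB))
    (0≤+ (0≤* (0≤lit 256) (0≤-gap repeats))
    (0≤+ (0≤* (0≤lit 2) (0≤-gap close))
    (0≤+ (0≤* (0≤* (0≤^ 2 0≤N) 0≤W) (0≤-gap N-big)) (0≤* (0≤^ 3 0≤N) (0≤-gap 2δ≤W))))))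
    (identity κ M³ N ΦA ΦB dA dB W δ)
    where
    256≤ : + 256 ≤ + 128 * M³
    256≤ = *-monoˡ-≤-nonNeg (+ 128) 2≤M³
    identity : ∀ κ M³ N ΦA ΦB dA dB W δ → + 2 * (+ 64 * M³ * dB) ≡ + 2 * ((N * (N * (N * + 1))) * δ + + 64 * M³ * dA) +
      ((+ 128 * M³ - + 256) * (dB - dA) +
      (+ 256 * (ΦA + dB + κ * (N * N * W) - (ΦB + dA)) +
      (+ 2 * (+ 128 * ΦB - (+ 128 * ΦA + (N * (N * (N * + 1))) * W)) +
      ((N * (N * + 1)) * W * (N - + 256 * κ) + (N * (N * (N * + 1))) * (W - + 2 * δ)))))
    identity = solve-∀
    dA≤dB : dA ≤ dB
    dA≤dB = *-cancelˡ-≤-pos dA dB (+ 128) (≤-by _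
      (0≤+ (0≤* (0≤lit 128) (0≤-gap repeats)) (0≤+ (0≤-gap close)
           (0≤* (0≤* (0≤^ 2 0≤N) 0≤W) (0≤-gap (≤-trans (≤-by _ (0≤* (0≤lit 128) 0≤κ) (double κ)) N-big)))))
      (identity′ κ N ΦA ΦB dA dB W))
      where
      double : ∀ κ → + 256 * κ ≡ + 128 * κ + + 128 * κ
      double = solve-∀
      identity′ : ∀ κ N ΦA ΦB dA dB W → + 128 * dB ≡ + 128 * dA +
        (+ 128 * (ΦA + dB + κ * (N * N * W) - (ΦB + dA)) +
        (+ 128 * ΦB - (+ 128 * ΦA + (N * (N * (N * + 1))) * W) + (N * (N * + 1)) * W * (N - + 128 * κ)))
      identity′ = solve-∀

  far-gap : ∀ Φ d t s W δ → + 2 * δ ≤ W → W ≤ N * N → + 1 ≤ N → + 144 * M³ ≤ N →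
    + 32 * M³ * Φ + + 5 * N ^ 5 ≤ + 20 * M³ * N ^ 5 → d ≤ Φ →
    N * N - + 1 ≤ + 4 * s → + 10 * N * (s * s) ≤ t + + 10 * N ^ 4 →
    N ^ 3 * δ + + 64 * M³ * d ≤ + 64 * M³ * t
  far-gap Φ d t s W δ 2δ≤W W≤N² 1≤N N-big far d≤Φ near best = halve
    (0≤+ (0≤* (0≤* (0≤lit 128) 0≤M³) (0≤-gap best))
    (0≤+ (0≤* (0≤* (0≤* (0≤lit 80) 0≤M³) 0≤N) (0≤* (0≤-gap near) (0≤+ 0≤4s (0≤-gap 1≤N²))))
    (0≤+ (0≤* (0≤* (0≤lit 128) 0≤M³) (0≤-gap d≤Φ))
    (0≤+ (0≤* (0≤lit 4) (0≤-gap far))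
    (0≤+ (0≤* (0≤^ 3 0≤N) (0≤-gap 2δ≤W))
    (0≤+ (0≤* (0≤^ 3 0≤N) (0≤-gap W≤N²))
    (0≤+ (0≤* (0≤* (0≤lit 10) (0≤^ 4 0≤N)) (0≤-gap N-big))
    (0≤+ (0≤* (0≤lit 9) (0≤^ 5 0≤N))
    (0≤+ (0≤* (0≤* (0≤* (0≤lit 160) 0≤M³) (0≤^ 3 0≤N)) (0≤-gap 1≤N))
         (0≤* (0≤* (0≤lit 80) 0≤M³) 0≤N))))))))))
    (identity M³ N Φ d t s W δ)
    where
    1≤N² : + 1 ≤ N * N
    1≤N² = ≤-by _ (0≤+ (0≤* 0≤N (0≤-gap 1≤N)) (0≤-gap 1≤N)) (expand N)
      where
      expand : ∀ N → N * N ≡ + 1 + (N * (N - + 1) + (N - + 1))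
      expand = solve-∀
    0≤4s : + 0 ≤ + 4 * s
    0≤4s = ≤-trans (0≤-gap 1≤N²) near
    identity : ∀ M³ N Φ d t s W δ → + 2 * (+ 64 * M³ * t) ≡ + 2 * ((N * (N * (N * + 1))) * δ + + 64 * M³ * d) +
      (+ 128 * M³ * (t + + 10 * (N * (N * (N * (N * + 1)))) - + 10 * N * (s * s)) +
      (+ 80 * M³ * N * ((+ 4 * s - (N * N - + 1)) * (+ 4 * s + (N * N - + 1))) +
      (+ 128 * M³ * (Φ - d) +
      (+ 4 * (+ 20 * M³ * (N * (N * (N * (N * (N * + 1))))) - (+ 32 * M³ * Φ + + 5 * (N * (N * (N * (N * (N * + 1))))))) +
      ((N * (N * (N * + 1))) * (W - + 2 * δ) +
      ((N * (N * (N * + 1))) * (N * N - W) +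
      (+ 10 * (N * (N * (N * (N * + 1)))) * (N - + 144 * M³) +
      (+ 9 * (N * (N * (N * (N * (N * + 1))))) +
      (+ 160 * M³ * (N * (N * (N * + 1))) * (N - + 1) +
       + 80 * M³ * N)))))))))
    identity = solve-∀

-- `H` only witnesses that the maximum lies well above the count of `G`, in proportion to the
-- distance of `G` from the family. It may itself be far from `G`: in the second case it is an
-- almost equal split of the vertices.
Gap : ℤ → ∀ {n} → Graph n → Graph n → Set
Gap M³ {n} G H = (+ n) ^ 3 * + distanceToBlowups twoLoops G + + 64 * M³ * (+ 120 * + inducedCount 5 4 G)
                   ≤ + 64 * M³ * (+ 120 * + inducedCount 5 4 H)

module _ (M³ : ℤ) (2≤M³ : + 2 ≤ M³) {n : ℕ} (G : Graph n) where

  close-stability : ∀ (c : Fin n → Fin 2) → + 23040 ≤ + n →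
    + 128 * fourCount (looped G) + (+ n) ^ 3 * wrongCount (looped G) (balanced (sides c))
      ≤ + 128 * fourCount (balanced (sides c)) →
    Gap M³ G (blowup twoLoops c)
  close-stability c n-big close = subst₂ (λ a b →
      (+ n) ^ 3 * + distanceToBlowups twoLoops G + + 64 * M³ * a ≤ + 64 * M³ * b)
    (sym (inducedCount-distinctCount G)) (sym (inducedCount-blowup c))
    (close-gap M³ (+ n) 2≤M³ (0≤lit n) (+ 90) (fourCount (looped G)) (fourCount (balanced (sides c)))
      (distinctCount (looped G)) (distinctCount (balanced (sides c)))
      (wrongCount (looped G) (balanced (sides c))) (+ distanceToBlowups twoLoops G)
      (0≤wrongCount (looped G) (balanced (sides c))) (2*distance≤wrongCount c G) (0≤lit 90) n-big close
      (fourCount-distinctCount (looped G) (balanced (sides c)) (looped-sym G) (looped-refl G)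
        (λ x y → same-sym (sides c x) (sides c y)) (λ x → same-refl (sides c x))))

  far-stability : ∀ (c : Fin n → Fin 2) → + 1 ≤ + n → + 144 * M³ ≤ + n →
    + 32 * M³ * fourCount (looped G) + + 5 * (+ n) ^ 5 ≤ + 20 * M³ * (+ n) ^ 5 →
    + n * + n - + 1 ≤ + 4 * (+ partSize c zero * (+ n - + partSize c zero)) →
    Gap M³ G (blowup twoLoops c)
  far-stability c 1≤n n-big far near = subst (λ a →
      (+ n) ^ 3 * + distanceToBlowups twoLoops G + + 64 * M³ * a
        ≤ + 64 * M³ * (+ 120 * + inducedCount 5 4 (blowup twoLoops c)))
    (sym (inducedCount-distinctCount G))
    (far-gap M³ (+ n) 2≤M³ (0≤lit n) (fourCount (looped G)) (distinctCount (looped G))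
      (+ 120 * + inducedCount 5 4 (blowup twoLoops c)) (+ partSize c zero * (+ n - + partSize c zero))
      (wrongCount (looped G) (balanced (sides c))) (+ distanceToBlowups twoLoops G)
      (2*distance≤wrongCount c G) (wrongCount≤ (looped G) (balanced (sides c))) 1≤n n-big far
      (distinctCount≤fourCount (looped G)) near (≤inducedCount-blowup c))

≤cube : ∀ {M} → + 1 ≤ M → M ≤ M * M * M
≤cube {M} 1≤M = ≤-by _ (0≤* (0≤* 0≤M (0≤-gap 1≤M)) (0≤+ 0≤M (0≤lit 1))) (identity M)
  where
  0≤M : + 0 ≤ M
  0≤M = ≤-trans (0≤lit 1) 1≤M
  identity : ∀ M → M * M * M ≡ M + M * (M - + 1) * (M + + 1)
  identity = solve-∀

stability : ∀ M → + 89856 ≤ M → ∀ {n} (G : Graph n) → + 23040 ≤ + n → + 144 * (M * M * M) ≤ + n →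
            Σ[ H ∈ Graph n ] Gap (M * M * M) G H
stability M M-big {n} G n-big n-bigger =
  decide (close-or-far M M-big 1≤n (looped G) (looped-sym G) (looped-refl G)) (half n)
  where
  1≤n : + 1 ≤ + n
  1≤n = ≤-trans (+≤+ (ℕ.s≤s ℕ.z≤n)) n-big
  2≤M³ : + 2 ≤ M * M * M
  2≤M³ = ≤-trans (≤-trans (+≤+ (ℕ.s≤s (ℕ.s≤s ℕ.z≤n))) M-big) (≤cube (≤-trans (+≤+ (ℕ.s≤s ℕ.z≤n)) M-big))
  decide : Σ[ h ∈ (Fin n → Bool) ]
      (+ 128 * fourCount (looped G) + (+ n) ^ 3 * wrongCount (looped G) (balanced h) ≤ + 128 * fourCount (balanced h)
      ⊎ + 32 * (M * M * M) * fourCount (looped G) + + 5 * (+ n) ^ 5 ≤ + 20 * (M * M * M) * (+ n) ^ 5) →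
    Σ[ k ∈ ℕ ] k ℕ.≤ n × + n * + n - + 1 ≤ + 4 * (+ k * (+ n - + k)) →
    Σ[ H ∈ Graph n ] Gap (M * M * M) G H
  decide (h , inj₁ close) _ = blowup twoLoops c , close-stability (M * M * M) 2≤M³ G c n-big
    (subst₂ (λ w b → + 128 * fourCount (looped G) + (+ n) ^ 3 * w ≤ + 128 * b) wrong≡ four≡ close)
    where
    c : Fin n → Fin 2
    c x = colour (h x)
    h≗sides : ∀ x y → balanced h x y ≡ balanced (sides c) x y
    h≗sides = balanced-cong {n} {h} {sides c} (λ x → sym (side-colour (h x)))
    wrong≡ : wrongCount (looped G) (balanced h) ≡ wrongCount (looped G) (balanced (sides c))
    wrong≡ = wrongCount-cong (looped G) {balanced h} {balanced (sides c)} h≗sides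
    four≡ : fourCount (balanced h) ≡ fourCount (balanced (sides c))
    four≡ = fourCount-cong {n} {balanced h} {balanced (sides c)} h≗sides
  decide (_ , inj₂ far) (k , k≤n , near) = blowup twoLoops (initial k) , far-stability (M * M * M) 2≤M³ G (initial k) 1≤n n-bigger far
    (subst (λ a → + n * + n - + 1 ≤ + 4 * (+ a * (+ n - + a))) (sym (partSize-initial n k k≤n)) near)

-- Densities

ι : ℤ → ℚ
ι z = z / 1

toℚᵘ-ι : ∀ z → ℚ.toℚᵘ (ι z) ℚᵘ.≃ ℚᵘ.mkℚᵘ z 0
toℚᵘ-ι z = ℚ.toℚᵘ-fromℚᵘ (ℚᵘ.mkℚᵘ z 0)

ι-+ : ∀ a b → ι (a + b) ≡ ι a ℚ.+ ι b
ι-+ a b = ℚ.toℚᵘ-injective (ℚᵘ.≃-trans (toℚᵘ-ι (a + b)) (ℚᵘ.≃-sym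
  (ℚᵘ.≃-trans (ℚ.toℚᵘ-homo-+ (ι a) (ι b))
  (ℚᵘ.≃-trans (ℚᵘ.+-cong (toℚᵘ-ι a) (toℚᵘ-ι b)) (ℚᵘ.*≡* (identity a b))))))
  where
  identity : ∀ a b → (a * + 1 + b * + 1) * + 1 ≡ (a + b) * + 1
  identity = solve-∀

ι-* : ∀ a b → ι (a * b) ≡ ι a ℚ.* ι b
ι-* a b = ℚ.toℚᵘ-injective (ℚᵘ.≃-trans (toℚᵘ-ι (a * b)) (ℚᵘ.≃-sym
  (ℚᵘ.≃-trans (ℚ.toℚᵘ-homo-* (ι a) (ι b))
              (ℚᵘ.*-cong (toℚᵘ-ι a) (toℚᵘ-ι b)))))

ι-neg : ∀ a → ι (- a) ≡ ℚ.- ι a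
ι-neg a = ℚ.toℚᵘ-injective (ℚᵘ.≃-trans (toℚᵘ-ι (- a)) (ℚᵘ.≃-sym
  (ℚᵘ.≃-trans (ℚ.toℚᵘ-homo‿- (ι a)) (ℚᵘ.-‿cong (toℚᵘ-ι a)))))

ι-- : ∀ a b → ι (a - b) ≡ ι a ℚ.- ι b
ι-- a b = trans (ι-+ a (- b)) (cong (ι a ℚ.+_) (ι-neg b))

ι-mono-≤ : ∀ {a b} → a ≤ b → ι a ℚ.≤ ι b
ι-mono-≤ {a} {b} a≤b = ℚ.toℚᵘ-cancel-≤
  (ℚᵘ.≤-respˡ-≃ (ℚᵘ.≃-sym (toℚᵘ-ι a)) (ℚᵘ.≤-respʳ-≃ (ℚᵘ.≃-sym (toℚᵘ-ι b))
    (ℚᵘ.*≤* (subst₂ _≤_ (sym (*-identityʳ a)) (sym (*-identityʳ b)) a≤b))))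

ι-cancel-≤ : ∀ {a b} → ι a ℚ.≤ ι b → a ≤ b
ι-cancel-≤ {a} {b} ιa≤ιb with ℚᵘ.≤-respˡ-≃ (toℚᵘ-ι a) (ℚᵘ.≤-respʳ-≃ (toℚᵘ-ι b) (ℚ.toℚᵘ-mono-≤ ιa≤ιb))
... | ℚᵘ.*≤* a≤b = subst₂ _≤_ (*-identityʳ a) (*-identityʳ b) a≤b

ι-pos : ∀ {a} → + 1 ≤ a → 0ℚ ℚ.< ι a
ι-pos 1≤a = ℚ.<-≤-trans (ℚ.positive⁻¹ 1ℚ) (ι-mono-≤ 1≤a)

ratio-cancel : ∀ a b → + 1 ≤ + b → ratio a b ℚ.* ι (+ b) ≡ ι (+ a)
ratio-cancel a zero    (+≤+ ())
ratio-cancel a (suc b) _ = ℚ.toℚᵘ-injective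
  (ℚᵘ.≃-trans (ℚ.toℚᵘ-homo-* (ratio a (suc b)) (ι (+ suc b)))
  (ℚᵘ.≃-trans (ℚᵘ.*-cong (ℚ.toℚᵘ-fromℚᵘ (ℚᵘ.mkℚᵘ (+ a) b)) (toℚᵘ-ι (+ suc b)))
  (ℚᵘ.≃-trans (ℚᵘ.*≡* (trans (identity (+ a) (+ suc b)) (cong (λ t → + a * + t) (sym (ℕ.*-identityʳ (suc b))))))
              (ℚᵘ.≃-sym (toℚᵘ-ι (+ a))))))
  where
  identity : ∀ a b → a * b * + 1 ≡ a * b
  identity = solve-∀

≤-byℚ : ∀ {p q} c → 0ℚ ℚ.≤ c → q ≡ p ℚ.+ c → p ℚ.≤ q
≤-byℚ {p} c 0≤c refl = subst (ℚ._≤ p ℚ.+ c) (ℚ.+-identityʳ p) (ℚ.+-monoʳ-≤ p 0≤c)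

0≤*ℚ : ∀ {p q} → 0ℚ ℚ.≤ p → 0ℚ ℚ.≤ q → 0ℚ ℚ.≤ p ℚ.* q
0≤*ℚ {p} {q} 0≤p 0≤q = subst (ℚ._≤ p ℚ.* q) (ℚ.*-zeroʳ p) (ℚ.*-monoˡ-≤-nonNeg p {{ℚ.nonNegative 0≤p}} 0≤q)

0≤gapℚ : ∀ {p q} → p ℚ.≤ q → 0ℚ ℚ.≤ q ℚ.- p
0≤gapℚ {p} {q} p≤q = subst (ℚ._≤ q ℚ.- p) (ℚ.+-inverseʳ p) (ℚ.+-monoˡ-≤ (ℚ.- p) p≤q)

cancel-≤ℚ : ∀ {p q} m → 0ℚ ℚ.< m → p ℚ.* m ℚ.≤ q ℚ.* m → p ℚ.≤ q
cancel-≤ℚ m 0<m = ℚ.*-cancelʳ-≤-pos m {{ℚ.positive 0<m}}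

0≤ratio : ∀ a n → + 1 ≤ + n → 0ℚ ℚ.≤ ratio a n
0≤ratio a n 1≤n = cancel-≤ℚ (ι (+ n)) (ι-pos 1≤n)
  (subst₂ ℚ._≤_ (sym (ℚ.*-zeroˡ (ι (+ n)))) (sym (ratio-cancel a n 1≤n)) (ι-mono-≤ {+ 0} (0≤lit a)))

-- The limit density 10 (x³ (1-x)² + x² (1-x)³) of two cliques with shares x and 1 - x.
P : ℚ → ℚ
P x = ι (+ 10) ℚ.* ((x ℚ.* (1ℚ ℚ.- x)) ℚ.* (x ℚ.* (1ℚ ℚ.- x)))

module Estimates (n : ℕ) (20≤n : + 20 ≤ + n) where

  private
    N B : ℤ
    N = + n
    B = + (n C 5)

  0≤N : + 0 ≤ N
  0≤N = 0≤lit n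

  1≤N : + 1 ≤ N
  1≤N = ≤-trans (+≤+ (ℕ.s≤s ℕ.z≤n)) 20≤n

  -- The bound 20 ≤ N makes the 10 N⁴ repeated tuples at most half of all tuples.
  N^5≤240*B : N ^ 5 ≤ + 240 * B
  N^5≤240*B = ≤-by _ (0≤+ (0≤* (0≤lit 2) (0≤-gap (≤120*C n))) (0≤* (0≤^ 4 0≤N) (0≤-gap 20≤n))) (identity N B)
    where
    identity : ∀ N B → + 240 * B ≡ (N * (N * (N * (N * (N * + 1))))) + (+ 2 * (+ 120 * B + + 10 * (N * (N * (N * (N * + 1)))) - (N * (N * (N * (N * (N * + 1)))))) + (N * (N * (N * (N * + 1)))) * (N - + 20))
    identity = solve-∀

  1≤B : + 1 ≤ B
  1≤B = positive-of (n C 5) (≤-trans 1≤N^5 N^5≤240*B)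
    where
    1≤N^5 : + 1 ≤ N ^ 5
    1≤N^5 = ≤-by _ (0≤* (0≤-gap 1≤N) (0≤+ (0≤^ 4 0≤N) (0≤+ (0≤^ 3 0≤N) (0≤+ (0≤^ 2 0≤N) (0≤+ 0≤N (0≤lit 1)))))) (identity N)
      where
      identity : ∀ N → (N * (N * (N * (N * (N * + 1))))) ≡ + 1 + (N - + 1) * ((N * (N * (N * (N * + 1)))) + ((N * (N * (N * + 1))) + ((N * (N * + 1)) + (N + + 1))))
      identity = solve-∀
    positive-of : ∀ m → + 1 ≤ + 240 * + m → + 1 ≤ + m
    positive-of zero    (+≤+ ())
    positive-of (suc m) _ = +≤+ (ℕ.s≤s ℕ.z≤n)

  module _ (a I : ℤ) (0≤a : + 0 ≤ a) (a≤N : a ≤ N) where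

    private
      s : ℤ
      s = a * (N - a)

      0≤s : + 0 ≤ s
      0≤s = 0≤* 0≤a (0≤-gap a≤N)

      s≤N² : s ≤ N * N
      s≤N² = ≤-by _ (0≤+ (0≤* 0≤N (0≤-gap a≤N)) (0≤sq a)) (identity N a)
        where
        identity : ∀ N a → N * N ≡ a * (N - a) + (N * (N - a) + a * a)
        identity = solve-∀

    -- Divided by B N⁵ this bounds I/B by 10 s²/N⁴ plus 200/N. The estimates that follow are cleared
    -- of denominators in the same way.
    estimate-upperℤ : + 120 * I ≤ + 10 * N * (s * s) → I * N ^ 5 ≤ + 10 * (s * s) * B * N + + 200 * B * N ^ 4
    estimate-upperℤ I≤ = *-cancelˡ-≤-pos (I * N ^ 5) (+ 10 * (s * s) * B * N + + 200 * B * N ^ 4) (+ 120) (≤-by _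
      (0≤+ (0≤* (0≤^ 5 0≤N) (0≤-gap I≤))
      (0≤+ (0≤* (0≤* (0≤* (0≤lit 10) 0≤N) (0≤sq s)) (0≤-gap (≤120*C n)))
      (0≤+ (0≤* (0≤* (0≤lit 100) (0≤^ 4 0≤N)) (0≤-gap N^5≤240*B))
           (0≤* (0≤* (0≤lit 100) (0≤^ 5 0≤N)) (0≤* (0≤-gap s≤N²) (0≤+ (0≤* 0≤N 0≤N) 0≤s))))))
      (identity N B I s))
      where
      identity : ∀ N B I s → + 120 * (+ 10 * (s * s) * B * N + + 200 * B * (N * (N * (N * (N * + 1))))) ≡ + 120 * (I * (N * (N * (N * (N * (N * + 1)))))) +
        ((N * (N * (N * (N * (N * + 1))))) * (+ 10 * N * (s * s) - + 120 * I) +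
        (+ 10 * N * (s * s) * (+ 120 * B + + 10 * (N * (N * (N * (N * + 1)))) - (N * (N * (N * (N * (N * + 1)))))) +
        (+ 100 * (N * (N * (N * (N * + 1)))) * (+ 240 * B - (N * (N * (N * (N * (N * + 1)))))) +
         + 100 * (N * (N * (N * (N * (N * + 1))))) * ((N * N - s) * (N * N + s)))))
      identity = solve-∀

    estimate-lowerℤ : + 10 * N * (s * s) ≤ + 120 * I + + 10 * N ^ 4 →
                      + 10 * (s * s) * B * N ≤ I * N ^ 5 + + 200 * B * N ^ 4
    estimate-lowerℤ ≤I = *-cancelˡ-≤-pos (+ 10 * (s * s) * B * N) (I * N ^ 5 + + 200 * B * N ^ 4) (+ 120) (≤-by _
      (0≤+ (0≤* (0≤^ 5 0≤N) (0≤-gap ≤I))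
      (0≤+ (0≤* (0≤* (0≤* (0≤lit 10) 0≤N) (0≤sq s)) (0≤-gap (120*C≤ n)))
      (0≤+ (0≤* (0≤* (0≤lit 100) (0≤^ 4 0≤N)) (0≤-gap N^5≤240*B))
           (0≤* (0≤lit 90) (0≤* (0≤^ 5 0≤N) (0≤^ 4 0≤N))))))
      (identity N B I s))
      where
      identity : ∀ N B I s → + 120 * (I * (N * (N * (N * (N * (N * + 1))))) + + 200 * B * (N * (N * (N * (N * + 1))))) ≡ + 120 * (+ 10 * (s * s) * B * N) +
        ((N * (N * (N * (N * (N * + 1))))) * (+ 120 * I + + 10 * (N * (N * (N * (N * + 1)))) - + 10 * N * (s * s)) +
        (+ 10 * N * (s * s) * ((N * (N * (N * (N * (N * + 1))))) - + 120 * B) +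
        (+ 100 * (N * (N * (N * (N * + 1)))) * (+ 240 * B - (N * (N * (N * (N * (N * + 1)))))) +
         + 90 * ((N * (N * (N * (N * (N * + 1))))) * (N * (N * (N * (N * + 1))))))))
      identity = solve-∀

  upperℤ : ∀ I → + 960 * I ≤ + 5 * N ^ 5 → + 8 * I * N ≤ + 5 * B * N + + 1600 * B
  upperℤ I I≤ = *-cancelˡ-≤-pos (+ 8 * I * N) (+ 5 * B * N + + 1600 * B) (+ 120) (≤-by _
    (0≤+ (0≤* 0≤N (0≤-gap I≤))
    (0≤+ (0≤* (0≤* (0≤lit 5) 0≤N) (0≤-gap (≤120*C n)))
    (0≤+ (0≤* (0≤lit 800) (0≤-gap N^5≤240*B)) (0≤* (0≤lit 750) (0≤^ 5 0≤N)))))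
    (identity N B I))
    where
    identity : ∀ N B I → + 120 * (+ 5 * B * N + + 1600 * B) ≡ + 120 * (+ 8 * I * N) +
      (N * (+ 5 * (N * (N * (N * (N * (N * + 1))))) - + 960 * I) +
      (+ 5 * N * (+ 120 * B + + 10 * (N * (N * (N * (N * + 1)))) - (N * (N * (N * (N * (N * + 1)))))) +
      (+ 800 * (+ 240 * B - (N * (N * (N * (N * (N * + 1)))))) + + 750 * (N * (N * (N * (N * (N * + 1))))))))
    identity = solve-∀

  -- Since 120 B ≤ N⁵, even 64 M³ would serve as the factor; 144 M³ is used because the stability
  -- constant is at the same time the threshold on n required by `far-gap`.
  stabilityℤ : ∀ M³ δ I J → + 0 ≤ δ →
    N ^ 3 * δ + + 64 * M³ * (+ 120 * I) ≤ + 64 * M³ * (+ 120 * J) → δ * B ≤ + 144 * M³ * (J - I) * (N * N)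
  stabilityℤ M³ δ I J 0≤δ gap = *-cancelˡ-≤-pos (δ * B) (+ 144 * M³ * (J - I) * (N * N)) (+ 480) (≤-by _
    (0≤+ (0≤* (0≤* (0≤lit 9) (0≤^ 2 0≤N)) (0≤-gap gap))
    (0≤+ (0≤* (0≤* (0≤lit 4) 0≤δ) (0≤-gap (120*C≤ n))) (0≤* (0≤* (0≤lit 5) (0≤^ 5 0≤N)) 0≤δ)))
    (identity N B M³ δ I J))
    where
    identity : ∀ N B M³ δ I J → + 480 * (+ 144 * M³ * (J - I) * (N * N)) ≡ + 480 * (δ * B) +
      (+ 9 * (N * (N * + 1)) * (+ 64 * M³ * (+ 120 * J) - ((N * (N * (N * + 1))) * δ + + 64 * M³ * (+ 120 * I))) +
      (+ 4 * δ * ((N * (N * (N * (N * (N * + 1))))) - + 120 * B) + + 5 * (N * (N * (N * (N * (N * + 1))))) * δ))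
    identity = solve-∀

  0<ιB : 0ℚ ℚ.< ι B
  0<ιB = ι-pos 1≤B

  ε : ℚ
  ε = ratio 1 n

  private
    denominator : ℚ
    denominator = ι B ℚ.* ι (N ^ 5)

    0<denominator : 0ℚ ℚ.< denominator
    0<denominator = subst (0ℚ ℚ.<_) (ι-* B (N ^ 5)) (ι-pos 1≤BN^5)
      where
      1≤* : ∀ {a b} → + 1 ≤ a → + 1 ≤ b → + 1 ≤ a * b
      1≤* {a} {b} 1≤a 1≤b = ≤-by _ (0≤+ (0≤* (0≤-gap 1≤a) (≤-trans (0≤lit 1) 1≤b)) (0≤-gap 1≤b)) (identity a b)
        where
        identity : ∀ a b → a * b ≡ + 1 + ((a - + 1) * b + (b - + 1))
        identity = solve-∀
      1≤BN^5 : + 1 ≤ B * N ^ 5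
      1≤BN^5 = 1≤* 1≤B (1≤* 1≤N (1≤* 1≤N (1≤* 1≤N (1≤* 1≤N (1≤* 1≤N ≤-refl)))))

    density-scaled : ∀ I → ratio I (n C 5) ℚ.* denominator ≡ ι (+ I * N ^ 5)
    density-scaled I = begin
      ratio I (n C 5) ℚ.* (ι B ℚ.* ι (N ^ 5)) ≡⟨ ℚ.*-assoc (ratio I (n C 5)) (ι B) (ι (N ^ 5)) ⟨
      ratio I (n C 5) ℚ.* ι B ℚ.* ι (N ^ 5)   ≡⟨ cong (ℚ._* ι (N ^ 5)) (ratio-cancel I (n C 5) 1≤B) ⟩
      ι (+ I) ℚ.* ι (N ^ 5)                   ≡⟨ ι-* (+ I) (N ^ 5) ⟨
      ι (+ I * N ^ 5)                         ∎
      where open ≡-Reasoning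

    ε-scaled : (ι (+ 200) ℚ.* ε) ℚ.* denominator ≡ ι (+ 200 * B * N ^ 4)
    ε-scaled = begin
      (ι (+ 200) ℚ.* ε) ℚ.* (ι B ℚ.* ι (N ^ 5))
        ≡⟨ cong (λ t → (ι (+ 200) ℚ.* ε) ℚ.* (ι B ℚ.* t)) (ι-* N (N ^ 4)) ⟩
      (ι (+ 200) ℚ.* ε) ℚ.* (ι B ℚ.* (ι N ℚ.* ι (N ^ 4)))
        ≡⟨ regroup (ι (+ 200)) ε (ι B) (ι N) (ι (N ^ 4)) ⟩
      (ι (+ 200) ℚ.* ι B) ℚ.* ι (N ^ 4) ℚ.* (ε ℚ.* ι N)
        ≡⟨ cong ((ι (+ 200) ℚ.* ι B) ℚ.* ι (N ^ 4) ℚ.*_) (ratio-cancel 1 n 1≤N) ⟩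
      (ι (+ 200) ℚ.* ι B) ℚ.* ι (N ^ 4) ℚ.* 1ℚ
        ≡⟨ ℚ.*-identityʳ _ ⟩
      (ι (+ 200) ℚ.* ι B) ℚ.* ι (N ^ 4)
        ≡⟨ trans (ι-* (+ 200 * B) (N ^ 4)) (cong (ℚ._* ι (N ^ 4)) (ι-* (+ 200) B)) ⟨
      ι (+ 200 * B * N ^ 4) ∎
      where
      open ≡-Reasoning
      regroup : ∀ k e c x y → (k ℚ.* e) ℚ.* (c ℚ.* (x ℚ.* y)) ≡ (k ℚ.* c) ℚ.* y ℚ.* (e ℚ.* x)
      regroup = solve 5 (λ k e c x y → (k :* e) :* (c :* (x :* y)) := ((k :* c) :* y) :* (e :* x)) refl

    P-scaled : ∀ a → P (ratio a n) ℚ.* denominator ≡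
               ι (+ 10 * ((+ a * (N - + a)) * (+ a * (N - + a))) * B * N)
    P-scaled a = begin
      P x ℚ.* (ι B ℚ.* ι (N ^ 5))
        ≡⟨ cong (λ t → P x ℚ.* (ι B ℚ.* t)) power ⟩
      P x ℚ.* (ι B ℚ.* (ι N ℚ.* (ι N ℚ.* (ι N ℚ.* (ι N ℚ.* ι N)))))
        ≡⟨ regroup (ι (+ 10)) x (ι B) (ι N) ⟩
      ι (+ 10) ℚ.* (y ℚ.* (ι N ℚ.- y) ℚ.* (y ℚ.* (ι N ℚ.- y))) ℚ.* ι B ℚ.* ι N
        ≡⟨ cong (λ y → ι (+ 10) ℚ.* (y ℚ.* (ι N ℚ.- y) ℚ.* (y ℚ.* (ι N ℚ.- y))) ℚ.* ι B ℚ.* ι N)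
                (ratio-cancel a n 1≤N) ⟩
      ι (+ 10) ℚ.* (ι (+ a) ℚ.* (ι N ℚ.- ι (+ a)) ℚ.* (ι (+ a) ℚ.* (ι N ℚ.- ι (+ a)))) ℚ.* ι B ℚ.* ι N
        ≡⟨ cong (λ s → ι (+ 10) ℚ.* (s ℚ.* s) ℚ.* ι B ℚ.* ι N)
                (trans (ι-* (+ a) (N - + a)) (cong (ι (+ a) ℚ.*_) (ι-- N (+ a)))) ⟨
      ι (+ 10) ℚ.* (ι s ℚ.* ι s) ℚ.* ι B ℚ.* ι N
        ≡⟨ trans (ι-* (+ 10 * (s * s) * B) N) (cong (ℚ._* ι N)
             (trans (ι-* (+ 10 * (s * s)) B) (cong (ℚ._* ι B)
               (trans (ι-* (+ 10) (s * s)) (cong (ι (+ 10) ℚ.*_) (ι-* s s)))))) ⟨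
      ι (+ 10 * (s * s) * B * N) ∎
      where
      open ≡-Reasoning
      x y : ℚ
      x = ratio a n
      y = x ℚ.* ι N
      s : ℤ
      s = + a * (N - + a)
      power : ι (N ^ 5) ≡ ι N ℚ.* (ι N ℚ.* (ι N ℚ.* (ι N ℚ.* ι N)))
      power = trans (ι-* N (N ^ 4)) (cong (ι N ℚ.*_)
        (trans (ι-* N (N ^ 3)) (cong (ι N ℚ.*_)
        (trans (ι-* N (N ^ 2)) (cong (ι N ℚ.*_)
        (trans (ι-* N (N ^ 1)) (cong (λ t → ι N ℚ.* ι t) (*-identityʳ N))))))))
      regroup : ∀ k x c m → (k ℚ.* ((x ℚ.* (1ℚ ℚ.- x)) ℚ.* (x ℚ.* (1ℚ ℚ.- x)))) ℚ.*
          (c ℚ.* (m ℚ.* (m ℚ.* (m ℚ.* (m ℚ.* m))))) ≡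
        k ℚ.* ((x ℚ.* m) ℚ.* (m ℚ.- x ℚ.* m) ℚ.* ((x ℚ.* m) ℚ.* (m ℚ.- x ℚ.* m))) ℚ.* c ℚ.* m
      regroup = solve 4 (λ k x c m → (k :* ((x :* (con 1ℚ :- x)) :* (x :* (con 1ℚ :- x)))) :*
          (c :* (m :* (m :* (m :* (m :* m))))) :=
        ((k :* (((x :* m) :* (m :- x :* m)) :* ((x :* m) :* (m :- x :* m)))) :* c) :* m) refl

  density-upper : ∀ (c : Fin n → Fin 2) →
    density 5 4 (blowup twoLoops c) ℚ.≤ P (ratio (partSize c zero) n) ℚ.+ ι (+ 200) ℚ.* ε
  density-upper c = cancel-≤ℚ denominator 0<denominator (subst₂ ℚ._≤_
    (sym (density-scaled I))
    (sym (trans (ℚ.*-distribʳ-+ denominator (P (ratio a n)) (ι (+ 200) ℚ.* ε))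
         (trans (cong₂ ℚ._+_ (P-scaled a) ε-scaled) (sym (ι-+ (+ 10 * (s * s) * B * N) (+ 200 * B * N ^ 4))))))
    (ι-mono-≤ (estimate-upperℤ (+ a) (+ I) (0≤lit a) (partSize≤ c) (inducedCount-blowup≤ c))))
    where
    a I : ℕ
    a = partSize c zero
    I = inducedCount 5 4 (blowup twoLoops c)
    s : ℤ
    s = + a * (N - + a)

  density-lower : ∀ (c : Fin n → Fin 2) →
    P (ratio (partSize c zero) n) ℚ.≤ density 5 4 (blowup twoLoops c) ℚ.+ ι (+ 200) ℚ.* ε
  density-lower c = cancel-≤ℚ denominator 0<denominator (subst₂ ℚ._≤_
    (sym (P-scaled a))
    (sym (trans (ℚ.*-distribʳ-+ denominator (density 5 4 (blowup twoLoops c)) (ι (+ 200) ℚ.* ε))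
         (trans (cong₂ ℚ._+_ (density-scaled I) ε-scaled) (sym (ι-+ (+ I * N ^ 5) (+ 200 * B * N ^ 4))))))
    (ι-mono-≤ (estimate-lowerℤ (+ a) (+ I) (0≤lit a) (partSize≤ c) (≤inducedCount-blowup c))))
    where
    a I : ℕ
    a = partSize c zero
    I = inducedCount 5 4 (blowup twoLoops c)

  density≤ : ∀ (G : Graph n) → density 5 4 G ℚ.≤ + 5 / 8 ℚ.+ ι (+ 200) ℚ.* ε
  density≤ G = cancel-≤ℚ (ι (+ 8) ℚ.* (ι B ℚ.* ι N)) 0<8BN (subst₂ ℚ._≤_ left right
    (ι-mono-≤ (upperℤ (+ I) (inducedCount≤ G))))
    where
    open ≡-Reasoning
    I : ℕ
    I = inducedCount 5 4 G
    0<8BN : 0ℚ ℚ.< ι (+ 8) ℚ.* (ι B ℚ.* ι N)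
    0<8BN = subst (0ℚ ℚ.<_) (trans (ι-* (+ 8) (B * N)) (cong (ι (+ 8) ℚ.*_) (ι-* B N)))
      (ι-pos (≤-by _ (0≤+ (0≤* (0≤* (0≤lit 8) (0≤-gap 1≤B)) 0≤N) (0≤+ (0≤* (0≤lit 8) (0≤-gap 1≤N)) (0≤lit 7))) (identity B N)))
      where
      identity : ∀ c m → + 8 * (c * m) ≡ + 1 + (+ 8 * (c - + 1) * m + (+ 8 * (m - + 1) + + 7))
      identity = solve-∀
    left : ι (+ 8 * + I * N) ≡ density 5 4 G ℚ.* (ι (+ 8) ℚ.* (ι B ℚ.* ι N))
    left = begin
      ι (+ 8 * + I * N)             ≡⟨ trans (ι-* (+ 8 * + I) N) (cong (ℚ._* ι N) (ι-* (+ 8) (+ I))) ⟩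
      ι (+ 8) ℚ.* ι (+ I) ℚ.* ι N   ≡⟨ cong (λ t → ι (+ 8) ℚ.* t ℚ.* ι N) (ratio-cancel I (n C 5) 1≤B) ⟨
      ι (+ 8) ℚ.* (density 5 4 G ℚ.* ι B) ℚ.* ι N ≡⟨ regroup (ι (+ 8)) (density 5 4 G) (ι B) (ι N) ⟩
      density 5 4 G ℚ.* (ι (+ 8) ℚ.* (ι B ℚ.* ι N)) ∎
      where
      regroup : ∀ k d c m → k ℚ.* (d ℚ.* c) ℚ.* m ≡ d ℚ.* (k ℚ.* (c ℚ.* m))
      regroup = solve 4 (λ k d c m → (k :* (d :* c)) :* m := d :* (k :* (c :* m))) refl
    right : ι (+ 5 * B * N + + 1600 * B) ≡ (+ 5 / 8 ℚ.+ ι (+ 200) ℚ.* ε) ℚ.* (ι (+ 8) ℚ.* (ι B ℚ.* ι N))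
    right = begin
      ι (+ 5 * B * N + + 1600 * B)
        ≡⟨ trans (ι-+ (+ 5 * B * N) (+ 1600 * B)) (cong₂ ℚ._+_
             (trans (ι-* (+ 5 * B) N) (cong (ℚ._* ι N) (ι-* (+ 5) B))) (ι-* (+ 1600) B)) ⟩
      ι (+ 5) ℚ.* ι B ℚ.* ι N ℚ.+ ι (+ 1600) ℚ.* ι B
        ≡⟨ cong (ι (+ 5) ℚ.* ι B ℚ.* ι N ℚ.+_) (trans (sym (ℚ.*-identityʳ _))
             (cong (ι (+ 1600) ℚ.* ι B ℚ.*_) (sym (ratio-cancel 1 n 1≤N)))) ⟩
      ι (+ 5) ℚ.* ι B ℚ.* ι N ℚ.+ ι (+ 1600) ℚ.* ι B ℚ.* (ε ℚ.* ι N)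
        ≡⟨ regroup ε (ι B) (ι N) ⟩
      (+ 5 / 8 ℚ.+ ι (+ 200) ℚ.* ε) ℚ.* (ι (+ 8) ℚ.* (ι B ℚ.* ι N)) ∎
      where
      regroup : ∀ e c m → ι (+ 5) ℚ.* c ℚ.* m ℚ.+ ι (+ 1600) ℚ.* c ℚ.* (e ℚ.* m) ≡
                (+ 5 / 8 ℚ.+ ι (+ 200) ℚ.* e) ℚ.* (ι (+ 8) ℚ.* (c ℚ.* m))
      regroup = solve 3 (λ e c m → con (ι (+ 5)) :* c :* m :+ con (ι (+ 1600)) :* c :* (e :* m) :=
                (con (+ 5 / 8) :+ con (ι (+ 200)) :* e) :* (con (ι (+ 8)) :* (c :* m))) refl

  distance-bound : ∀ M³ (G H : Graph n) → + 0 ≤ M³ → Gap M³ G H →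
    fromℕ (distanceToBlowups twoLoops G) ℚ.≤
      ι (+ 144 * M³) ℚ.* (maxDensity 5 4 n ℚ.- density 5 4 G) ℚ.* fromℕ (n ℕ.^ 2)
  distance-bound M³ G H 0≤M³ gap = ℚ.≤-trans attained
    (≤-byℚ _ (0≤*ℚ (0≤*ℚ 0≤K (0≤gapℚ (density≤maxDensity 5 4 H))) 0≤n²)
      (regroup (ι (+ 144 * M³)) (maxDensity 5 4 n) (density 5 4 H) (density 5 4 G) (fromℕ (n ℕ.^ 2))))
    where
    δ I I′ : ℕ
    δ = distanceToBlowups twoLoops G
    I = inducedCount 5 4 G
    I′ = inducedCount 5 4 H
    0≤K : 0ℚ ℚ.≤ ι (+ 144 * M³)
    0≤K = ι-mono-≤ {+ 0} (0≤* (0≤lit 144) 0≤M³)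
    0≤n² : 0ℚ ℚ.≤ fromℕ (n ℕ.^ 2)
    0≤n² = ι-mono-≤ {+ 0} (0≤lit (n ℕ.^ 2))
    regroup : ∀ k m h g s → k ℚ.* (m ℚ.- g) ℚ.* s ≡ k ℚ.* (h ℚ.- g) ℚ.* s ℚ.+ k ℚ.* (m ℚ.- h) ℚ.* s
    regroup = solve 5 (λ k m h g s → (k :* (m :- g)) :* s := (k :* (h :- g)) :* s :+ (k :* (m :- h)) :* s) refl
    open ≡-Reasoning
    scaled : ι (+ 144 * M³ * (+ I′ - + I) * (N * N)) ≡
             ι (+ 144 * M³) ℚ.* (density 5 4 H ℚ.- density 5 4 G) ℚ.* fromℕ (n ℕ.^ 2) ℚ.* ι B
    scaled = begin
      ι (+ 144 * M³ * (+ I′ - + I) * (N * N))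
        ≡⟨ trans (ι-* (+ 144 * M³ * (+ I′ - + I)) (N * N)) (cong (ℚ._* ι (N * N))
             (trans (ι-* (+ 144 * M³) (+ I′ - + I)) (cong (ι (+ 144 * M³) ℚ.*_) (ι-- (+ I′) (+ I))))) ⟩
      ι (+ 144 * M³) ℚ.* (ι (+ I′) ℚ.- ι (+ I)) ℚ.* ι (N * N)
        ≡⟨ cong₂ (λ j i → ι (+ 144 * M³) ℚ.* (j ℚ.- i) ℚ.* ι (N * N))
             (sym (ratio-cancel I′ (n C 5) 1≤B)) (sym (ratio-cancel I (n C 5) 1≤B)) ⟩
      ι (+ 144 * M³) ℚ.* (density 5 4 H ℚ.* ι B ℚ.- density 5 4 G ℚ.* ι B) ℚ.* ι (N * N)
        ≡⟨ cong (λ t → ι (+ 144 * M³) ℚ.* (density 5 4 H ℚ.* ι B ℚ.- density 5 4 G ℚ.* ι B) ℚ.* ι t) square ⟩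
      ι (+ 144 * M³) ℚ.* (density 5 4 H ℚ.* ι B ℚ.- density 5 4 G ℚ.* ι B) ℚ.* fromℕ (n ℕ.^ 2)
        ≡⟨ collect (ι (+ 144 * M³)) (density 5 4 H) (density 5 4 G) (ι B) (fromℕ (n ℕ.^ 2)) ⟩
      ι (+ 144 * M³) ℚ.* (density 5 4 H ℚ.- density 5 4 G) ℚ.* fromℕ (n ℕ.^ 2) ℚ.* ι B ∎
      where
      square : N * N ≡ + (n ℕ.^ 2)
      square = trans (sym (pos-* n n)) (cong (λ t → + (n ℕ.* t)) (sym (ℕ.*-identityʳ n)))
      collect : ∀ k h g c s → k ℚ.* (h ℚ.* c ℚ.- g ℚ.* c) ℚ.* s ≡ k ℚ.* (h ℚ.- g) ℚ.* s ℚ.* c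
      collect = solve 5 (λ k h g c s → (k :* (h :* c :- g :* c)) :* s := ((k :* (h :- g)) :* s) :* c) refl
    attained : ι (+ δ) ℚ.≤ ι (+ 144 * M³) ℚ.* (density 5 4 H ℚ.- density 5 4 G) ℚ.* fromℕ (n ℕ.^ 2)
    attained = cancel-≤ℚ (ι B) 0<ιB (subst₂ ℚ._≤_ (ι-* (+ δ) B) scaled
      (ι-mono-≤ (stabilityℤ M³ (+ δ) (+ I) (+ I′) (0≤lit δ) gap)))

perfectlyStable : ∀ M → + 89856 ≤ M → PerfectlyStable 5 4 twoLoops
perfectlyStable M M-big = ι K , ι-pos (≤-trans (+≤+ (ℕ.s≤s ℕ.z≤n)) K-big) , λ n G K≤n →
  bound n G (ι-cancel-≤ K≤n)
  where
  K : ℤ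
  K = + 144 * (M * M * M)
  0≤M³ : + 0 ≤ M * M * M
  0≤M³ = 0≤* (0≤* 0≤M 0≤M) 0≤M
    where
    0≤M : + 0 ≤ M
    0≤M = ≤-trans (0≤lit 89856) M-big
  K-big : + 23040 ≤ K
  -- 23040 + 66816 = 89856.
  K-big = ≤-trans (+≤+ (ℕ.m≤m+n 23040 66816)) (≤-trans M-big (≤-trans (≤cube (≤-trans (+≤+ (ℕ.s≤s ℕ.z≤n)) M-big))
    (≤-by _ (0≤* (0≤lit 143) 0≤M³) (times (M * M * M)))))
    where
    times : ∀ m → + 144 * m ≡ m + + 143 * m
    times = solve-∀
  bound : ∀ n (G : Graph n) → K ≤ + n →
    fromℕ (distanceToBlowups twoLoops G) ℚ.≤ ι K ℚ.* (maxDensity 5 4 n ℚ.- density 5 4 G) ℚ.* fromℕ (n ℕ.^ 2)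
  bound n G K≤n = let H , gap = stability M M-big G (≤-trans K-big K≤n) K≤n in
    Estimates.distance-bound n (≤-trans (+≤+ (ℕ.m≤m+n 20 23020)) (≤-trans K-big K≤n)) (M * M * M) G H 0≤M³ gap

frac-cancel : ∀ p → p ℚ.* ι (ℚ.↧ p) ≡ ι (ℚ.↥ p)
frac-cancel p@record{} = ℚ.toℚᵘ-injective
  (ℚᵘ.≃-trans (ℚ.toℚᵘ-homo-* p (ι (ℚ.↧ p)))
  (ℚᵘ.≃-trans (ℚᵘ.*-cong (ℚᵘ.≃-refl {ℚ.toℚᵘ p}) (toℚᵘ-ι (ℚ.↧ p)))
  (ℚᵘ.≃-trans (ℚᵘ.*≡* (trans (identity (ℚ.↥ p) (ℚ.↧ p)) (cong (λ t → ℚ.↥ p * + t) (sym (ℕ.*-identityʳ (ℚ.↧ₙ p))))))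
              (ℚᵘ.≃-sym (toℚᵘ-ι (ℚ.↥ p))))))
  where
  identity : ∀ a b → a * b * + 1 ≡ a * b
  identity = solve-∀

-- A positive fraction with denominator q is at least 1/q, so c q vertices suffice; the summand 20
-- secures the hypothesis of `Estimates`.
archimedean : ∀ c ε → 0ℚ ℚ.< ε → Σ[ N ∈ ℕ ] (∀ n → N ℕ.≤ n → + 20 ≤ + n × ι (+ c) ℚ.* ratio 1 n ℚ.≤ ε)
archimedean c ε 0<ε = 20 ℕ.+ c ℕ.* ℚ.↧ₙ ε , λ n N≤n →
  let 20≤n = +≤+ (ℕ.≤-trans (ℕ.m≤m+n 20 (c ℕ.* ℚ.↧ₙ ε)) N≤n)
      1≤n  = ≤-trans (+≤+ (ℕ.s≤s ℕ.z≤n)) 20≤n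
      cq≤n = +≤+ (ℕ.≤-trans (ℕ.m≤n+m (c ℕ.* ℚ.↧ₙ ε) 20) N≤n) in
  20≤n , cancel-≤ℚ (ι (+ n)) (ι-pos 1≤n) (subst (ℚ._≤ ε ℚ.* ι (+ n)) (sym (left n 1≤n))
    (ℚ.≤-trans c≤ (ℚ.*-monoˡ-≤-nonNeg ε {{ℚ.nonNegative (ℚ.<⇒≤ 0<ε)}} (ι-mono-≤ cq≤n))))
  where
  1≤↥ε : + 1 ≤ ℚ.↥ ε
  1≤↥ε = numerator ε 0<ε
    where
    numerator : ∀ ε → 0ℚ ℚ.< ε → + 1 ≤ ℚ.↥ ε
    numerator (ℚ.mkℚ (+ suc n) _ _)  _ = +≤+ (ℕ.s≤s ℕ.z≤n)
    numerator (ℚ.mkℚ (+ zero) _ _)   (ℚ.*<* (+<+ ()))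
    numerator (ℚ.mkℚ (-[1+ n ]) _ _) (ℚ.*<* ())
  left : ∀ n → + 1 ≤ + n → ι (+ c) ℚ.* ratio 1 n ℚ.* ι (+ n) ≡ ι (+ c)
  left n 1≤n = trans (ℚ.*-assoc (ι (+ c)) (ratio 1 n) (ι (+ n)))
    (trans (cong (ι (+ c) ℚ.*_) (ratio-cancel 1 n 1≤n)) (ℚ.*-identityʳ (ι (+ c))))
  c≤ : ι (+ c) ℚ.≤ ε ℚ.* ι (+ (c ℕ.* ℚ.↧ₙ ε))
  c≤ = subst₂ ℚ._≤_ (ℚ.*-identityʳ (ι (+ c))) right
    (ℚ.*-monoˡ-≤-nonNeg (ι (+ c)) {{ℚ.nonNegative (ι-mono-≤ {+ 0} (0≤lit c))}} (ι-mono-≤ 1≤↥ε))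
    where
    right : ι (+ c) ℚ.* ι (ℚ.↥ ε) ≡ ε ℚ.* ι (+ (c ℕ.* ℚ.↧ₙ ε))
    right = trans (cong (ι (+ c) ℚ.*_) (sym (frac-cancel ε)))
      (trans (swap (ι (+ c)) ε (ι (ℚ.↧ ε)))
             (cong (ε ℚ.*_) (trans (sym (ι-* (+ c) (ℚ.↧ ε))) (cong ι (sym (pos-* c (ℚ.↧ₙ ε)))))))
      where
      swap : ∀ a e b → a ℚ.* (e ℚ.* b) ≡ e ℚ.* (a ℚ.* b)
      swap = solve 3 (λ a e b → a :* (e :* b) := e :* (a :* b)) refl

0<*ℚ : ∀ {p q} → 0ℚ ℚ.< p → 0ℚ ℚ.< q → 0ℚ ℚ.< p ℚ.* q
0<*ℚ {p} {q} 0<p 0<q = ℚ.positive⁻¹ (p ℚ.* q) {{ℚ.pos*pos⇒pos p {{ℚ.positive 0<p}} q {{ℚ.positive 0<q}}}}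

0≤+ℚ : ∀ {p q} → 0ℚ ℚ.≤ p → 0ℚ ℚ.≤ q → 0ℚ ℚ.≤ p ℚ.+ q
0≤+ℚ = ℚ.+-mono-≤

-- Limits

-- Two one-sided inequalities in place of an absolute value, so that each can enter as a gap in a
-- linear identity.
record Close (δ x y : ℚ) : Set where
  constructor _∼_
  field
    below : x ℚ.≤ y ℚ.+ δ
    above : y ℚ.≤ x ℚ.+ δ

open Close

close-sym : ∀ {δ x y} → Close δ x y → Close δ y x
close-sym (p ∼ q) = q ∼ p

≤-shift : ∀ {x y z δ η} → x ℚ.≤ y ℚ.+ δ → y ℚ.≤ z ℚ.+ η → x ℚ.≤ z ℚ.+ (δ ℚ.+ η)
≤-shift {x} {y} {z} {δ} {η} p q = ≤-byℚ _ (0≤+ℚ (0≤gapℚ p) (0≤gapℚ q)) (identity x y z δ η)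
  where
  identity : ∀ x y z δ η → z ℚ.+ (δ ℚ.+ η) ≡ x ℚ.+ ((y ℚ.+ δ ℚ.- x) ℚ.+ (z ℚ.+ η ℚ.- y))
  identity = solve 5 (λ x y z δ η → z :+ (δ :+ η) := x :+ ((y :+ δ :- x) :+ (z :+ η :- y))) refl

close-trans : ∀ {x y z δ η} → Close δ x y → Close η y z → Close (δ ℚ.+ η) x z
close-trans {x} {y} {z} {δ} {η} (p ∼ q) (r ∼ s) =
  ≤-shift {x} {y} {z} p r ∼ subst (λ t → z ℚ.≤ x ℚ.+ t) (ℚ.+-comm η δ) (≤-shift {z} {y} {x} s q)

close-weaken : ∀ {x y δ η} → δ ℚ.≤ η → Close δ x y → Close η x y
close-weaken {x} {y} δ≤η (p ∼ q) = ℚ.≤-trans p (ℚ.+-monoʳ-≤ y δ≤η) ∼ ℚ.≤-trans q (ℚ.+-monoʳ-≤ x δ≤η)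

≤∣∣ : ∀ p → p ℚ.≤ ℚ.∣ p ∣
≤∣∣ p with ℚ.≤-total 0ℚ p
... | inj₁ 0≤p = ℚ.≤-reflexive (sym (ℚ.0≤p⇒∣p∣≡p 0≤p))
... | inj₂ p≤0 = ℚ.≤-trans p≤0 (ℚ.0≤∣p∣ p)

∣-∣⇒close : ∀ {x y δ} → ℚ.∣ x ℚ.- y ∣ ℚ.≤ δ → Close δ x y
∣-∣⇒close {x} {y} {δ} h =
  ≤-byℚ _ (0≤gapℚ (ℚ.≤-trans (≤∣∣ (x ℚ.- y)) h)) (one x y δ) ∼
  ≤-byℚ _ (0≤gapℚ (ℚ.≤-trans (≤∣∣ (ℚ.- (x ℚ.- y))) (subst (ℚ._≤ δ) (sym (ℚ.∣-p∣≡∣p∣ (x ℚ.- y))) h))) (two x y δ)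
  where
  one : ∀ x y δ → y ℚ.+ δ ≡ x ℚ.+ (δ ℚ.- (x ℚ.- y))
  one = solve 3 (λ x y δ → y :+ δ := x :+ (δ :- (x :- y))) refl
  two : ∀ x y δ → x ℚ.+ δ ≡ y ℚ.+ (δ ℚ.- (ℚ.- (x ℚ.- y)))
  two = solve 3 (λ x y δ → x :+ δ := y :+ (δ :- (:- (x :- y)))) refl

close⇒∣-∣ : ∀ {x y δ} → Close δ x y → ℚ.∣ x ℚ.- y ∣ ℚ.≤ δ
close⇒∣-∣ {x} {y} {δ} (p ∼ q) with ℚ.∣p∣≡p∨∣p∣≡-p (x ℚ.- y)
... | inj₁ eq = subst (ℚ._≤ δ) (sym eq) (≤-byℚ _ (0≤gapℚ p) (one x y δ))
  where
  one : ∀ x y δ → δ ≡ (x ℚ.- y) ℚ.+ (y ℚ.+ δ ℚ.- x)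
  one = solve 3 (λ x y δ → δ := (x :- y) :+ (y :+ δ :- x)) refl
... | inj₂ eq = subst (ℚ._≤ δ) (sym eq) (≤-byℚ _ (0≤gapℚ q) (two x y δ))
  where
  two : ∀ x y δ → δ ≡ (ℚ.- (x ℚ.- y)) ℚ.+ (x ℚ.+ δ ℚ.- y)
  two = solve 3 (λ x y δ → δ := (:- (x :- y)) :+ (x :+ δ :- y)) refl

clamp : ℚ → ℚ
clamp x = 0ℚ ℚ.⊔ (1ℚ ℚ.⊓ x)

0≤clamp : ∀ x → 0ℚ ℚ.≤ clamp x
0≤clamp x = ℚ.p≤p⊔q 0ℚ (1ℚ ℚ.⊓ x)

clamp≤1 : ∀ x → clamp x ℚ.≤ 1ℚ
clamp≤1 x = ℚ.⊔-lub (ℚ.<⇒≤ (ℚ.positive⁻¹ 1ℚ)) (ℚ.p⊓q≤p 1ℚ x)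

clamp-id : ∀ {x} → 0ℚ ℚ.≤ x → x ℚ.≤ 1ℚ → clamp x ≡ x
clamp-id {x} 0≤x x≤1 = trans (cong (0ℚ ℚ.⊔_) (ℚ.p≥q⇒p⊓q≡q x≤1)) (ℚ.p≤q⇒p⊔q≡q 0≤x)

clamp-mono-shift : ∀ {x y δ} → 0ℚ ℚ.≤ δ → x ℚ.≤ y ℚ.+ δ → clamp x ℚ.≤ clamp y ℚ.+ δ
clamp-mono-shift {x} {y} {δ} 0≤δ x≤y+δ = ℚ.⊔-lub (0≤+ℚ (0≤clamp y) 0≤δ) (upper (ℚ.≤-total y 1ℚ))
  where
  clamp≤+ : clamp y ℚ.≤ clamp y ℚ.+ δ
  clamp≤+ = ≤-byℚ δ 0≤δ refl
  upper : y ℚ.≤ 1ℚ ⊎ 1ℚ ℚ.≤ y → 1ℚ ℚ.⊓ x ℚ.≤ clamp y ℚ.+ δ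
  upper (inj₁ y≤1) = ℚ.≤-trans (ℚ.p⊓q≤q 1ℚ x) (ℚ.≤-trans x≤y+δ (ℚ.+-monoˡ-≤ δ
    (subst (ℚ._≤ clamp y) (ℚ.p≥q⇒p⊓q≡q y≤1) (ℚ.p≤q⊔p 0ℚ (1ℚ ℚ.⊓ y)))))
  upper (inj₂ 1≤y) = ℚ.≤-trans (ℚ.p⊓q≤p 1ℚ x) (ℚ.≤-trans
    (subst (ℚ._≤ clamp y) (ℚ.p≤q⇒p⊓q≡p 1≤y) (ℚ.p≤q⊔p 0ℚ (1ℚ ℚ.⊓ y))) clamp≤+)

-- With u = x (1-x) and v = y (1-y), the difference 10 (u² - v²) factors; u - v is x - y times 1 - x
-- - y, hence at most δ in size, and u + v is at most 2.
P-shift : ∀ {x y δ} → 0ℚ ℚ.≤ x → x ℚ.≤ 1ℚ → 0ℚ ℚ.≤ y → y ℚ.≤ 1ℚ → 0ℚ ℚ.≤ δ → Close δ x y →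
          P x ℚ.≤ P y ℚ.+ ι (+ 20) ℚ.* δ
P-shift {x} {y} {δ} 0≤x x≤1 0≤y y≤1 0≤δ (x≤ ∼ y≤) = ≤-byℚ _
  (0≤+ℚ (0≤*ℚ (0≤*ℚ (ι-mono-≤ {+ 0} (0≤lit 5)) (0≤+ℚ (0≤u 0≤x x≤1) (0≤u 0≤y y≤1)))
              (0≤+ℚ (0≤*ℚ (0≤gapℚ x≤) (0≤+ℚ (0≤gapℚ x≤1) (0≤gapℚ y≤1))) (0≤*ℚ (0≤gapℚ y≤) (0≤+ℚ 0≤x 0≤y))))
        (0≤*ℚ (0≤*ℚ (ι-mono-≤ {+ 0} (0≤lit 10)) 0≤δ) (0≤+ℚ (u≤1 0≤x x≤1) (u≤1 0≤y y≤1))))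
  (identity x y δ)
  where
  0≤u : ∀ {x} → 0ℚ ℚ.≤ x → x ℚ.≤ 1ℚ → 0ℚ ℚ.≤ x ℚ.* (1ℚ ℚ.- x)
  0≤u 0≤x x≤1 = 0≤*ℚ 0≤x (0≤gapℚ x≤1)
  u≤1 : ∀ {x} → 0ℚ ℚ.≤ x → x ℚ.≤ 1ℚ → 0ℚ ℚ.≤ 1ℚ ℚ.- x ℚ.* (1ℚ ℚ.- x)
  u≤1 {x} 0≤x x≤1 = subst (0ℚ ℚ.≤_) (sym (expand x)) (0≤+ℚ (0≤gapℚ x≤1) (0≤*ℚ 0≤x 0≤x))
    where
    expand : ∀ x → 1ℚ ℚ.- x ℚ.* (1ℚ ℚ.- x) ≡ (1ℚ ℚ.- x) ℚ.+ x ℚ.* x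
    expand = solve 1 (λ x → con 1ℚ :- x :* (con 1ℚ :- x) := (con 1ℚ :- x) :+ x :* x) refl
  identity : ∀ x y δ → P y ℚ.+ ι (+ 20) ℚ.* δ ≡ P x ℚ.+
    (ι (+ 5) ℚ.* (x ℚ.* (1ℚ ℚ.- x) ℚ.+ y ℚ.* (1ℚ ℚ.- y)) ℚ.*
      ((y ℚ.+ δ ℚ.- x) ℚ.* ((1ℚ ℚ.- x) ℚ.+ (1ℚ ℚ.- y)) ℚ.+ (x ℚ.+ δ ℚ.- y) ℚ.* (x ℚ.+ y)) ℚ.+
     ι (+ 10) ℚ.* δ ℚ.* ((1ℚ ℚ.- x ℚ.* (1ℚ ℚ.- x)) ℚ.+ (1ℚ ℚ.- y ℚ.* (1ℚ ℚ.- y))))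
  identity = solve 3 (λ x y δ →
    con (ι (+ 10)) :* ((y :* (con 1ℚ :- y)) :* (y :* (con 1ℚ :- y))) :+ con (ι (+ 20)) :* δ :=
    con (ι (+ 10)) :* ((x :* (con 1ℚ :- x)) :* (x :* (con 1ℚ :- x))) :+
    (con (ι (+ 5)) :* (x :* (con 1ℚ :- x) :+ y :* (con 1ℚ :- y)) :*
      ((y :+ δ :- x) :* ((con 1ℚ :- x) :+ (con 1ℚ :- y)) :+ (x :+ δ :- y) :* (x :+ y)) :+
     con (ι (+ 10)) :* δ :* ((con 1ℚ :- x :* (con 1ℚ :- x)) :+ (con 1ℚ :- y :* (con 1ℚ :- y))))) refl

-- Clamping makes this Lipschitz on all of ℚ, so that it extends to every real
-- and not only to those between 0 and 1.
limitDensity : ℚ → ℚ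
limitDensity x = P (clamp x)

limitDensity-close : ∀ {x y δ} → 0ℚ ℚ.≤ δ → Close δ x y → Close (ι (+ 20) ℚ.* δ) (limitDensity x) (limitDensity y)
limitDensity-close {x} {y} {δ} 0≤δ (p ∼ q) =
  P-shift (0≤clamp x) (clamp≤1 x) (0≤clamp y) (clamp≤1 y) 0≤δ near ∼
  P-shift (0≤clamp y) (clamp≤1 y) (0≤clamp x) (clamp≤1 x) 0≤δ (close-sym near)
  where
  near : Close δ (clamp x) (clamp y)
  near = clamp-mono-shift {x} {y} 0≤δ p ∼ clamp-mono-shift {y} {x} 0≤δ q

0≤square : ∀ p → 0ℚ ℚ.≤ p ℚ.* p
0≤square p with ℚ.≤-total 0ℚ p
... | inj₁ 0≤p = 0≤*ℚ 0≤p 0≤p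
... | inj₂ p≤0 = subst (0ℚ ℚ.≤_) (flip p) (0≤*ℚ (0≤gapℚ p≤0) (0≤gapℚ p≤0))
  where
  flip : ∀ p → (0ℚ ℚ.- p) ℚ.* (0ℚ ℚ.- p) ≡ p ℚ.* p
  flip = solve 1 (λ p → (con 0ℚ :- p) :* (con 0ℚ :- p) := p :* p) refl

-- With u = c (1-c) one has 1/4 - u = (c - ½)², and 5/8 - 10 u² = 10 (1/4 - u) (1/4 + u).
limitDensity≤5/8 : ∀ x → limitDensity x ℚ.≤ + 5 / 8
limitDensity≤5/8 x = ≤-byℚ _ (0≤*ℚ (0≤*ℚ (ι-mono-≤ {+ 0} (0≤lit 10)) (0≤square (c ℚ.- ½)))
    (0≤+ℚ (ℚ.<⇒≤ (ℚ.positive⁻¹ (+ 1 / 4))) (0≤*ℚ (0≤clamp x) (0≤gapℚ (clamp≤1 x)))))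
  (identity c)
  where
  c : ℚ
  c = clamp x
  identity : ∀ c → + 5 / 8 ≡ P c ℚ.+
    ι (+ 10) ℚ.* ((c ℚ.- ½) ℚ.* (c ℚ.- ½)) ℚ.* (+ 1 / 4 ℚ.+ c ℚ.* (1ℚ ℚ.- c))
  identity = solve 1 (λ c → con (+ 5 / 8) :=
    con (ι (+ 10)) :* ((c :* (con 1ℚ :- c)) :* (c :* (con 1ℚ :- c))) :+
    con (ι (+ 10)) :* ((c :- con ½) :* (c :- con ½)) :* (con (+ 1 / 4) :+ c :* (con 1ℚ :- c))) refl

limit : ℝ → ℝ
limit x .seq i = limitDensity (seq x i)
limit x .cauchy ε 0<ε = let N , near = cauchy x δ 0<δ in N , λ i j N≤i N≤j →
  close⇒∣-∣ (subst (λ t → Close t (limitDensity (seq x i)) (limitDensity (seq x j))) (twenty ε)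
    (limitDensity-close (ℚ.<⇒≤ 0<δ) (∣-∣⇒close {seq x i} {seq x j} (near i j N≤i N≤j))))
  where
  δ : ℚ
  δ = (+ 1 / 20) ℚ.* ε
  0<δ : 0ℚ ℚ.< δ
  0<δ = 0<*ℚ (ℚ.positive⁻¹ (+ 1 / 20)) 0<ε
  twenty : ∀ ε → ι (+ 20) ℚ.* ((+ 1 / 20) ℚ.* ε) ≡ ε
  twenty = solve 1 (λ ε → con (ι (+ 20)) :* (con (+ 1 / 20) :* ε) := ε) refl

-- Equivalent to _⟶_, with all tolerances merged into one.
infix 4 _⇝_

_⇝_ : (ℕ → ℚ) → ℝ → Set
s ⇝ x = ∀ ε → 0ℚ ℚ.< ε → Σ[ N ∈ ℕ ] (∀ n → N ℕ.≤ n → Σ[ K ∈ ℕ ] (∀ i → K ℕ.≤ i → Close ε (s n) (seq x i)))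

half-pos : ∀ {ε} → 0ℚ ℚ.< ε → 0ℚ ℚ.< ½ ℚ.* ε
half-pos = 0<*ℚ (ℚ.positive⁻¹ ½)

halves : ∀ ε → ½ ℚ.* ε ℚ.+ ½ ℚ.* ε ≡ ε
halves = solve 1 (λ ε → con ½ :* ε :+ con ½ :* ε := ε) refl

⟶⇒⇝ : ∀ s x → s ⟶ x → s ⇝ x
⟶⇒⇝ s x s⟶x ε 0<ε = let N , near = s⟶x (½ ℚ.* ε) (half-pos 0<ε) in N , λ n N≤n →
  let lower , upper = near n N≤n
      K₁ , lo = lower (½ ℚ.* ε) (half-pos 0<ε)
      K₂ , hi = upper (½ ℚ.* ε) (half-pos 0<ε) in
  K₁ ℕ.⊔ K₂ , λ i K≤i →
    subst (λ t → s n ℚ.≤ seq x i ℚ.+ t) (halves ε)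
      (≤-byℚ _ (0≤gapℚ (lo i (ℕ.m⊔n≤o⇒m≤o K₁ K₂ K≤i))) (one (s n) (seq x i) (½ ℚ.* ε)))
    ∼ subst (λ t → seq x i ℚ.≤ s n ℚ.+ t) (halves ε)
      (subst (seq x i ℚ.≤_) (ℚ.+-assoc (s n) (½ ℚ.* ε) (½ ℚ.* ε)) (hi i (ℕ.m⊔n≤o⇒n≤o K₁ K₂ K≤i)))
  where
  one : ∀ s x h → x ℚ.+ (h ℚ.+ h) ≡ s ℚ.+ (x ℚ.+ h ℚ.- (s ℚ.- h))
  one = solve 3 (λ s x h → x :+ (h :+ h) := s :+ (x :+ h :- (s :- h))) refl

⇝⇒⟶ : ∀ s x → s ⇝ x → s ⟶ x
⇝⇒⟶ s x s⇝x ε 0<ε = let N , near = s⇝x ε 0<ε in N , λ n N≤n →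
  let K , close = near n N≤n in
  (λ η 0<η → K , λ i K≤i →
    ≤-byℚ _ (0≤+ℚ (0≤gapℚ (below (close i K≤i))) (ℚ.<⇒≤ 0<η)) (one (s n) (seq x i) ε η)) ,
  (λ η 0<η → K , λ i K≤i → ℚ.≤-trans (above (close i K≤i)) (≤-byℚ η (ℚ.<⇒≤ 0<η) refl))
  where
  one : ∀ s x ε η → x ℚ.+ η ≡ (s ℚ.- ε) ℚ.+ ((x ℚ.+ ε ℚ.- s) ℚ.+ η)
  one = solve 4 (λ s x ε η → x :+ η := (s :- ε) :+ ((x :+ ε :- s) :+ η)) refl

module _ {n : ℕ} (1≤n : + 1 ≤ + n) (c : Fin n → Fin 2) where

  ratio≤1 : ratio (partSize c zero) n ℚ.≤ 1ℚ
  ratio≤1 = cancel-≤ℚ (ι (+ n)) (ι-pos 1≤n)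
    (subst₂ ℚ._≤_ (sym (ratio-cancel (partSize c zero) n 1≤n)) (sym (ℚ.*-identityˡ (ι (+ n))))
      (ι-mono-≤ (partSize≤ c)))

  ratio-one : ratio (partSize c (suc zero)) n ≡ 1ℚ ℚ.- ratio (partSize c zero) n
  ratio-one = ℚ.≤-antisym (cancel-≤ℚ (ι (+ n)) (ι-pos 1≤n) (ℚ.≤-reflexive scaled))
                          (cancel-≤ℚ (ι (+ n)) (ι-pos 1≤n) (ℚ.≤-reflexive (sym scaled)))
    where
    open ≡-Reasoning
    a b : ℕ
    a = partSize c zero
    b = partSize c (suc zero)
    scaled : ratio b n ℚ.* ι (+ n) ≡ (1ℚ ℚ.- ratio a n) ℚ.* ι (+ n)
    scaled = begin
      ratio b n ℚ.* ι (+ n)                 ≡⟨ ratio-cancel b n 1≤n ⟩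
      ι (+ b)                               ≡⟨ cong ι (partSize-one c) ⟩
      ι (+ n - + a)                         ≡⟨ ι-- (+ n) (+ a) ⟩
      ι (+ n) ℚ.- ι (+ a)                   ≡⟨ cong (λ t → ι (+ n) ℚ.- t) (ratio-cancel a n 1≤n) ⟨
      ι (+ n) ℚ.- ratio a n ℚ.* ι (+ n)     ≡⟨ factor (ι (+ n)) (ratio a n) ⟩
      (1ℚ ℚ.- ratio a n) ℚ.* ι (+ n)        ∎
      where
      factor : ∀ m r → m ℚ.- r ℚ.* m ≡ (1ℚ ℚ.- r) ℚ.* m
      factor = solve 2 (λ m r → m :- r :* m := (con 1ℚ :- r) :* m) refl

density-close : ∀ n → + 20 ≤ + n → ∀ (c : Fin n → Fin 2) →
  Close (ι (+ 200) ℚ.* ratio 1 n) (density 5 4 (blowup twoLoops c)) (limitDensity (ratio (partSize c zero) n))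
density-close n 20≤n c = subst (λ t → Close (ι (+ 200) ℚ.* ratio 1 n) (density 5 4 (blowup twoLoops c)) (P t))
  (sym (clamp-id (0≤ratio (partSize c zero) n 1≤n) (ratio≤1 1≤n c)))
  (Estimates.density-upper n 20≤n c ∼ Estimates.density-lower n 20≤n c)
  where
  1≤n : + 1 ≤ + n
  1≤n = ≤-trans (+≤+ (ℕ.s≤s ℕ.z≤n)) 20≤n

blowupDensity : ∀ y → BlowupDensity 5 4 twoLoops y (limit (y zero))
blowupDensity y c converges = ⇝⇒⟶ (λ n → density 5 4 (blowup twoLoops (c n))) (limit (y zero)) λ ε 0<ε →
  let 0<ε/2     = half-pos 0<ε
      0<δ       = 0<*ℚ (ℚ.positive⁻¹ (+ 1 / 40)) 0<ε
      N₁ , near = ⟶⇒⇝ (λ n → ratio (partSize (c n) zero) n) (y zero) (converges zero) ((+ 1 / 40) ℚ.* ε) 0<δ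
      N₂ , arch = archimedean 200 (½ ℚ.* ε) 0<ε/2 in
  N₁ ℕ.⊔ N₂ , λ n N≤n →
    let 20≤n , small = arch n (ℕ.m⊔n≤o⇒n≤o N₁ N₂ N≤n)
        K , close    = near n (ℕ.m⊔n≤o⇒m≤o N₁ N₂ N≤n) in
    K , λ i K≤i → subst (λ t → Close t (density 5 4 (blowup twoLoops (c n))) (limitDensity (seq (y zero) i))) (total ε)
      (close-trans (close-weaken small (density-close n 20≤n (c n))) (limitDensity-close {ratio (partSize (c n) zero) n} {seq (y zero) i} (ℚ.<⇒≤ 0<δ) (close i K≤i)))
  where
  total : ∀ ε → ½ ℚ.* ε ℚ.+ ι (+ 20) ℚ.* ((+ 1 / 40) ℚ.* ε) ≡ ε
  total = solve 1 (λ ε → con ½ :* ε :+ con (ι (+ 20)) :* (con (+ 1 / 40) :* ε) := ε) refl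

floor : ∀ m r → 0ℚ ℚ.≤ r → r ℚ.≤ ι (+ m) → Σ[ k ∈ ℕ ] k ℕ.≤ m × ι (+ k) ℚ.≤ r × r ℚ.≤ ι (+ suc k)
floor zero    r 0≤r r≤0 = 0 , ℕ.z≤n , 0≤r , ℚ.≤-trans r≤0 (ι-mono-≤ {+ 0} {+ 1} (0≤lit 1))
floor (suc m) r 0≤r r≤m with ℚ.≤-total r (ι (+ m))
... | inj₁ r≤m′ = let k , k≤m , rest = floor m r 0≤r r≤m′ in k , ℕ.m≤n⇒m≤1+n k≤m , rest
... | inj₂ m≤r  = m , ℕ.n≤1+n m , m≤r , r≤m

clamp-floor : ∀ q n → Σ[ k ∈ ℕ ] k ℕ.≤ n × ι (+ k) ℚ.≤ clamp q ℚ.* ι (+ n) × clamp q ℚ.* ι (+ n) ℚ.≤ ι (+ suc k)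
clamp-floor q n = floor n (clamp q ℚ.* ι (+ n)) (0≤*ℚ (0≤clamp q) 0≤n)
  (subst (clamp q ℚ.* ι (+ n) ℚ.≤_) (ℚ.*-identityˡ (ι (+ n)))
    (ℚ.*-monoʳ-≤-nonNeg (ι (+ n)) {{ℚ.nonNegative 0≤n}} (clamp≤1 q)))
  where
  0≤n : 0ℚ ℚ.≤ ι (+ n)
  0≤n = ι-mono-≤ {+ 0} (0≤lit n)

-- The first part receives the rounded-down share of the n vertices; clamping keeps this number
-- between 0 and n for every rational `q`.
split : ℚ → ∀ n → Fin n → Fin 2
split q n = initial (proj₁ (clamp-floor q n))

split-close : ∀ q n → + 1 ≤ + n → Close (ratio 1 n) (ratio (partSize (split q n) zero) n) (clamp q)
split-close q n 1≤n with clamp-floor q n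
... | k , k≤n , lo , hi rewrite partSize-initial n k k≤n =
  ℚ.≤-trans low (≤-byℚ (ratio 1 n) (0≤ratio 1 n 1≤n) refl) ∼ cancel-≤ℚ (ι (+ n)) (ι-pos 1≤n) (subst (clamp q ℚ.* ι (+ n) ℚ.≤_) next hi)
  where
  low : ratio k n ℚ.≤ clamp q
  low = cancel-≤ℚ (ι (+ n)) (ι-pos 1≤n) (subst (ℚ._≤ clamp q ℚ.* ι (+ n)) (sym (ratio-cancel k n 1≤n)) lo)
  next : ι (+ suc k) ≡ (ratio k n ℚ.+ ratio 1 n) ℚ.* ι (+ n)
  next = trans (trans (cong ι (+-comm (+ 1) (+ k))) (ι-+ (+ k) (+ 1)))
    (sym (trans (ℚ.*-distribʳ-+ (ι (+ n)) (ratio k n) (ratio 1 n))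
                (cong₂ ℚ._+_ (ratio-cancel k n 1≤n) (ratio-cancel 1 n 1≤n))))

hasInducibility : HasInducibility 5 4 (fromℚ (+ 5 / 8))
-- 220 = 200 + 20: the error 200/n between density and limit, and the rounding error 1/n of an equal
-- split times the Lipschitz constant 20.
hasInducibility = ⇝⇒⟶ (maxDensity 5 4) (fromℚ (+ 5 / 8)) λ ε 0<ε → let N , arch = archimedean 220 ε 0<ε in N , λ n N≤n →
  let 20≤n , small = arch n N≤n in 0 , λ _ _ → lemma n ε 20≤n small
  where
  lemma : ∀ n ε → + 20 ≤ + n → ι (+ 220) ℚ.* ratio 1 n ℚ.≤ ε → Close ε (maxDensity 5 4 n) (+ 5 / 8)
  lemma n ε 20≤n small = ℚ.≤-trans (upper (maxDensity-attained 5 4 n)) (ℚ.+-monoʳ-≤ (+ 5 / 8) (ℚ.≤-trans 200≤220 small))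
    ∼ ℚ.≤-trans (above both) (ℚ.+-mono-≤ (density≤maxDensity 5 4 (blowup twoLoops c)) (ℚ.≤-trans (ℚ.≤-reflexive (sum220 (ratio 1 n))) small))
    where
    1≤n : + 1 ≤ + n
    1≤n = ≤-trans (+≤+ (ℕ.s≤s ℕ.z≤n)) 20≤n
    0≤ε : 0ℚ ℚ.≤ ratio 1 n
    0≤ε = 0≤ratio 1 n 1≤n
    200≤220 : ι (+ 200) ℚ.* ratio 1 n ℚ.≤ ι (+ 220) ℚ.* ratio 1 n
    200≤220 = ≤-byℚ _ (0≤*ℚ (ι-mono-≤ {+ 0} (0≤lit 20)) 0≤ε) (identity (ratio 1 n))
      where
      identity : ∀ e → ι (+ 220) ℚ.* e ≡ ι (+ 200) ℚ.* e ℚ.+ ι (+ 20) ℚ.* e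
      identity = solve 1 (λ e → con (ι (+ 220)) :* e := con (ι (+ 200)) :* e :+ con (ι (+ 20)) :* e) refl
    upper : Σ[ G ∈ Graph n ] density 5 4 G ≡ maxDensity 5 4 n →
            maxDensity 5 4 n ℚ.≤ + 5 / 8 ℚ.+ ι (+ 200) ℚ.* ratio 1 n
    upper (G , eq) = subst (ℚ._≤ + 5 / 8 ℚ.+ ι (+ 200) ℚ.* ratio 1 n) eq (Estimates.density≤ n 20≤n G)
    c : Fin n → Fin 2
    c = split ½ n
    both : Close (ι (+ 200) ℚ.* ratio 1 n ℚ.+ ι (+ 20) ℚ.* ratio 1 n) (density 5 4 (blowup twoLoops c)) (limitDensity ½)
    both = close-trans (density-close n 20≤n c) (limitDensity-close 0≤ε (split-close ½ n 1≤n))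
    sum220 : ∀ e → ι (+ 200) ℚ.* e ℚ.+ ι (+ 20) ℚ.* e ≡ ι (+ 220) ℚ.* e
    sum220 = solve 1 (λ e → con (ι (+ 200)) :* e :+ con (ι (+ 20)) :* e := con (ι (+ 220)) :* e) refl

clamp-close : ∀ {x η} → 0ℚ ℚ.≤ η → 0ℚ ℚ.≤ x ℚ.+ η → x ℚ.≤ 1ℚ ℚ.+ η → Close η (clamp x) x
clamp-close {x} {η} 0≤η lo hi =
  ℚ.⊔-lub lo (ℚ.≤-trans (ℚ.p⊓q≤q 1ℚ x) (≤-byℚ η 0≤η refl)) ∼ upper (ℚ.≤-total x 1ℚ)
  where
  upper : x ℚ.≤ 1ℚ ⊎ 1ℚ ℚ.≤ x → x ℚ.≤ clamp x ℚ.+ η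
  upper (inj₁ x≤1) = ℚ.≤-trans (subst (ℚ._≤ clamp x) (ℚ.p≥q⇒p⊓q≡q x≤1) (ℚ.p≤q⊔p 0ℚ (1ℚ ℚ.⊓ x))) (≤-byℚ η 0≤η refl)
  upper (inj₂ 1≤x) = ℚ.≤-trans hi (ℚ.+-monoˡ-≤ η
    (subst (ℚ._≤ clamp x) (ℚ.p≤q⇒p⊓q≡p 1≤x) (ℚ.p≤q⊔p 0ℚ (1ℚ ℚ.⊓ x))))

complement-close : ∀ {ε r y} → Close ε r (1ℚ ℚ.- y) → Close ε (1ℚ ℚ.- r) y
complement-close {ε} {r} {y} (p ∼ q) = ≤-byℚ _ (0≤gapℚ q) (one r y ε) ∼ ≤-byℚ _ (0≤gapℚ p) (two r y ε)
  where
  one : ∀ r y ε → y ℚ.+ ε ≡ (1ℚ ℚ.- r) ℚ.+ (r ℚ.+ ε ℚ.- (1ℚ ℚ.- y))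
  one = solve 3 (λ r y ε → y :+ ε := (con 1ℚ :- r) :+ (r :+ ε :- (con 1ℚ :- y))) refl
  two : ∀ r y ε → (1ℚ ℚ.- r) ℚ.+ ε ≡ y ℚ.+ ((1ℚ ℚ.- y) ℚ.+ ε ℚ.- r)
  two = solve 3 (λ r y ε → (con 1ℚ :- r) :+ ε := y :+ ((con 1ℚ :- y) :+ ε :- r)) refl

-- Colourings that realise a point of the simplex

module Simplex (y : Vector ℝ 2) (y∈ : InSimplex y) where

  y₀ y₁ : ℕ → ℚ
  y₀ = seq (y zero)
  y₁ = seq (y (suc zero))

  complement : ∀ ε → 0ℚ ℚ.< ε → Σ[ N ∈ ℕ ] (∀ i → N ℕ.≤ i → Close ε (y₀ i) (1ℚ ℚ.- y₁ i))
  complement ε 0<ε = let N₁ , p = proj₁ (proj₁ y∈) ε 0<ε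
                         N₂ , q = proj₂ (proj₁ y∈) ε 0<ε in
    N₁ ℕ.⊔ N₂ , λ i N≤i →
      ≤-byℚ _ (0≤gapℚ (p i (ℕ.m⊔n≤o⇒m≤o N₁ N₂ N≤i))) (one (y₀ i) (y₁ i) ε)
      ∼ ≤-byℚ _ (0≤gapℚ (q i (ℕ.m⊔n≤o⇒n≤o N₁ N₂ N≤i))) (two (y₀ i) (y₁ i) ε)
    where
    one : ∀ a b ε → (1ℚ ℚ.- b) ℚ.+ ε ≡ a ℚ.+ (1ℚ ℚ.+ ε ℚ.- (a ℚ.+ (b ℚ.+ 0ℚ)))
    one = solve 3 (λ a b ε → (con 1ℚ :- b) :+ ε := a :+ (con 1ℚ :+ ε :- (a :+ (b :+ con 0ℚ)))) refl
    two : ∀ a b ε → a ℚ.+ ε ≡ (1ℚ ℚ.- b) ℚ.+ ((a ℚ.+ (b ℚ.+ 0ℚ)) ℚ.+ ε ℚ.- 1ℚ)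
    two = solve 3 (λ a b ε → a :+ ε := (con 1ℚ :- b) :+ ((a :+ (b :+ con 0ℚ)) :+ ε :- con 1ℚ)) refl

  -- The rational terms of a coordinate may leave the unit interval, but eventually by at most 2 ε:
  -- one ε from the sum being 1 and one from the other coordinate being nonnegative.
  clamp-y₀ : ∀ ε → 0ℚ ℚ.< ε → Σ[ N ∈ ℕ ] (∀ i → N ℕ.≤ i → Close (ε ℚ.+ ε) (clamp (y₀ i)) (y₀ i))
  clamp-y₀ ε 0<ε = let N₁ , near = complement ε 0<ε
                       N₂ , 0≤y₀ = proj₂ y∈ zero ε 0<ε
                       N₃ , 0≤y₁ = proj₂ y∈ (suc zero) ε 0<ε in
    N₁ ℕ.⊔ (N₂ ℕ.⊔ N₃) , λ i N≤i →
      let N₂₃≤i = ℕ.m⊔n≤o⇒n≤o N₁ (N₂ ℕ.⊔ N₃) N≤i in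
      clamp-close (0≤+ℚ 0≤ε 0≤ε)
        (subst (0ℚ ℚ.≤_) (ℚ.+-assoc (y₀ i) ε ε) (0≤+ℚ (0≤y₀ i (ℕ.m⊔n≤o⇒m≤o N₂ N₃ N₂₃≤i)) 0≤ε))
        (≤-byℚ _ (0≤+ℚ (0≤gapℚ (below (near i (ℕ.m⊔n≤o⇒m≤o N₁ (N₂ ℕ.⊔ N₃) N≤i)))) (0≤y₁ i (ℕ.m⊔n≤o⇒n≤o N₂ N₃ N₂₃≤i)))
          (one (y₀ i) (y₁ i) ε))
    where
    0≤ε : 0ℚ ℚ.≤ ε
    0≤ε = ℚ.<⇒≤ 0<ε
    one : ∀ a b ε → 1ℚ ℚ.+ (ε ℚ.+ ε) ≡ a ℚ.+ (((1ℚ ℚ.- b) ℚ.+ ε ℚ.- a) ℚ.+ (b ℚ.+ ε))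
    one = solve 3 (λ a b ε → con 1ℚ :+ (ε :+ ε) := a :+ (((con 1ℚ :- b) :+ ε :- a) :+ (b :+ ε))) refl

  -- A real share is given only through rational terms, so the n-th colouring uses the n-th term;
  -- the Cauchy property makes the shares converge.
  splitting : ∀ n → Fin n → Fin 2
  splitting n = split (y₀ n) n

  splitting-zero : (λ n → ratio (partSize (splitting n) zero) n) ⇝ y zero
  splitting-zero ε 0<ε =
    -- One quarter of the tolerance covers rounding to a part size, two quarters the clamping, and
    -- one the passage from the n-th to the i-th term.
    let 0<δ       = 0<*ℚ (ℚ.positive⁻¹ (+ 1 / 4)) 0<ε
        δ         = (+ 1 / 4) ℚ.* ε
        N₁ , cau  = cauchy (y zero) δ 0<δ
        N₂ , near = clamp-y₀ δ 0<δ
        N₃ , arch = archimedean 1 δ 0<δ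
        N         = N₁ ℕ.⊔ (N₂ ℕ.⊔ N₃) in
    N , λ n N≤n → N , λ i N≤i →
      let N₂₃≤n      = ℕ.m⊔n≤o⇒n≤o N₁ (N₂ ℕ.⊔ N₃) N≤n
          20≤n , small = arch n (ℕ.m⊔n≤o⇒n≤o N₂ N₃ N₂₃≤n) in
      subst (λ t → Close t (ratio (partSize (splitting n) zero) n) (y₀ i)) (total ε)
        (close-trans
          (close-weaken (subst (ℚ._≤ δ) (ℚ.*-identityˡ (ratio 1 n)) small)
            (split-close (y₀ n) n (≤-trans (+≤+ (ℕ.s≤s ℕ.z≤n)) 20≤n)))
          (close-trans (near n (ℕ.m⊔n≤o⇒m≤o N₂ N₃ N₂₃≤n))
            (∣-∣⇒close (cau n i (ℕ.m⊔n≤o⇒m≤o N₁ (N₂ ℕ.⊔ N₃) N≤n) (ℕ.m⊔n≤o⇒m≤o N₁ (N₂ ℕ.⊔ N₃) N≤i)))))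
    where
    total : ∀ ε → let δ = (+ 1 / 4) ℚ.* ε in δ ℚ.+ ((δ ℚ.+ δ) ℚ.+ δ) ≡ ε
    total = solve 1 (λ ε → con (+ 1 / 4) :* ε :+ ((con (+ 1 / 4) :* ε :+ con (+ 1 / 4) :* ε) :+ con (+ 1 / 4) :* ε) := ε) refl

  splitting-one : (λ n → ratio (partSize (splitting n) (suc zero)) n) ⇝ y (suc zero)
  splitting-one ε 0<ε =
    let N₁ , near = splitting-zero (½ ℚ.* ε) (half-pos 0<ε)
        N₂ , comp = complement (½ ℚ.* ε) (half-pos 0<ε) in
    N₁ ℕ.⊔ 1 , λ n N≤n →
      let K , close = near n (ℕ.m⊔n≤o⇒m≤o N₁ 1 N≤n)
          1≤n       = +≤+ (ℕ.m⊔n≤o⇒n≤o N₁ 1 N≤n) in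
      K ℕ.⊔ N₂ , λ i K≤i →
        subst (λ t → Close ε t (y₁ i)) (sym (ratio-one 1≤n (splitting n)))
          (complement-close (subst (λ t → Close t (ratio (partSize (splitting n) zero) n) (1ℚ ℚ.- y₁ i)) (halves ε)
            (close-trans (close i (ℕ.m⊔n≤o⇒m≤o K N₂ K≤i)) (comp i (ℕ.m⊔n≤o⇒n≤o K N₂ K≤i)))))

  splitting-converges : ∀ i → (λ n → ratio (partSize (splitting n) i) n) ⟶ y i
  splitting-converges zero       = ⇝⇒⟶ (λ n → ratio (partSize (splitting n) zero) n) (y zero) splitting-zero
  splitting-converges (suc zero) = ⇝⇒⟶ (λ n → ratio (partSize (splitting n) (suc zero)) n) (y (suc zero)) splitting-one

-- The maximizer and its uniqueness

balancedPoint : Vector ℝ 2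
balancedPoint _ = fromℚ ½

balancedPoint∈ : InSimplex balancedPoint
balancedPoint∈ = ((λ ε 0<ε → 0 , λ _ _ → ≤-byℚ ε (ℚ.<⇒≤ 0<ε) refl) , (λ ε 0<ε → 0 , λ _ _ → ≤-byℚ ε (ℚ.<⇒≤ 0<ε) refl))
               , λ _ ε 0<ε → 0 , λ _ _ → 0≤+ℚ (ℚ.<⇒≤ (ℚ.positive⁻¹ ½)) (ℚ.<⇒≤ 0<ε)

balancedPoint-maximizer : IsMaximizer 5 4 twoLoops balancedPoint
balancedPoint-maximizer = balancedPoint∈ , limit (fromℚ ½) , blowupDensity balancedPoint , λ y _ →
  limit (y zero) , blowupDensity y , λ ε 0<ε → 0 , λ i _ →
    -- The limit at ½ evaluates to the constant sequence 5/8, so the comparison is termwise.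
    ℚ.≤-trans (limitDensity≤5/8 (seq (y zero) i)) (≤-byℚ ε (ℚ.<⇒≤ 0<ε) refl)

-- With t = 1 - 2x, the value of `P` is 5/8 (1 - t²)², so its deficit is 5/8 t² (2 - t²), at least
-- 5/8 t². A quadratic deficit is what turns an almost maximal density into a bound on the distance
-- of x from ½.
P-deficit : ∀ {x δ} → 0ℚ ℚ.≤ x → x ℚ.≤ 1ℚ → + 5 / 8 ℚ.≤ P x ℚ.+ δ →
            (+ 5 / 8) ℚ.* ((1ℚ ℚ.- (x ℚ.+ x)) ℚ.* (1ℚ ℚ.- (x ℚ.+ x))) ℚ.≤ δ
P-deficit {x} {δ} 0≤x x≤1 h = ≤-byℚ _
  (0≤+ℚ (0≤gapℚ h) (0≤*ℚ (0≤*ℚ (ℚ.<⇒≤ (ℚ.positive⁻¹ (+ 5 / 2))) (0≤*ℚ 0≤x (0≤gapℚ x≤1))) (0≤square (1ℚ ℚ.- (x ℚ.+ x)))))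
  (identity x δ)
  where
  identity : ∀ x δ → let t = 1ℚ ℚ.- (x ℚ.+ x) in
    δ ≡ (+ 5 / 8) ℚ.* (t ℚ.* t) ℚ.+ ((P x ℚ.+ δ ℚ.- + 5 / 8) ℚ.+ (+ 5 / 2) ℚ.* (x ℚ.* (1ℚ ℚ.- x)) ℚ.* (t ℚ.* t))
  identity = solve 2 (λ x δ → let t = con 1ℚ :- (x :+ x) in
    δ := con (+ 5 / 8) :* (t :* t) :+
      (((con (ι (+ 10)) :* ((x :* (con 1ℚ :- x)) :* (x :* (con 1ℚ :- x)))) :+ δ :- con (+ 5 / 8)) :+
       con (+ 5 / 2) :* (x :* (con 1ℚ :- x)) :* (t :* t))) refl

root-≤ : ∀ {t ε} → 0ℚ ℚ.< ε → t ℚ.* t ℚ.≤ ε ℚ.* ε → t ℚ.≤ ε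
root-≤ {t} {ε} 0<ε t²≤ε² with ℚ.≤-total t ε
... | inj₁ t≤ε = t≤ε
... | inj₂ ε≤t = cancel-≤ℚ ε 0<ε (ℚ.≤-trans
  (ℚ.*-monoˡ-≤-nonNeg t {{ℚ.nonNegative (ℚ.≤-trans (ℚ.<⇒≤ 0<ε) ε≤t)}} ε≤t) t²≤ε²)

near-half : ∀ {x ε} → 0ℚ ℚ.< ε → 0ℚ ℚ.≤ x → x ℚ.≤ 1ℚ →
            + 5 / 8 ℚ.≤ P x ℚ.+ (+ 5 / 8) ℚ.* (ε ℚ.* ε) → Close ε x ½
near-half {x} {ε} 0<ε 0≤x x≤1 h =
  ≤-byℚ _ (0≤+ℚ (0≤*ℚ 0≤½ (0≤gapℚ (root-≤ {ℚ.- t} 0<ε (subst (ℚ._≤ ε ℚ.* ε) (flip t) t²≤ε²)))) (0≤*ℚ 0≤½ (ℚ.<⇒≤ 0<ε))) (one x ε) ∼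
  ≤-byℚ _ (0≤+ℚ (0≤*ℚ 0≤½ (0≤gapℚ (root-≤ {t} 0<ε t²≤ε²))) (0≤*ℚ 0≤½ (ℚ.<⇒≤ 0<ε))) (two x ε)
  where
  t : ℚ
  t = 1ℚ ℚ.- (x ℚ.+ x)
  0≤½ : 0ℚ ℚ.≤ ½
  0≤½ = ℚ.<⇒≤ (ℚ.positive⁻¹ ½)
  t²≤ε² : t ℚ.* t ℚ.≤ ε ℚ.* ε
  t²≤ε² = ℚ.*-cancelˡ-≤-pos (+ 5 / 8) (P-deficit 0≤x x≤1 h)
  flip : ∀ t → t ℚ.* t ≡ (ℚ.- t) ℚ.* (ℚ.- t)
  flip = solve 1 (λ t → t :* t := (:- t) :* (:- t)) refl
  one : ∀ x ε → ½ ℚ.+ ε ≡ x ℚ.+ (½ ℚ.* (ε ℚ.- (ℚ.- (1ℚ ℚ.- (x ℚ.+ x)))) ℚ.+ ½ ℚ.* ε)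
  one = solve 2 (λ x ε → con ½ :+ ε := x :+ (con ½ :* (ε :- (:- (con 1ℚ :- (x :+ x)))) :+ con ½ :* ε)) refl
  two : ∀ x ε → x ℚ.+ ε ≡ ½ ℚ.+ (½ ℚ.* (ε ℚ.- (1ℚ ℚ.- (x ℚ.+ x))) ℚ.+ ½ ℚ.* ε)
  two = solve 2 (λ x ε → x :+ ε := con ½ :+ (con ½ :* (ε :- (con 1ℚ :- (x :+ x))) :+ con ½ :* ε)) refl

module Uniqueness (a : Vector ℝ 2) (a-max : IsMaximizer 5 4 twoLoops a) where

  open Simplex a (proj₁ a-max)

  private
    module Half = Simplex balancedPoint balancedPoint∈

    L L½ : ℝ
    L  = proj₁ (proj₂ a-max)
    L½ = proj₁ (proj₂ (proj₂ (proj₂ a-max)) balancedPoint balancedPoint∈)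

    density-a density-½ : ℕ → ℚ
    density-a n = density 5 4 (blowup twoLoops (splitting n))
    density-½ n = density 5 4 (blowup twoLoops (Half.splitting n))

    density-a⇝L : density-a ⇝ L
    density-a⇝L = ⟶⇒⇝ density-a L (proj₁ (proj₂ (proj₂ a-max)) splitting splitting-converges)

    density-½⇝L½ : density-½ ⇝ L½
    density-½⇝L½ = ⟶⇒⇝ density-½ L½
      (proj₁ (proj₂ (proj₂ (proj₂ (proj₂ a-max)) balancedPoint balancedPoint∈)) Half.splitting Half.splitting-converges)

    density-½⇝5/8 : density-½ ⇝ limit (fromℚ ½)
    density-½⇝5/8 = ⟶⇒⇝ density-½ (limit (fromℚ ½)) (blowupDensity balancedPoint Half.splitting Half.splitting-converges)

    L½≤L : L½ ≤ᴿ L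
    L½≤L = proj₂ (proj₂ (proj₂ (proj₂ (proj₂ a-max)) balancedPoint balancedPoint∈))

    -- `L` and `L½` are supplied by the hypothesis and known only as limits, so they are tested on
    -- explicit colourings: 5/8 is close to `density-½`, which is close to `L½`, which is at most
    -- `L`, which is close to `density-a`. Each link costs one δ.
    5/8≤density-a : ∀ δ → 0ℚ ℚ.< δ → Σ[ N ∈ ℕ ] (∀ n → N ℕ.≤ n →
                    + 5 / 8 ℚ.≤ density-a n ℚ.+ (δ ℚ.+ (δ ℚ.+ (δ ℚ.+ δ))))
    5/8≤density-a δ 0<δ =
      let N₁ , near₁ = density-½⇝5/8 δ 0<δ
          N₂ , near₂ = density-½⇝L½ δ 0<δ
          N₃ , near₃ = density-a⇝L δ 0<δ
          K₀ , L½≤   = L½≤L δ 0<δ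
          m          = N₁ ℕ.⊔ N₂
          K₁ , c₁    = near₁ m (ℕ.m≤m⊔n N₁ N₂)
          K₂ , c₂    = near₂ m (ℕ.m≤n⊔m N₁ N₂) in
      N₃ , λ n N≤n →
        let K₃ , c₃ = near₃ n N≤n
            i       = K₀ ℕ.⊔ (K₂ ℕ.⊔ K₃)
            K₂₃≤i   = ℕ.m≤n⊔m K₀ (K₂ ℕ.⊔ K₃) in
        -- The sequence of `limit (fromℚ ½)` is constant, so any admissible index serves for the
        -- first link, while the others share the index `i`.
        ≤-shift {limitDensity ½} {density-½ m} {density-a n} (above (c₁ K₁ ℕ.≤-refl))
          (≤-shift {density-½ m} {seq L½ i} {density-a n} (below (c₂ i (ℕ.≤-trans (ℕ.m≤m⊔n K₂ K₃) K₂₃≤i)))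
            (≤-shift {seq L½ i} {seq L i} {density-a n} (L½≤ i (ℕ.m≤m⊔n K₀ (K₂ ℕ.⊔ K₃)))
              (above (c₃ i (ℕ.≤-trans (ℕ.m≤n⊔m K₂ K₃) K₂₃≤i)))))

    ratio-near-half : ∀ ε → 0ℚ ℚ.< ε → Σ[ N ∈ ℕ ] (∀ n → N ℕ.≤ n → Close ε (ratio (partSize (splitting n) zero) n) ½)
    ratio-near-half ε 0<ε =
      -- Four δ from the chain above and a fifth from the error 200/n add up to 5/8 ε².
      let δ          = (+ 1 / 8) ℚ.* (ε ℚ.* ε)
          0<δ        = 0<*ℚ (ℚ.positive⁻¹ (+ 1 / 8)) (0<*ℚ 0<ε 0<ε)
          N₁ , big   = 5/8≤density-a δ 0<δ
          N₂ , arch  = archimedean 200 δ 0<δ in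
      N₁ ℕ.⊔ N₂ , λ n N≤n →
        let 20≤n , small = arch n (ℕ.m⊔n≤o⇒n≤o N₁ N₂ N≤n)
            1≤n          = ≤-trans (+≤+ (ℕ.s≤s ℕ.z≤n)) 20≤n
            r            = ratio (partSize (splitting n) zero) n in
        near-half 0<ε (0≤ratio (partSize (splitting n) zero) n 1≤n) (ratio≤1 1≤n (splitting n))
          (subst (λ t → + 5 / 8 ℚ.≤ P r ℚ.+ t) (total ε)
            (≤-shift {+ 5 / 8} {density-a n} {P r} (big n (ℕ.m⊔n≤o⇒m≤o N₁ N₂ N≤n))
              (ℚ.≤-trans (Estimates.density-upper n 20≤n (splitting n)) (ℚ.+-monoʳ-≤ (P r) small))))
      where
      total : ∀ ε → let δ = (+ 1 / 8) ℚ.* (ε ℚ.* ε) in (δ ℚ.+ (δ ℚ.+ (δ ℚ.+ δ))) ℚ.+ δ ≡ (+ 5 / 8) ℚ.* (ε ℚ.* ε)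
      total = solve 1 (λ ε → let δ = con (+ 1 / 8) :* (ε :* ε) in
        (δ :+ (δ :+ (δ :+ δ))) :+ δ := con (+ 5 / 8) :* (ε :* ε)) refl

    y₀-near-half : ∀ ε → 0ℚ ℚ.< ε → Σ[ K ∈ ℕ ] (∀ i → K ℕ.≤ i → Close ε (y₀ i) ½)
    y₀-near-half ε 0<ε =
      let N₁ , half  = ratio-near-half (½ ℚ.* ε) (half-pos 0<ε)
          N₂ , near  = splitting-zero (½ ℚ.* ε) (half-pos 0<ε)
          n          = N₁ ℕ.⊔ N₂
          K , close  = near n (ℕ.m≤n⊔m N₁ N₂) in
      K , λ i K≤i → subst (λ t → Close t (y₀ i) ½) (halves ε)
        (close-trans (close-sym (close i K≤i)) (half n (ℕ.m≤m⊔n N₁ N₂)))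

    y₁-near-half : ∀ ε → 0ℚ ℚ.< ε → Σ[ K ∈ ℕ ] (∀ i → K ℕ.≤ i → Close ε (y₁ i) ½)
    y₁-near-half ε 0<ε =
      let K₁ , near = y₀-near-half (½ ℚ.* ε) (half-pos 0<ε)
          K₂ , comp = complement (½ ℚ.* ε) (half-pos 0<ε) in
      K₁ ℕ.⊔ K₂ , λ i K≤i → close-sym (complement-close {ε} {½} {y₁ i}
        (subst (λ t → Close t ½ (1ℚ ℚ.- y₁ i)) (halves ε)
          (close-trans (close-sym (near i (ℕ.m⊔n≤o⇒m≤o K₁ K₂ K≤i))) (comp i (ℕ.m⊔n≤o⇒n≤o K₁ K₂ K≤i)))))

  maximizer-unique : ∀ i → a i ≃ᴿ fromℚ ½
  maximizer-unique zero =
    (λ ε 0<ε → let K , near = y₀-near-half ε 0<ε in K , λ i K≤i → below (near i K≤i)) ,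
    (λ ε 0<ε → let K , near = y₀-near-half ε 0<ε in K , λ i K≤i → above (near i K≤i))
  maximizer-unique (suc zero) =
    (λ ε 0<ε → let K , near = y₁-near-half ε 0<ε in K , λ i K≤i → below (near i K≤i)) ,
    (λ ε 0<ε → let K , near = y₁-near-half ε 0<ε in K , λ i K≤i → above (near i K≤i))

theorem3p6 : HasInducibility 5 4 (fromℚ (+ 5 / 8))
    × PerfectlyStable 5 4 twoLoops
    × IsMaximizer 5 4 twoLoops (λ _ → fromℚ ½)
    × ((a : Vector ℝ 2) → IsMaximizer 5 4 twoLoops a → (i : Fin 2) → a i ≃ᴿ fromℚ ½)
-- 89856 is twice the error constant 44928, the smallest value of `M` that `close-or-far` admits.
theorem3p6 = hasInducibility , perfectlyStable (+ 89856) ≤-refl , balancedPoint-maximizer , Uniqueness.maximizer-unique
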